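{- There exists a label-invariant property of distributions such that any adaptive testing algorithm for it must use at least $\Omega(\sqrt{\log\log n})$ conditional samples for some fixed $\epsilon$. That is, there exist constants $\epsilon>0$, $c>0$ and, for every $n$, a label-invariant set $\mathcal P_n$ of distributions over $[n]$, such that for all sufficiently large $n$ every adaptive distribution tester for $\mathcal P_n$, with distance parameter $\epsilon$ and error bound $\delta=\frac13$, must use at least $c\sqrt{\log\log n}$ conditional samples.
   Context: $[n]=\{1,\ldots,n\}$; the variation distance is $d(\mu,\mu')=\frac12\sum_{i=1}^n|\mu(i)-\mu'(i)|$. A property is a set of distributions over $[n]$; it is label-invariant if it is closed under permutations of the domain $[n]$. $\mu$ is $\epsilon$-far from $\mathcal P$ if $d(\mu,\mu')\ge\epsilon$ for every $\mu'\in\mathcal P$. A conditional sampling oracle for $\mu$ takes a nonempty set $A\subseteq[n]$ and returns $j\in A$ with probability $\mu(j)/\mu(A)$ if $\mu(A)>0$, and a uniformly random member of $A$ if $\mu(A)=0$, independently of all previous samples. An adaptive distribution tester for $\mathcal P$ (with parameters $\epsilon,\delta,n$) is a randomized algorithm that in each phase chooses a conditioning set based on the previously received samples and its internal coin tosses and receives the oracle's answer, and finally accepts or rejects based on the received samples and its coin tosses. It must accept with probability at least $1-\delta$ if $\mu\in\mathcal P$ and reject with probability at least $1-\delta$ if $\mu$ is $\epsilon$-far from $\mathcal P$. -}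

module Defs where

import Algebra.Definitions.RawMonoid as RawMonoidDefs
import Algebra.Definitions.RawSemiring as RawSemiringDefs
import Algebra.Properties.CommutativeSemiring.Exp as CommExp
open import Algebra.Bundles using (RawMonoid; CommutativeRing)
open import Data.Bool.Base using (if_then_else_)
open import Data.Fin.Base using (Fin)
open import Data.Fin.Permutation using (Permutation′; _⟨$⟩ʳ_)
open import Data.Fin.Subset using (Subset; Nonempty; _∈_; _∉_) renaming (∣_∣ to ∣_∣ₛ)
open import Data.Fin.Subset.Properties using (_∈?_)
import Data.Integer.Base as ℤ
import Data.Integer.Properties as ℤ
open import Data.Nat.Base as ℕ using (ℕ; zero; suc; z≤n; s≤s)
import Data.Nat.Coprimality as Coprime
import Data.Nat.Properties as ℕ
open import Data.Product.Base using (∃-syntax; _×_; _,_; proj₁; proj₂)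
open import Data.Rational as ℚ using (ℚ; 0ℚ; 1ℚ; ½)
import Data.Rational.Properties as ℚ
import Data.Rational.Unnormalised.Base as ℚᵘ
import Data.Rational.Unnormalised.Properties as ℚᵘ
open import Data.Rational.Solver using (module +-*-Solver)
open import Data.Sum.Base using (inj₁; inj₂)
open import Level using (0ℓ)
open import Relation.Binary.PropositionalEquality
open import Relation.Nullary using (does; yes; no; contradiction)
open import Relation.Unary using (Pred)

natℚ : ℕ → ℚ
natℚ n = ℤ.+ n ℚ./ 1

2ℚ : ℚ
2ℚ = natℚ 2

infixr 8 _^_
_^_ : ℚ → ℕ → ℚ
_^_ = RawSemiringDefs._^_ ℚ.+-*-rawSemiring

greatestUpTo : (ℕ → ℚ) → ℚ → ℕ → ℕ
greatestUpTo g p zero    = zero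
greatestUpTo g p (suc b) with g (suc b) ℚ.≤? p
... | yes _ = suc b
... | no _  = greatestUpTo g p b

-- The greatest j with g j ≤ p, for nondecreasing g with g 0 ≤ p and j ≤ g j
-- for all j.  The last condition is what justifies the search bound.
floorInverse : (ℕ → ℚ) → ℚ → ℕ
floorInverse g p = greatestUpTo g p ℤ.∣ ℚ.↥ p ∣

-- The multiple a / 2ᵏ of 1 / 2ᵏ with a / 2ᵏ ≤ log₂ (max 1 p) < (a + 1) / 2ᵏ.
log₂-approx : ℕ → ℚ → ℚ
log₂-approx k p =
  natℚ (floorInverse (2ℚ ^_) ((1ℚ ℚ.⊔ p) ^ (2 ℕ.^ k))) ℚ.* ½ ^ k

-- The multiple a / 2ᵏ of 1 / 2ᵏ with a / 2ᵏ ≤ √ (max 0 p) < (a + 1) / 2ᵏ.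
√-approx : ℕ → ℚ → ℚ
√-approx k p =
  natℚ (floorInverse (λ j → natℚ j ℚ.* natℚ j) ((0ℚ ℚ.⊔ p) ℚ.* (2ℚ ^ k ℚ.* 2ℚ ^ k)))
    ℚ.* ½ ^ k

IsCauchy : (ℕ → ℚ) → Set
IsCauchy x = ∀ ε → 0ℚ ℚ.< ε →
  ∃[ N ] (∀ m n → N ℕ.≤ m → N ℕ.≤ n → ℚ.∣ x m ℚ.- x n ∣ ℚ.≤ ε)

module RationalLemmas where
  open import Data.Rational.Base using (_+_; _*_; -_; _-_; _≤_; _<_; _⊔_; ↥_; mkℚ; ∣_∣)
  open import Data.Rational.Properties using (module ≤-Reasoning)
  open ≤-Reasoning
  open CommExp (CommutativeRing.commutativeSemiring ℚ.+-*-commutativeRing)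
    using (^-homo-*; ^-assocʳ; ^-distrib-*)
  open +-*-Solver using (solve; _:+_; _:*_; _:-_; :-_; _:=_; con)

  natℚ-mkℚ : ∀ n → natℚ n ≡ mkℚ (ℤ.+ n) 0 (Coprime.sym (Coprime.1-coprimeTo n))
  natℚ-mkℚ n = ℚ.normalize-coprime _

  natℚ-mono : ∀ {m n} → m ℕ.≤ n → natℚ m ≤ natℚ n
  natℚ-mono {m} {n} m≤n = subst₂ _≤_ (sym (natℚ-mkℚ m)) (sym (natℚ-mkℚ n))
    (ℚ.*≤* (ℤ.*-monoʳ-≤-nonNeg (ℤ.+ 1) (ℤ.+≤+ m≤n)))

  natℚ-suc : ∀ n → natℚ (suc n) ≡ 1ℚ + natℚ n
  natℚ-suc n = sym (trans (cong (1ℚ +_) (natℚ-mkℚ n))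
    (cong (ℚ._/ 1) (cong₂ ℤ._+_ {x = ℤ.+ 1} refl (ℤ.*-identityʳ (ℤ.+ n)))))

  0≤natℚ : ∀ n → 0ℚ ≤ natℚ n
  0≤natℚ n = natℚ-mono {0} {n} z≤n

  natℚ-+ : ∀ m n → natℚ (m ℕ.+ n) ≡ natℚ m + natℚ n
  natℚ-+ zero n = sym (ℚ.+-identityˡ (natℚ n))
  natℚ-+ (suc m) n = begin-equality
    natℚ (suc (m ℕ.+ n))        ≡⟨ natℚ-suc (m ℕ.+ n) ⟩
    1ℚ + natℚ (m ℕ.+ n)         ≡⟨ cong (1ℚ +_) (natℚ-+ m n) ⟩
    1ℚ + (natℚ m + natℚ n)      ≡⟨ ℚ.+-assoc 1ℚ (natℚ m) (natℚ n) ⟨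
    1ℚ + natℚ m + natℚ n        ≡⟨ cong (_+ natℚ n) (natℚ-suc m) ⟨
    natℚ (suc m) + natℚ n       ∎

  natℚ-* : ∀ m n → natℚ (m ℕ.* n) ≡ natℚ m * natℚ n
  natℚ-* zero n = sym (ℚ.*-zeroˡ (natℚ n))
  natℚ-* (suc m) n = begin-equality
    natℚ (n ℕ.+ m ℕ.* n)        ≡⟨ natℚ-+ n (m ℕ.* n) ⟩
    natℚ n + natℚ (m ℕ.* n)     ≡⟨ cong (natℚ n +_) (natℚ-* m n) ⟩
    natℚ n + natℚ m * natℚ n    ≡⟨ solve 2 (λ a b → b :+ a :* b := (con 1ℚ :+ a) :* b) refl (natℚ m) (natℚ n) ⟩
    (1ℚ + natℚ m) * natℚ n      ≡⟨ cong (_* natℚ n) (natℚ-suc m) ⟨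
    natℚ (suc m) * natℚ n       ∎

  natℚ-^ : ∀ n → natℚ (2 ℕ.^ n) ≡ 2ℚ ^ n
  natℚ-^ zero = refl
  natℚ-^ (suc n) = trans (natℚ-* 2 (2 ℕ.^ n)) (cong (2ℚ *_) (natℚ-^ n))

  *-mono : ∀ {a b c d} → 0ℚ ≤ a → a ≤ b → 0ℚ ≤ c → c ≤ d → a * c ≤ b * d
  *-mono {a} {b} {c} {d} 0≤a a≤b 0≤c c≤d = ℚ.≤-trans
    (ℚ.*-monoʳ-≤-nonNeg c {{ℚ.nonNegative 0≤c}} a≤b)
    (ℚ.*-monoˡ-≤-nonNeg b {{ℚ.nonNegative (ℚ.≤-trans 0≤a a≤b)}} c≤d)

  *-0≤ : ∀ {a b} → 0ℚ ≤ a → 0ℚ ≤ b → 0ℚ ≤ a * b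
  *-0≤ {a} {b} 0≤a 0≤b = subst (_≤ a * b) (ℚ.*-zeroˡ 0ℚ)
    (*-mono ℚ.≤-refl 0≤a ℚ.≤-refl 0≤b)

  *-0< : ∀ {a b} → 0ℚ < a → 0ℚ < b → 0ℚ < a * b
  *-0< {a} {b} 0<a 0<b = ℚ.positive⁻¹ (a * b)
    {{ℚ.pos*pos⇒pos a {{ℚ.positive 0<a}} b {{ℚ.positive 0<b}}}}

  +-0≤ : ∀ {a b} → 0ℚ ≤ a → 0ℚ ≤ b → 0ℚ ≤ a + b
  +-0≤ = ℚ.+-mono-≤

  square-cancel : ∀ {x y} → 0ℚ ≤ y → x * x ≤ y * y → x ≤ y
  square-cancel {x} {y} 0≤y x²≤y² = ℚ.≮⇒≥ λ y<x → ℚ.<-irrefl refl (begin-strict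
    x * x  ≤⟨ x²≤y² ⟩
    y * y  ≤⟨ ℚ.*-monoˡ-≤-nonNeg y {{ℚ.nonNegative 0≤y}} (ℚ.<⇒≤ y<x) ⟩
    y * x  <⟨ ℚ.*-monoˡ-<-pos x {{ℚ.positive (ℚ.≤-<-trans 0≤y y<x)}} y<x ⟩
    x * x  ∎)

  ∣∣⇒≤ : ∀ {x y ε} → ∣ x - y ∣ ≤ ε → x ≤ y + ε
  ∣∣⇒≤ {x} {y} {ε} h = begin
    x            ≡⟨ solve 2 (λ a b → a := b :+ (a :- b)) refl x y ⟩
    y + (x - y)  ≤⟨ ℚ.+-monoʳ-≤ y (ℚ.≤-trans (p≤∣p∣ (x - y)) h) ⟩
    y + ε        ∎
    where
    p≤∣p∣ : ∀ p → p ≤ ∣ p ∣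
    p≤∣p∣ p with ℚ.≤-total 0ℚ p
    ... | inj₁ 0≤p = ℚ.≤-reflexive (sym (ℚ.0≤p⇒∣p∣≡p 0≤p))
    ... | inj₂ p≤0 = ℚ.≤-trans p≤0 (ℚ.0≤∣p∣ p)

  ≤⇒∣∣ : ∀ {x y ε} → x ≤ y + ε → y ≤ x + ε → ∣ x - y ∣ ≤ ε
  ≤⇒∣∣ {x} {y} {ε} x≤ y≤ with ℚ.∣p∣≡p∨∣p∣≡-p (x - y)
  ... | inj₁ e = begin
    ∣ x - y ∣      ≡⟨ e ⟩
    x - y          ≤⟨ ℚ.+-monoˡ-≤ (- y) x≤ ⟩
    y + ε - y      ≡⟨ solve 2 (λ b c → b :+ c :- b := c) refl y ε ⟩
    ε              ∎
  ... | inj₂ e = begin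
    ∣ x - y ∣      ≡⟨ e ⟩
    - (x - y)      ≡⟨ solve 2 (λ a b → :- (a :- b) := b :- a) refl x y ⟩
    y - x          ≤⟨ ℚ.+-monoˡ-≤ (- x) y≤ ⟩
    x + ε - x      ≡⟨ solve 2 (λ b c → b :+ c :- b := c) refl x ε ⟩
    ε              ∎

  ^-0≤ : ∀ {a} n → 0ℚ ≤ a → 0ℚ ≤ a ^ n
  ^-0≤ zero 0≤a = natℚ-mono {0} {1} z≤n
  ^-0≤ (suc n) 0≤a = *-0≤ 0≤a (^-0≤ n 0≤a)

  ^-0< : ∀ {a} n → 0ℚ < a → 0ℚ < a ^ n
  ^-0< zero 0<a = ℚ.positive⁻¹ 1ℚ
  ^-0< (suc n) 0<a = *-0< 0<a (^-0< n 0<a)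

  ^-monoˡ : ∀ {a b} n → 0ℚ ≤ a → a ≤ b → a ^ n ≤ b ^ n
  ^-monoˡ zero 0≤a a≤b = ℚ.≤-refl
  ^-monoˡ (suc n) 0≤a a≤b = *-mono 0≤a a≤b (^-0≤ n 0≤a) (^-monoˡ n 0≤a a≤b)

  0≤1 : 0ℚ ≤ 1ℚ
  0≤1 = natℚ-mono {0} {1} z≤n

  0≤2 : 0ℚ ≤ 2ℚ
  0≤2 = natℚ-mono {0} {2} z≤n

  1<2 : 1ℚ < 2ℚ
  1<2 = ℚ.*<* (ℤ.+<+ (s≤s (s≤s z≤n)))

  1≤^ : ∀ {a} n → 1ℚ ≤ a → 1ℚ ≤ a ^ n
  1≤^ zero 1≤a = ℚ.≤-refl
  1≤^ (suc n) 1≤a = *-mono 0≤1 1≤a 0≤1 (1≤^ n 1≤a)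

  2^-mono : ∀ {m n} → m ℕ.≤ n → 2ℚ ^ m ≤ 2ℚ ^ n
  2^-mono {m} {n} m≤n = subst₂ _≤_ (natℚ-^ m) (natℚ-^ n)
    (natℚ-mono (ℕ.^-monoʳ-≤ 2 m≤n))

  2^-cancel : ∀ {m n} → 2ℚ ^ m ≤ 2ℚ ^ n → m ℕ.≤ n
  2^-cancel {m} {n} h = ℕ.≮⇒≥ λ n<m → ℚ.<-irrefl refl (begin-strict
    2ℚ ^ n      ≡⟨ ℚ.*-identityˡ (2ℚ ^ n) ⟨
    1ℚ * 2ℚ ^ n <⟨ ℚ.*-monoˡ-<-pos (2ℚ ^ n) {{ℚ.positive (^-0< n (ℚ.positive⁻¹ 2ℚ))}} 1<2 ⟩
    2ℚ ^ suc n  ≤⟨ 2^-mono n<m ⟩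
    2ℚ ^ m      ≤⟨ h ⟩
    2ℚ ^ n      ∎)

  1^ : ∀ n → 1ℚ ^ n ≡ 1ℚ
  1^ zero = refl
  1^ (suc n) = trans (ℚ.*-identityˡ (1ℚ ^ n)) (1^ n)

  2^*½^ : ∀ n → 2ℚ ^ n * ½ ^ n ≡ 1ℚ
  2^*½^ n = trans (sym (^-distrib-* 2ℚ ½ n)) (1^ n)

  0<½^ : ∀ n → 0ℚ < ½ ^ n
  0<½^ n = ^-0< n (ℚ.positive⁻¹ ½)

  0≤½^ : ∀ n → 0ℚ ≤ ½ ^ n
  0≤½^ n = ℚ.<⇒≤ (0<½^ n)

  ½^-anti : ∀ {m n} → m ℕ.≤ n → ½ ^ n ≤ ½ ^ m
  ½^-anti {n = n} z≤n = subst (½ ^ n ≤_) (1^ n)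
    (^-monoˡ n (ℚ.<⇒≤ (ℚ.positive⁻¹ ½)) (ℚ.*≤* (ℤ.+≤+ (s≤s z≤n))))
  ½^-anti (s≤s m≤n) = ℚ.*-monoˡ-≤-nonNeg ½ (½^-anti m≤n)

  n≤2ⁿ : ∀ n → n ℕ.≤ 2 ℕ.^ n
  n≤2ⁿ zero = z≤n
  n≤2ⁿ (suc n) = ℕ.+-mono-≤ (ℕ.m^n>0 2 n) (subst (n ℕ.≤_) (sym (ℕ.+-identityʳ _)) (n≤2ⁿ n))

  n≤2^n : ∀ n → natℚ n ≤ 2ℚ ^ n
  n≤2^n n = subst (natℚ n ≤_) (natℚ-^ n) (natℚ-mono (n≤2ⁿ n))

  archimedean : ∀ {ε} → 0ℚ < ε → ∃[ p ] ½ ^ p ≤ ε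
  archimedean {ε@(mkℚ (ℤ.+ 0) d c)} 0<ε = contradiction (ℚ.drop-*<* 0<ε) λ { (ℤ.+<+ ()) }
  archimedean {mkℚ ℤ.-[1+ n ] d c} 0<ε = contradiction (ℚ.drop-*<* 0<ε) λ ()
  archimedean {ε@(mkℚ (ℤ.+ suc n) d c)} 0<ε = suc d , (begin
    ½ ^ suc d                              ≡⟨ ℚ.*-identityʳ (½ ^ suc d) ⟨
    ½ ^ suc d * 1ℚ                         ≤⟨ ℚ.*-monoˡ-≤-nonNeg (½ ^ suc d) {{ℚ.nonNegative (0≤½^ (suc d))}} 1≤ ⟩
    ½ ^ suc d * (2ℚ ^ suc d * ε)           ≡⟨ solve 3 (λ a b e → a :* (b :* e) := b :* a :* e) refl (½ ^ suc d) (2ℚ ^ suc d) ε ⟩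
    2ℚ ^ suc d * ½ ^ suc d * ε             ≡⟨ cong (_* ε) (2^*½^ (suc d)) ⟩
    1ℚ * ε                                 ≡⟨ ℚ.*-identityˡ ε ⟩
    ε                                      ∎)
    where
    step : 1ℚ ≤ mkℚ (ℤ.+ suc d) 0 (Coprime.sym (Coprime.1-coprimeTo (suc d))) * ε
    step = ℚ.toℚᵘ-cancel-≤ (ℚᵘ.≤-trans
      (ℚᵘ.*≤* (ℤ.+≤+ (ℕ.≤-trans (ℕ.≤-reflexive (trans (ℕ.+-identityʳ _) (trans (ℕ.+-identityʳ _) (sym (ℕ.*-identityʳ (suc d))))))
        (ℕ.≤-trans (ℕ.*-monoʳ-≤ (suc d) (s≤s (z≤n {n}))) (ℕ.≤-reflexive (sym (ℕ.*-identityʳ _)))))))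
      (ℚᵘ.≤-reflexive (ℚᵘ.≃-sym (ℚ.toℚᵘ-homo-* (mkℚ (ℤ.+ suc d) 0 (Coprime.sym (Coprime.1-coprimeTo (suc d)))) ε))))

    1≤ : 1ℚ ≤ 2ℚ ^ suc d * ε
    1≤ = ℚ.≤-trans (subst (λ q → 1ℚ ≤ q * ε) (sym (natℚ-mkℚ (suc d))) step)
      (ℚ.*-monoʳ-≤-nonNeg ε (n≤2^n (suc d)))

  p<1+↥p : ∀ {p} → 0ℚ ≤ p → p < natℚ (suc ℤ.∣ ↥ p ∣)
  p<1+↥p {mkℚ (ℤ.+ n) d c} _ = subst (mkℚ (ℤ.+ n) d c <_) (sym (natℚ-mkℚ (suc n)))
    (ℚ.*<* (subst₂ ℤ._<_ (sym (ℤ.*-identityʳ (ℤ.+ n))) refl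
      (ℤ.+<+ (ℕ.≤-trans (ℕ.n<1+n n) (ℕ.m≤m*n (suc n) (suc d))))))
  p<1+↥p {mkℚ ℤ.-[1+ n ] d c} 0≤p = contradiction (ℚ.drop-*≤* 0≤p) λ ()

  module _ {g : ℕ → ℚ} {p : ℚ} (g0≤p : g 0 ≤ p) where
    greatest-lower : ∀ b → g (greatestUpTo g p b) ≤ p
    greatest-lower zero = g0≤p
    greatest-lower (suc b) with g (suc b) ℚ.≤? p
    ... | yes h = h
    ... | no _  = greatest-lower b

    greatest-upper : ∀ b → p < g (suc b) → p < g (suc (greatestUpTo g p b))
    greatest-upper zero h = h
    greatest-upper (suc b) h with g (suc b) ℚ.≤? p
    ... | yes _ = h
    ... | no h′ = greatest-upper b (ℚ.≰⇒> h′)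

    module _ (0≤p : 0ℚ ≤ p) (j≤gj : ∀ j → natℚ j ≤ g j) where
      inverse-lower : g (floorInverse g p) ≤ p
      inverse-lower = greatest-lower ℤ.∣ ↥ p ∣

      inverse-upper : p < g (suc (floorInverse g p))
      inverse-upper = greatest-upper ℤ.∣ ↥ p ∣
        (ℚ.<-≤-trans (p<1+↥p 0≤p) (j≤gj (suc ℤ.∣ ↥ p ∣)))

  clamp-shift : ∀ {c r s δ} → 0ℚ ≤ δ → r ≤ s + δ → c ⊔ r ≤ (c ⊔ s) + δ
  clamp-shift {c} {r} {s} {δ} 0≤δ r≤ = ℚ.⊔-lub
    (begin c             ≡⟨ ℚ.+-identityʳ c ⟨
           c + 0ℚ        ≤⟨ ℚ.+-mono-≤ (ℚ.p≤p⊔q c s) 0≤δ ⟩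
           (c ⊔ s) + δ   ∎)
    (ℚ.≤-trans r≤ (ℚ.+-monoˡ-≤ δ (ℚ.p≤q⊔p c s)))

  approximants-cauchy :
    (u : ℕ → ℚ → ℚ) (δ : ℕ → ℚ) → (∀ p → 0ℚ < δ p) →
    (∀ p k l r s → p ℕ.≤ k → p ℕ.≤ l → r ≤ s + δ p → u k r ≤ u l s + (½ ^ p + ½ ^ p)) →
    ∀ {x} → IsCauchy x → IsCauchy (λ k → u k (x k))
  approximants-cauchy u δ 0<δ close {x} x-cauchy ε 0<ε =
    p ℕ.⊔ N , λ m n m≥ n≥ → ≤⇒∣∣ (one-sided m n m≥ n≥) (one-sided n m n≥ m≥)
    where
    small = archimedean (*-0< (ℚ.positive⁻¹ ½) 0<ε)
    p = proj₁ small
    N = proj₁ (x-cauchy (δ p) (0<δ p))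

    2½^p≤ε : ½ ^ p + ½ ^ p ≤ ε
    2½^p≤ε = begin
      ½ ^ p + ½ ^ p    ≤⟨ ℚ.+-mono-≤ (proj₂ small) (proj₂ small) ⟩
      ½ * ε + ½ * ε    ≡⟨ ℚ.*-distribʳ-+ ε ½ ½ ⟨
      1ℚ * ε           ≡⟨ ℚ.*-identityˡ ε ⟩
      ε                ∎

    one-sided : ∀ m n → p ℕ.⊔ N ℕ.≤ m → p ℕ.⊔ N ℕ.≤ n → u m (x m) ≤ u n (x n) + ε
    one-sided m n m≥ n≥ = ℚ.≤-trans
      (close p m n (x m) (x n) (ℕ.m⊔n≤o⇒m≤o p N m≥) (ℕ.m⊔n≤o⇒m≤o p N n≥)
        (∣∣⇒≤ (proj₂ (x-cauchy (δ p) (0<δ p)) m n (ℕ.m⊔n≤o⇒n≤o p N m≥) (ℕ.m⊔n≤o⇒n≤o p N n≥))))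
      (ℚ.+-monoʳ-≤ (u n (x n)) 2½^p≤ε)

  module _ (k : ℕ) (p : ℚ) where
    private
      q = (1ℚ ⊔ p) ^ (2 ℕ.^ k)
      1≤q : 1ℚ ≤ q
      1≤q = 1≤^ (2 ℕ.^ k) (ℚ.p≤p⊔q 1ℚ p)

    log₂-index : ℕ
    log₂-index = floorInverse (2ℚ ^_) q

    log₂-lower : 2ℚ ^ log₂-index ≤ (1ℚ ⊔ p) ^ (2 ℕ.^ k)
    log₂-lower = inverse-lower {2ℚ ^_} 1≤q (ℚ.≤-trans 0≤1 1≤q) n≤2^n

    log₂-upper : (1ℚ ⊔ p) ^ (2 ℕ.^ k) < 2ℚ ^ suc log₂-index
    log₂-upper = inverse-upper {2ℚ ^_} 1≤q (ℚ.≤-trans 0≤1 1≤q) n≤2^n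

  ⅓ : ℚ
  ⅓ = ℤ.+ 1 ℚ./ 3

  0<⅓^ : ∀ p → 0ℚ < ⅓ ^ p
  0<⅓^ p = ^-0< p (ℚ.positive⁻¹ ⅓)

  ⅓^≤1 : ∀ p → ⅓ ^ p ≤ 1ℚ
  ⅓^≤1 zero = ℚ.≤-refl
  ⅓^≤1 (suc p) = *-mono {⅓} {1ℚ} (ℚ.<⇒≤ (ℚ.positive⁻¹ ⅓)) (ℚ.*≤* (ℤ.+≤+ (s≤s z≤n)))
    (ℚ.<⇒≤ (0<⅓^ p)) (⅓^≤1 p)

  [1+⅓^p]^2^p≤2 : ∀ p → (1ℚ + ⅓ ^ p) ^ (2 ℕ.^ p) ≤ 2ℚ
  [1+⅓^p]^2^p≤2 zero = ℚ.≤-refl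
  [1+⅓^p]^2^p≤2 (suc p) = begin
    (1ℚ + ⅓ * e) ^ (2 ℕ.* 2 ℕ.^ p)      ≡⟨ ^-assocʳ (1ℚ + ⅓ * e) 2 (2 ℕ.^ p) ⟨
    ((1ℚ + ⅓ * e) ^ 2) ^ (2 ℕ.^ p)      ≤⟨ ^-monoˡ (2 ℕ.^ p) (^-0≤ 2 (+-0≤ 0≤1 (*-0≤ 0≤⅓ 0≤e))) step ⟩
    (1ℚ + e) ^ (2 ℕ.^ p)                ≤⟨ [1+⅓^p]^2^p≤2 p ⟩
    2ℚ                                  ∎
    where
    e = ⅓ ^ p
    0≤e = ℚ.<⇒≤ (0<⅓^ p)
    0≤⅓ = ℚ.<⇒≤ (ℚ.positive⁻¹ ⅓)
    step : (1ℚ + ⅓ * e) ^ 2 ≤ 1ℚ + e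
    step = begin
      (1ℚ + ⅓ * e) * ((1ℚ + ⅓ * e) * 1ℚ)
        ≡⟨ solve 1 (λ e → (con 1ℚ :+ con ⅓ :* e) :* ((con 1ℚ :+ con ⅓ :* e) :* con 1ℚ)
                       := con 1ℚ :+ con (⅓ + ⅓) :* e :+ con (⅓ * ⅓) :* (e :* e)) refl e ⟩
      1ℚ + (⅓ + ⅓) * e + (⅓ * ⅓) * (e * e)
        ≤⟨ ℚ.+-monoʳ-≤ (1ℚ + (⅓ + ⅓) * e) (*-mono {⅓ * ⅓} {⅓} (ℚ.<⇒≤ (ℚ.positive⁻¹ (⅓ * ⅓)))
             (ℚ.*≤* (ℤ.+≤+ (ℕ.m≤m+n 3 6))) (*-0≤ 0≤e 0≤e) (*-mono 0≤e (⅓^≤1 p) 0≤e ℚ.≤-refl)) ⟩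
      1ℚ + (⅓ + ⅓) * e + ⅓ * (1ℚ * e)
        ≡⟨ solve 1 (λ e → con 1ℚ :+ con (⅓ + ⅓) :* e :+ con ⅓ :* (con 1ℚ :* e) := con 1ℚ :+ e) refl e ⟩
      1ℚ + e ∎

  log₂-close : ∀ p k l r s → p ℕ.≤ k → p ℕ.≤ l → r ≤ s + ⅓ ^ p →
    log₂-approx k r ≤ log₂-approx l s + (½ ^ p + ½ ^ p)
  log₂-close p k l r s p≤k p≤l r≤s+δ = begin
    natℚ a * ½ ^ k
      ≡⟨ ℚ.*-identityʳ (natℚ a * ½ ^ k) ⟨
    natℚ a * ½ ^ k * 1ℚ
      ≡⟨ cong (natℚ a * ½ ^ k *_) (2^*½^ l) ⟨
    natℚ a * ½ ^ k * (2ℚ ^ l * ½ ^ l)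
      ≡⟨ solve 4 (λ a k m l → a :* k :* (m :* l) := a :* m :* (k :* l)) refl (natℚ a) (½ ^ k) (2ℚ ^ l) (½ ^ l) ⟩
    natℚ a * 2ℚ ^ l * (½ ^ k * ½ ^ l)
      ≤⟨ ℚ.*-monoʳ-≤-nonNeg (½ ^ k * ½ ^ l) {{ℚ.nonNegative (*-0≤ (0≤½^ k) (0≤½^ l))}} numerators ⟩
    ((1ℚ + natℚ b) * 2ℚ ^ k + 2ℚ ^ j * 2ℚ ^ l) * (½ ^ k * ½ ^ l)
      ≡⟨ solve 6 (λ b K J L hk hl → ((con 1ℚ :+ b) :* K :+ J :* L) :* (hk :* hl)
                                  := (con 1ℚ :+ b) :* hl :* (K :* hk) :+ J :* hk :* (L :* hl))
           refl (natℚ b) (2ℚ ^ k) (2ℚ ^ j) (2ℚ ^ l) (½ ^ k) (½ ^ l) ⟩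
    (1ℚ + natℚ b) * ½ ^ l * (2ℚ ^ k * ½ ^ k) + 2ℚ ^ j * ½ ^ k * (2ℚ ^ l * ½ ^ l)
      ≡⟨ cong₂ (λ x y → (1ℚ + natℚ b) * ½ ^ l * x + 2ℚ ^ j * ½ ^ k * y) (2^*½^ k) (2^*½^ l) ⟩
    (1ℚ + natℚ b) * ½ ^ l * 1ℚ + 2ℚ ^ j * ½ ^ k * 1ℚ
      ≡⟨ cong (λ x → (1ℚ + natℚ b) * ½ ^ l * 1ℚ + x * 1ℚ) 2^j*½^k ⟩
    (1ℚ + natℚ b) * ½ ^ l * 1ℚ + ½ ^ p * 1ℚ
      ≡⟨ solve 3 (λ b hl hp → (con 1ℚ :+ b) :* hl :* con 1ℚ :+ hp :* con 1ℚ := b :* hl :+ (hl :+ hp))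
           refl (natℚ b) (½ ^ l) (½ ^ p) ⟩
    natℚ b * ½ ^ l + (½ ^ l + ½ ^ p)
      ≤⟨ ℚ.+-monoʳ-≤ (natℚ b * ½ ^ l) (ℚ.+-monoˡ-≤ (½ ^ p) (½^-anti p≤l)) ⟩
    natℚ b * ½ ^ l + (½ ^ p + ½ ^ p) ∎
    where
    a = log₂-index k r
    b = log₂-index l s
    j = k ℕ.∸ p
    R = 1ℚ ⊔ r
    S = 1ℚ ⊔ s
    t = 1ℚ + ⅓ ^ p
    0≤δ = ℚ.<⇒≤ (0<⅓^ p)

    p+j : p ℕ.+ j ≡ k
    p+j = ℕ.m+[n∸m]≡n p≤k

    2^j*½^k : 2ℚ ^ j * ½ ^ k ≡ ½ ^ p
    2^j*½^k = begin-equality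
      2ℚ ^ j * ½ ^ k              ≡⟨ cong (λ i → 2ℚ ^ j * ½ ^ i) p+j ⟨
      2ℚ ^ j * ½ ^ (p ℕ.+ j)      ≡⟨ cong (2ℚ ^ j *_) (^-homo-* ½ p j) ⟩
      2ℚ ^ j * (½ ^ p * ½ ^ j)    ≡⟨ solve 3 (λ x y z → x :* (y :* z) := y :* (x :* z)) refl (2ℚ ^ j) (½ ^ p) (½ ^ j) ⟩
      ½ ^ p * (2ℚ ^ j * ½ ^ j)    ≡⟨ cong (½ ^ p *_) (2^*½^ j) ⟩
      ½ ^ p * 1ℚ                  ≡⟨ ℚ.*-identityʳ (½ ^ p) ⟩
      ½ ^ p                       ∎

    R≤St : R ≤ S * t
    R≤St = begin
      R                   ≤⟨ clamp-shift {1ℚ} {r} {s} 0≤δ r≤s+δ ⟩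
      S + ⅓ ^ p           ≡⟨ cong (S +_) (ℚ.*-identityˡ (⅓ ^ p)) ⟨
      S + 1ℚ * ⅓ ^ p      ≤⟨ ℚ.+-monoʳ-≤ S (ℚ.*-monoʳ-≤-nonNeg (⅓ ^ p) {{ℚ.nonNegative 0≤δ}} (ℚ.p≤p⊔q 1ℚ s)) ⟩
      S + S * ⅓ ^ p       ≡⟨ solve 2 (λ s d → s :+ s :* d := s :* (con 1ℚ :+ d)) refl S (⅓ ^ p) ⟩
      S * t               ∎

    0≤R : 0ℚ ≤ R
    0≤R = ℚ.≤-trans 0≤1 (ℚ.p≤p⊔q 1ℚ r)
    0≤S : 0ℚ ≤ S
    0≤S = ℚ.≤-trans 0≤1 (ℚ.p≤p⊔q 1ℚ s)
    0≤t : 0ℚ ≤ t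
    0≤t = +-0≤ 0≤1 0≤δ

    S-part : S ^ (2 ℕ.^ k ℕ.* 2 ℕ.^ l) ≤ 2ℚ ^ (suc b ℕ.* 2 ℕ.^ k)
    S-part = begin
      S ^ (2 ℕ.^ k ℕ.* 2 ℕ.^ l)      ≡⟨ cong (S ^_) (ℕ.*-comm (2 ℕ.^ k) (2 ℕ.^ l)) ⟩
      S ^ (2 ℕ.^ l ℕ.* 2 ℕ.^ k)      ≡⟨ ^-assocʳ S (2 ℕ.^ l) (2 ℕ.^ k) ⟨
      (S ^ (2 ℕ.^ l)) ^ (2 ℕ.^ k)    ≤⟨ ^-monoˡ (2 ℕ.^ k) (^-0≤ (2 ℕ.^ l) 0≤S) (ℚ.<⇒≤ (log₂-upper l s)) ⟩
      (2ℚ ^ suc b) ^ (2 ℕ.^ k)       ≡⟨ ^-assocʳ 2ℚ (suc b) (2 ℕ.^ k) ⟩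
      2ℚ ^ (suc b ℕ.* 2 ℕ.^ k)       ∎

    t-part : t ^ (2 ℕ.^ k ℕ.* 2 ℕ.^ l) ≤ 2ℚ ^ (2 ℕ.^ j ℕ.* 2 ℕ.^ l)
    t-part = begin
      t ^ (2 ℕ.^ k ℕ.* 2 ℕ.^ l)                    ≡⟨ cong (λ i → t ^ (2 ℕ.^ i ℕ.* 2 ℕ.^ l)) p+j ⟨
      t ^ (2 ℕ.^ (p ℕ.+ j) ℕ.* 2 ℕ.^ l)            ≡⟨ cong (λ i → t ^ (i ℕ.* 2 ℕ.^ l)) (ℕ.^-distribˡ-+-* 2 p j) ⟩
      t ^ (2 ℕ.^ p ℕ.* 2 ℕ.^ j ℕ.* 2 ℕ.^ l)        ≡⟨ cong (t ^_) (ℕ.*-assoc (2 ℕ.^ p) (2 ℕ.^ j) (2 ℕ.^ l)) ⟩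
      t ^ (2 ℕ.^ p ℕ.* (2 ℕ.^ j ℕ.* 2 ℕ.^ l))      ≡⟨ ^-assocʳ t (2 ℕ.^ p) _ ⟨
      (t ^ (2 ℕ.^ p)) ^ (2 ℕ.^ j ℕ.* 2 ℕ.^ l)      ≤⟨ ^-monoˡ (2 ℕ.^ j ℕ.* 2 ℕ.^ l) (^-0≤ (2 ℕ.^ p) 0≤t) ([1+⅓^p]^2^p≤2 p) ⟩
      2ℚ ^ (2 ℕ.^ j ℕ.* 2 ℕ.^ l)                   ∎

    exponents : a ℕ.* 2 ℕ.^ l ℕ.≤ suc b ℕ.* 2 ℕ.^ k ℕ.+ 2 ℕ.^ j ℕ.* 2 ℕ.^ l
    exponents = 2^-cancel (begin
      2ℚ ^ (a ℕ.* 2 ℕ.^ l)                                         ≡⟨ ^-assocʳ 2ℚ a (2 ℕ.^ l) ⟨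
      (2ℚ ^ a) ^ (2 ℕ.^ l)                                         ≤⟨ ^-monoˡ (2 ℕ.^ l) (^-0≤ a 0≤2) (log₂-lower k r) ⟩
      (R ^ (2 ℕ.^ k)) ^ (2 ℕ.^ l)                                  ≡⟨ ^-assocʳ R (2 ℕ.^ k) (2 ℕ.^ l) ⟩
      R ^ (2 ℕ.^ k ℕ.* 2 ℕ.^ l)                                    ≤⟨ ^-monoˡ (2 ℕ.^ k ℕ.* 2 ℕ.^ l) 0≤R R≤St ⟩
      (S * t) ^ (2 ℕ.^ k ℕ.* 2 ℕ.^ l)                              ≡⟨ ^-distrib-* S t (2 ℕ.^ k ℕ.* 2 ℕ.^ l) ⟩
      S ^ (2 ℕ.^ k ℕ.* 2 ℕ.^ l) * t ^ (2 ℕ.^ k ℕ.* 2 ℕ.^ l)        ≤⟨ *-mono (^-0≤ (2 ℕ.^ k ℕ.* 2 ℕ.^ l) 0≤S) S-part (^-0≤ (2 ℕ.^ k ℕ.* 2 ℕ.^ l) 0≤t) t-part ⟩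
      2ℚ ^ (suc b ℕ.* 2 ℕ.^ k) * 2ℚ ^ (2 ℕ.^ j ℕ.* 2 ℕ.^ l)        ≡⟨ ^-homo-* 2ℚ (suc b ℕ.* 2 ℕ.^ k) (2 ℕ.^ j ℕ.* 2 ℕ.^ l) ⟨
      2ℚ ^ (suc b ℕ.* 2 ℕ.^ k ℕ.+ 2 ℕ.^ j ℕ.* 2 ℕ.^ l)             ∎)

    numerators : natℚ a * 2ℚ ^ l ≤ (1ℚ + natℚ b) * 2ℚ ^ k + 2ℚ ^ j * 2ℚ ^ l
    numerators = begin
      natℚ a * 2ℚ ^ l
        ≡⟨ cong (natℚ a *_) (natℚ-^ l) ⟨
      natℚ a * natℚ (2 ℕ.^ l)
        ≡⟨ natℚ-* a (2 ℕ.^ l) ⟨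
      natℚ (a ℕ.* 2 ℕ.^ l)
        ≤⟨ natℚ-mono exponents ⟩
      natℚ (suc b ℕ.* 2 ℕ.^ k ℕ.+ 2 ℕ.^ j ℕ.* 2 ℕ.^ l)
        ≡⟨ natℚ-+ (suc b ℕ.* 2 ℕ.^ k) (2 ℕ.^ j ℕ.* 2 ℕ.^ l) ⟩
      natℚ (suc b ℕ.* 2 ℕ.^ k) + natℚ (2 ℕ.^ j ℕ.* 2 ℕ.^ l)
        ≡⟨ cong₂ _+_ (natℚ-* (suc b) (2 ℕ.^ k)) (natℚ-* (2 ℕ.^ j) (2 ℕ.^ l)) ⟩
      natℚ (suc b) * natℚ (2 ℕ.^ k) + natℚ (2 ℕ.^ j) * natℚ (2 ℕ.^ l)
        ≡⟨ cong₂ _+_ (cong₂ _*_ (natℚ-suc b) (natℚ-^ k)) (cong₂ _*_ (natℚ-^ j) (natℚ-^ l)) ⟩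
      (1ℚ + natℚ b) * 2ℚ ^ k + 2ℚ ^ j * 2ℚ ^ l ∎

  natℚ≤square : ∀ j → natℚ j ≤ natℚ j * natℚ j
  natℚ≤square j = subst (natℚ j ≤_) (natℚ-* j j) (natℚ-mono (j≤j*j j))
    where
    j≤j*j : ∀ j → j ℕ.≤ j ℕ.* j
    j≤j*j zero = z≤n
    j≤j*j (suc j) = ℕ.m≤m*n (suc j) (suc j)

  4^-cancel : ∀ k x → x * (2ℚ ^ k * 2ℚ ^ k) * (½ ^ k * ½ ^ k) ≡ x
  4^-cancel k x = begin-equality
    x * (2ℚ ^ k * 2ℚ ^ k) * (½ ^ k * ½ ^ k)
      ≡⟨ solve 3 (λ x p h → x :* (p :* p) :* (h :* h) := x :* ((p :* h) :* (p :* h))) refl x (2ℚ ^ k) (½ ^ k) ⟩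
    x * ((2ℚ ^ k * ½ ^ k) * (2ℚ ^ k * ½ ^ k))
      ≡⟨ cong (λ y → x * (y * y)) (2^*½^ k) ⟩
    x * 1ℚ
      ≡⟨ ℚ.*-identityʳ x ⟩
    x ∎

  module _ (k : ℕ) (p : ℚ) where
    private
      q = (0ℚ ⊔ p) * (2ℚ ^ k * 2ℚ ^ k)
      0≤q : 0ℚ ≤ q
      0≤q = *-0≤ (ℚ.p≤p⊔q 0ℚ p) (*-0≤ (^-0≤ k 0≤2) (^-0≤ k 0≤2))
      sq : ℕ → ℚ
      sq j = natℚ j * natℚ j
      i = floorInverse sq q

      unscale : ∀ {x y} → x * x ≤ y → x * ½ ^ k * (x * ½ ^ k) ≤ y * (½ ^ k * ½ ^ k)
      unscale {x} {y} h = subst (_≤ y * (½ ^ k * ½ ^ k))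
        (solve 2 (λ x h → x :* x :* (h :* h) := x :* h :* (x :* h)) refl x (½ ^ k))
        (ℚ.*-monoʳ-≤-nonNeg (½ ^ k * ½ ^ k) {{ℚ.nonNegative (*-0≤ (0≤½^ k) (0≤½^ k))}} h)

    √-lower : √-approx k p * √-approx k p ≤ 0ℚ ⊔ p
    √-lower = subst (√-approx k p * √-approx k p ≤_) (4^-cancel k (0ℚ ⊔ p))
      (unscale {natℚ i} {q} (inverse-lower {sq} 0≤q 0≤q natℚ≤square))

    √-upper : 0ℚ ⊔ p ≤ (√-approx k p + ½ ^ k) * (√-approx k p + ½ ^ k)
    √-upper = begin
      0ℚ ⊔ p
        ≡⟨ 4^-cancel k (0ℚ ⊔ p) ⟨
      q * (½ ^ k * ½ ^ k)
        ≤⟨ ℚ.*-monoʳ-≤-nonNeg (½ ^ k * ½ ^ k) {{ℚ.nonNegative (*-0≤ (0≤½^ k) (0≤½^ k))}}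
             (ℚ.<⇒≤ (inverse-upper {sq} 0≤q 0≤q natℚ≤square)) ⟩
      natℚ (suc i) * natℚ (suc i) * (½ ^ k * ½ ^ k)
        ≡⟨ cong (λ x → x * x * (½ ^ k * ½ ^ k)) (natℚ-suc i) ⟩
      (1ℚ + natℚ i) * (1ℚ + natℚ i) * (½ ^ k * ½ ^ k)
        ≡⟨ solve 2 (λ x h → (con 1ℚ :+ x) :* (con 1ℚ :+ x) :* (h :* h)
                         := (x :* h :+ h) :* (x :* h :+ h)) refl (natℚ i) (½ ^ k) ⟩
      (√-approx k p + ½ ^ k) * (√-approx k p + ½ ^ k) ∎

  √-close : ∀ p k l r s → p ℕ.≤ k → p ℕ.≤ l → r ≤ s + ½ ^ p * ½ ^ p →
    √-approx k r ≤ √-approx l s + (½ ^ p + ½ ^ p)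
  √-close p k l r s p≤k p≤l r≤ = square-cancel
    (+-0≤ 0≤v (+-0≤ (0≤½^ p) (0≤½^ p)))
    (begin
      u * u                                      ≤⟨ √-lower k r ⟩
      0ℚ ⊔ r                                     ≤⟨ clamp-shift {0ℚ} {r} {s} (*-0≤ (0≤½^ p) (0≤½^ p)) r≤ ⟩
      (0ℚ ⊔ s) + e * e                           ≤⟨ ℚ.+-monoˡ-≤ (e * e) (√-upper l s) ⟩
      (v + f) * (v + f) + e * e                  ≤⟨ ℚ.+-monoˡ-≤ (e * e) (*-mono (+-0≤ 0≤v (0≤½^ l)) v+f≤v+e (+-0≤ 0≤v (0≤½^ l)) v+f≤v+e) ⟩
      (v + e) * (v + e) + e * e                  ≡⟨ ℚ.+-identityʳ _ ⟨
      (v + e) * (v + e) + e * e + 0ℚ             ≤⟨ ℚ.+-monoʳ-≤ ((v + e) * (v + e) + e * e) (+-0≤ 0≤[v+e]e 0≤[v+e]e) ⟩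
      (v + e) * (v + e) + e * e + ((v + e) * e + (v + e) * e)
        ≡⟨ solve 2 (λ v e → (v :+ e) :* (v :+ e) :+ e :* e :+ ((v :+ e) :* e :+ (v :+ e) :* e)
                         := (v :+ (e :+ e)) :* (v :+ (e :+ e))) refl v e ⟩
      (v + (e + e)) * (v + (e + e))              ∎)
    where
    u = √-approx k r
    v = √-approx l s
    e = ½ ^ p
    f = ½ ^ l
    0≤v : 0ℚ ≤ v
    0≤v = *-0≤ (0≤natℚ (floorInverse (λ j → natℚ j * natℚ j) ((0ℚ ⊔ s) * (2ℚ ^ l * 2ℚ ^ l)))) (0≤½^ l)
    v+f≤v+e : v + f ≤ v + e
    v+f≤v+e = ℚ.+-monoʳ-≤ v (½^-anti p≤l)
    0≤[v+e]e : 0ℚ ≤ (v + e) * e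
    0≤[v+e]e = *-0≤ (+-0≤ 0≤v (0≤½^ p)) (0≤½^ p)

  const-cauchy : ∀ q → IsCauchy (λ _ → q)
  const-cauchy q ε 0<ε = 0 , λ _ _ _ _ → ≤⇒∣∣ {q} {q} q≤q+ε q≤q+ε
    where
    q≤q+ε : q ≤ q + ε
    q≤q+ε = ℚ.≤-trans (ℚ.≤-reflexive (sym (ℚ.+-identityʳ q))) (ℚ.+-monoʳ-≤ q (ℚ.<⇒≤ 0<ε))

  +-cauchy : ∀ {x y} → IsCauchy x → IsCauchy y → IsCauchy (λ n → x n + y n)
  +-cauchy {x} {y} cx cy ε 0<ε = N ℕ.⊔ M , λ m n m≥ n≥ →
    let h₁ = proj₂ (cx ε′ 0<ε′) m n (ℕ.m⊔n≤o⇒m≤o N M m≥) (ℕ.m⊔n≤o⇒m≤o N M n≥)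
        h₂ = proj₂ (cy ε′ 0<ε′) m n (ℕ.m⊔n≤o⇒n≤o N M m≥) (ℕ.m⊔n≤o⇒n≤o N M n≥)
    in begin
      ∣ x m + y m - (x n + y n) ∣        ≡⟨ cong ∣_∣ (solve 4 (λ a b c d → a :+ b :- (c :+ d) := (a :- c) :+ (b :- d)) refl (x m) (y m) (x n) (y n)) ⟩
      ∣ (x m - x n) + (y m - y n) ∣      ≤⟨ ℚ.∣p+q∣≤∣p∣+∣q∣ (x m - x n) (y m - y n) ⟩
      ∣ x m - x n ∣ + ∣ y m - y n ∣      ≤⟨ ℚ.+-mono-≤ h₁ h₂ ⟩
      ½ * ε + ½ * ε                      ≡⟨ ℚ.*-distribʳ-+ ε ½ ½ ⟨
      1ℚ * ε                             ≡⟨ ℚ.*-identityˡ ε ⟩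
      ε                                  ∎
    where
    ε′ = ½ * ε
    0<ε′ = *-0< (ℚ.positive⁻¹ ½) 0<ε
    N = proj₁ (cx ε′ 0<ε′)
    M = proj₁ (cy ε′ 0<ε′)

  neg-cauchy : ∀ {x} → IsCauchy x → IsCauchy (λ n → - x n)
  neg-cauchy {x} cx ε 0<ε = proj₁ (cx ε 0<ε) , λ m n m≥ n≥ → begin
    ∣ - x m - - x n ∣    ≡⟨ cong ∣_∣ (solve 2 (λ a b → :- a :- :- b := b :- a) refl (x m) (x n)) ⟩
    ∣ x n - x m ∣        ≤⟨ proj₂ (cx ε 0<ε) n m n≥ m≥ ⟩
    ε                    ∎

  ∣x∣≤∣y∣+ε : ∀ {x y ε} → ∣ x - y ∣ ≤ ε → ∣ x ∣ ≤ ∣ y ∣ + ε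
  ∣x∣≤∣y∣+ε {x} {y} {ε} h = begin
    ∣ x ∣                ≡⟨ cong ∣_∣ (solve 2 (λ a b → a := b :+ (a :- b)) refl x y) ⟩
    ∣ y + (x - y) ∣      ≤⟨ ℚ.∣p+q∣≤∣p∣+∣q∣ y (x - y) ⟩
    ∣ y ∣ + ∣ x - y ∣    ≤⟨ ℚ.+-monoʳ-≤ ∣ y ∣ h ⟩
    ∣ y ∣ + ε            ∎

  abs-cauchy : ∀ {x} → IsCauchy x → IsCauchy (λ n → ∣ x n ∣)
  abs-cauchy {x} cx ε 0<ε = proj₁ (cx ε 0<ε) , λ m n m≥ n≥ →
    ≤⇒∣∣ {∣ x m ∣} {∣ x n ∣}
      (∣x∣≤∣y∣+ε {x m} {x n} (proj₂ (cx ε 0<ε) m n m≥ n≥))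
      (∣x∣≤∣y∣+ε {x n} {x m} (proj₂ (cx ε 0<ε) n m n≥ m≥))

  cauchy-bound : ∀ {x} → IsCauchy x → ∃[ N ] ∃[ B ] (0ℚ ≤ B × (∀ n → N ℕ.≤ n → ∣ x n ∣ ≤ B))
  cauchy-bound {x} cx = N , ∣ x N ∣ + 1ℚ , +-0≤ (ℚ.0≤∣p∣ (x N)) 0≤1 ,
    λ n n≥ → ∣x∣≤∣y∣+ε {x n} {x N} (proj₂ (cx 1ℚ (ℚ.positive⁻¹ 1ℚ)) n N n≥ ℕ.≤-refl)
    where
    N = proj₁ (cx 1ℚ (ℚ.positive⁻¹ 1ℚ))

  *-close : ∀ {a b c d A B ε δ} →
    ∣ a ∣ ≤ A → ∣ d ∣ ≤ B → ∣ a - c ∣ ≤ δ → ∣ b - d ∣ ≤ δ → (A + B) * δ ≤ ε →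
    ∣ a * b - c * d ∣ ≤ ε
  *-close {a} {b} {c} {d} {A} {B} {ε} {δ} ha hd hac hbd h = begin
    ∣ a * b - c * d ∣
      ≡⟨ cong ∣_∣ (solve 4 (λ a b c d → a :* b :- c :* d := a :* (b :- d) :+ (a :- c) :* d) refl a b c d) ⟩
    ∣ a * (b - d) + (a - c) * d ∣
      ≤⟨ ℚ.∣p+q∣≤∣p∣+∣q∣ (a * (b - d)) ((a - c) * d) ⟩
    ∣ a * (b - d) ∣ + ∣ (a - c) * d ∣
      ≡⟨ cong₂ _+_ (ℚ.∣p*q∣≡∣p∣*∣q∣ a (b - d)) (ℚ.∣p*q∣≡∣p∣*∣q∣ (a - c) d) ⟩
    ∣ a ∣ * ∣ b - d ∣ + ∣ a - c ∣ * ∣ d ∣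
      ≤⟨ ℚ.+-mono-≤ (*-mono {∣ a ∣} {A} {∣ b - d ∣} {δ} (ℚ.0≤∣p∣ a) ha (ℚ.0≤∣p∣ (b - d)) hbd)
                    (*-mono {∣ a - c ∣} {δ} {∣ d ∣} {B} (ℚ.0≤∣p∣ (a - c)) hac (ℚ.0≤∣p∣ d) hd) ⟩
    A * δ + δ * B
      ≡⟨ solve 3 (λ a e b → a :* e :+ e :* b := (a :+ b) :* e) refl A δ B ⟩
    (A + B) * δ
      ≤⟨ h ⟩
    ε ∎

  scale-down : ∀ {B ε} → 0ℚ ≤ B → 0ℚ < ε → ∃[ δ ] (0ℚ < δ × B * δ ≤ ε)
  scale-down {B} {ε} 0≤B 0<ε =
    r * ε , *-0< (ℚ.positive⁻¹ r {{ℚ.1/pos⇒pos C {{ℚ.positive 0<C}}}}) 0<ε , (begin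
      B * (r * ε)    ≡⟨ ℚ.*-assoc B r ε ⟨
      B * r * ε      ≤⟨ ℚ.*-monoʳ-≤-nonNeg ε {{ℚ.nonNegative (ℚ.<⇒≤ 0<ε)}} Br≤1 ⟩
      1ℚ * ε         ≡⟨ ℚ.*-identityˡ ε ⟩
      ε              ∎)
    where
    C = B + 1ℚ
    0<C : 0ℚ < C
    0<C = ℚ.+-mono-≤-< 0≤B (ℚ.positive⁻¹ 1ℚ)
    r = ℚ.1/_ C {{ℚ.>-nonZero 0<C}}
    Br≤1 : B * r ≤ 1ℚ
    Br≤1 = begin
      B * r    ≤⟨ ℚ.*-monoʳ-≤-nonNeg r {{ℚ.pos⇒nonNeg r {{ℚ.1/pos⇒pos C {{ℚ.positive 0<C}}}}}}
                    (subst (_≤ C) (ℚ.+-identityʳ B) (ℚ.+-monoʳ-≤ B 0≤1)) ⟩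
      C * r    ≡⟨ ℚ.*-inverseʳ C {{ℚ.>-nonZero 0<C}} ⟩
      1ℚ       ∎

  *-cauchy : ∀ {x y} → IsCauchy x → IsCauchy y → IsCauchy (λ n → x n * y n)
  *-cauchy {x} {y} cx cy ε 0<ε =
    (Nx ℕ.⊔ Ny) ℕ.⊔ (Mx ℕ.⊔ My) , λ m n m≥ n≥ →
      *-close {x m} {y m} {x n} {y n} {Bx} {By}
        (∣x∣≤Bx m (ℕ.m⊔n≤o⇒m≤o Nx Ny (left m≥)))
        (∣y∣≤By n (ℕ.m⊔n≤o⇒n≤o Nx Ny (left n≥)))
        (proj₂ (cx δ 0<δ) m n (ℕ.m⊔n≤o⇒m≤o Mx My (right m≥)) (ℕ.m⊔n≤o⇒m≤o Mx My (right n≥)))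
        (proj₂ (cy δ 0<δ) m n (ℕ.m⊔n≤o⇒n≤o Mx My (right m≥)) (ℕ.m⊔n≤o⇒n≤o Mx My (right n≥)))
        (proj₂ (proj₂ scale))
    where
    Nx = proj₁ (cauchy-bound {x} cx)
    Bx = proj₁ (proj₂ (cauchy-bound {x} cx))
    ∣x∣≤Bx = proj₂ (proj₂ (proj₂ (cauchy-bound {x} cx)))
    Ny = proj₁ (cauchy-bound {y} cy)
    By = proj₁ (proj₂ (cauchy-bound {y} cy))
    ∣y∣≤By = proj₂ (proj₂ (proj₂ (cauchy-bound {y} cy)))
    scale : ∃[ δ ] (0ℚ < δ × (Bx + By) * δ ≤ ε)
    scale = scale-down (+-0≤ (proj₁ (proj₂ (proj₂ (cauchy-bound {x} cx)))) (proj₁ (proj₂ (proj₂ (cauchy-bound {y} cy))))) 0<ε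
    δ = proj₁ scale
    0<δ = proj₁ (proj₂ scale)
    Mx = proj₁ (cx δ 0<δ)
    My = proj₁ (cy δ 0<δ)
    left : ∀ {m} → (Nx ℕ.⊔ Ny) ℕ.⊔ (Mx ℕ.⊔ My) ℕ.≤ m → Nx ℕ.⊔ Ny ℕ.≤ m
    left = ℕ.m⊔n≤o⇒m≤o (Nx ℕ.⊔ Ny) (Mx ℕ.⊔ My)
    right : ∀ {m} → (Nx ℕ.⊔ Ny) ℕ.⊔ (Mx ℕ.⊔ My) ℕ.≤ m → Mx ℕ.⊔ My ℕ.≤ m
    right = ℕ.m⊔n≤o⇒n≤o (Nx ℕ.⊔ Ny) (Mx ℕ.⊔ My)

  log₂-cauchy : ∀ {x} → IsCauchy x → IsCauchy (λ k → log₂-approx k (x k))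
  log₂-cauchy {x} = approximants-cauchy log₂-approx (⅓ ^_) 0<⅓^ log₂-close {x}

  √-cauchy : ∀ {x} → IsCauchy x → IsCauchy (λ k → √-approx k (x k))
  √-cauchy {x} = approximants-cauchy √-approx (λ p → ½ ^ p * ½ ^ p)
    (λ p → *-0< (0<½^ p) (0<½^ p)) √-close {x}

open RationalLemmas

-- Abstract because normalising these proofs is infeasible.
abstract
  fromℚ-isCauchy : ∀ q → IsCauchy (λ _ → q)
  fromℚ-isCauchy q = const-cauchy q

  +-isCauchy : ∀ x y → IsCauchy x → IsCauchy y → IsCauchy (λ n → x n ℚ.+ y n)
  +-isCauchy x y cx cy = +-cauchy {x} {y} cx cy

  *-isCauchy : ∀ x y → IsCauchy x → IsCauchy y → IsCauchy (λ n → x n ℚ.* y n)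
  *-isCauchy x y cx cy = *-cauchy {x} {y} cx cy

  neg-isCauchy : ∀ x → IsCauchy x → IsCauchy (λ n → ℚ.- x n)
  neg-isCauchy x cx = neg-cauchy {x} cx

  abs-isCauchy : ∀ x → IsCauchy x → IsCauchy (λ n → ℚ.∣ x n ∣)
  abs-isCauchy x cx = abs-cauchy {x} cx

  log₂-isCauchy : ∀ x → IsCauchy x → IsCauchy (λ k → log₂-approx k (x k))
  log₂-isCauchy x cx = log₂-cauchy {x} cx

  √-isCauchy : ∀ x → IsCauchy x → IsCauchy (λ k → √-approx k (x k))
  √-isCauchy x cx = √-cauchy {x} cx

record ℝ : Set where
  constructor real
  field
    seq      : ℕ → ℚ
    isCauchy : IsCauchy seq
open ℝ

infix  4 _≤_ _<_ _≃_
infixl 6 _+_ _-_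
infixl 7 _*_
infix  8 -_

record _≤_ (x y : ℝ) : Set where
  constructor ≤-intro
  field
    eventually : ∀ ε → 0ℚ ℚ.< ε →
      ∃[ N ] (∀ n → N ℕ.≤ n → seq x n ℚ.≤ seq y n ℚ.+ ε)

record _<_ (x y : ℝ) : Set where
  constructor <-intro
  field
    gap          : ℚ
    gap-positive : 0ℚ ℚ.< gap
    eventually   : ∃[ N ] (∀ n → N ℕ.≤ n → seq x n ℚ.+ gap ℚ.≤ seq y n)

_≃_ : ℝ → ℝ → Set
x ≃ y = x ≤ y × y ≤ x

fromℚ : ℚ → ℝ
fromℚ q = real (λ _ → q) (fromℚ-isCauchy q)

fromℕ : ℕ → ℝ
fromℕ n = fromℚ (natℚ n)

0ℝ 1ℝ : ℝ
0ℝ = fromℕ 0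
1ℝ = fromℕ 1

_+_ _*_ : ℝ → ℝ → ℝ
x + y = real (λ n → seq x n ℚ.+ seq y n) (+-isCauchy (seq x) (seq y) (isCauchy x) (isCauchy y))
x * y = real (λ n → seq x n ℚ.* seq y n) (*-isCauchy (seq x) (seq y) (isCauchy x) (isCauchy y))

-_ ∣_∣ : ℝ → ℝ
- x = real (λ n → ℚ.- seq x n) (neg-isCauchy (seq x) (isCauchy x))
∣ x ∣ = real (λ n → ℚ.∣ seq x n ∣) (abs-isCauchy (seq x) (isCauchy x))

_-_ : ℝ → ℝ → ℝ
x - y = x + (- y)

-- log₂ x is the base-2 logarithm of max 1 x, and √ x the square root of
-- max 0 x; both arguments are truncated only to make the functions total.
log₂ √ : ℝ → ℝ
log₂ x = real (λ k → log₂-approx k (seq x k)) (log₂-isCauchy (seq x) (isCauchy x))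
√ x = real (λ k → √-approx k (seq x k)) (√-isCauchy (seq x) (isCauchy x))

+-0-rawMonoid : RawMonoid 0ℓ 0ℓ
+-0-rawMonoid = record { _≈_ = _≃_ ; _∙_ = _+_ ; ε = 0ℝ }

open RawMonoidDefs +-0-rawMonoid public using (sum)

record Distribution (n : ℕ) : Set where
  field
    prob        : Fin n → ℝ
    nonNegative : ∀ i → 0ℝ ≤ prob i
    total       : sum prob ≃ 1ℝ
open Distribution

mass : ∀ {n} → Distribution n → Subset n → ℝ
mass μ A = sum (λ i → if does (i ∈? A) then prob μ i else 0ℝ)

distance : ∀ {n} → Distribution n → Distribution n → ℝ
distance μ ν = fromℚ ½ * sum (λ i → ∣ prob μ i - prob ν i ∣)

Property : ℕ → Set₁
Property n = Pred (Distribution n) 0ℓ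

-- Taking π to be the identity, this also makes P respect equality of
-- distributions, as a predicate that represents a set of distributions must.
LabelInvariant : ∀ {n} → Property n → Set
LabelInvariant {n} P = ∀ (π : Permutation′ n) μ ν →
  (∀ i → prob ν i ≃ prob μ (π ⟨$⟩ʳ i)) → P μ → P ν

Far : ∀ {n} → ℝ → Property n → Distribution n → Set
Far ε P μ = ∀ ν → P ν → ε ≤ distance μ ν

-- The probabilities μ(j) / μ(A) and 1 / |A| are given with the denominator
-- multiplied out.  The oracle is a structure over μ rather than a function of μ
-- because constructively a real mass cannot be tested for being zero.
record ConditionalOracle {n : ℕ} (μ : Distribution n) : Set where
  field
    respond     : (A : Subset n) → Nonempty A → Distribution n
    outside     : ∀ A ne j → j ∉ A → prob (respond A ne) j ≃ 0ℝ
    conditional : ∀ A ne j → j ∈ A → 0ℝ < mass μ A →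
                  prob (respond A ne) j * mass μ A ≃ prob μ j
    uniform     : ∀ A ne j → j ∈ A → mass μ A ≃ 0ℝ →
                  prob (respond A ne) j * fromℕ ∣ A ∣ₛ ≃ 1ℝ
open ConditionalOracle

data Verdict : Set where
  accept reject : Verdict

-- Tester n q: randomized decision trees over [n] with at most q oracle calls on
-- every path.  Each node is reached with the history of samples and coins that
-- leads to it, so its conditioning set or verdict may depend on all of them.
-- The coins are arbitrary finitely supported real distributions.
data Tester (n : ℕ) : ℕ → Set where
  decide : ∀ {q} → Verdict → Tester n q
  toss   : ∀ {q k} → Distribution k → (Fin k → Tester n q) → Tester n q
  query  : ∀ {q} (A : Subset n) → Nonempty A → (Fin n → Tester n q) →
           Tester n (suc q)

indicator : Verdict → Verdict → ℝ
indicator accept accept = 1ℝ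
indicator reject reject = 1ℝ
indicator _      _      = 0ℝ

outputProb : ∀ {n q} {μ : Distribution n} →
             ConditionalOracle μ → Tester n q → Verdict → ℝ
outputProb O (decide w)     v = indicator w v
outputProb O (toss coin T)  v = sum (λ i → prob coin i * outputProb O (T i) v)
outputProb O (query A ne T) v =
  sum (λ j → prob (respond O A ne) j * outputProb O (T j) v)

record IsTester {n q : ℕ} (P : Property n) (ε δ : ℝ) (T : Tester n q) : Set where
  field
    accepts : ∀ μ (O : ConditionalOracle μ) → P μ →
              1ℝ - δ ≤ outputProb O T accept
    rejects : ∀ μ (O : ConditionalOracle μ) → Far ε P μ →
              1ℝ - δ ≤ outputProb O T reject

{-# OPTIONS --safe #-}
module Submission where

-- The property consists of the distributions that are uniform on a set of density about
-- 1 / 4ᵏ in [n], where k is even.  The uniform distributions whose sets have density about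
-- 1 / 4ᵏ for an odd k are far from it, because the sizes of two such sets of different levels
-- differ by a constant factor (odd-far).  So a tester has to accept a random set of level k
-- if k is even and to reject it if k is odd.  Hence its probability of acceptance, averaged over
-- a set that contains each point independently with probability 1 / 4ᵏ, changes by
-- at least 1/4 from each level k to the next (with the help of Concentration.expectation≥,
-- as such a set need not have a typical size).
--
-- On the other hand, the total variation of this probability along the levels is bounded by
-- a function of the number of queries q alone (totalVariation≤).  The proof is by induction on
-- the tester, for random sets that are known to contain a given set I.  Consider a query
-- A and let m be the expected number of members of the random set in A outside I.
--   If m is small, then the random set is unlikely to have a member in A apart from those
-- in I, so that the distribution of the answer hardly depends on the level (W-sparse).
--   If m is large, then the number of members is concentrated, and the answer is close to
-- a uniformly random point j of A outside I, again almost independently of the level.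
-- Knowing the answer amounts to adding j to I (W-dense).
-- The sum of the errors over all levels is a convergent two-sided geometric series around the
-- level with m = 1, and thus O(q).  As each of the two regimes contributes at most the bound for
-- q - 1 queries, the total variation is O(q 2 ^ q), hence at most O(4 ^ q).
--
-- About log n / log 4 levels are available, so that log n = O(4 ^ q).  This gives
-- q = Ω(log log n), which implies the stated bound.
--
-- The probabilities of the coins are real numbers.  All estimates are made for their rational
-- approximations at a single late index, where the absolute values of the approximate
-- weights of a coin add up to little more than 1 (weights-bounded).

open import Algebra.Bundles using (CommutativeRing)
open import Data.Bool.Base using (true; false; if_then_else_)
open import Data.Empty using (⊥-elim)
open import Data.Fin.Base using (Fin; zero; suc; toℕ)
open import Data.Fin.Properties using (toℕ<n)
open import Data.Fin.Subset using (Subset; inside; outside; ⊥; ⊤; _∩_; _∪_; ∁; _∈_; _∉_; Nonempty) renaming (∣_∣ to ∣_∣ₛ)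
open import Data.Fin.Subset.Properties using (_∈?_; ∣p∩q∣≤∣q∣; ∪-identityˡ; ∩-identityˡ; ∣⊤∣≡n; ∣⊥∣≡0)
import Data.Integer.Base as ℤ
open import Data.Nat.Base using (ℕ; zero; suc; z≤n; s≤s)
import Data.Nat.Base as ℕ
import Data.Nat.Coprimality as Coprime
import Data.Nat.Properties as ℕ
open import Data.Product.Base using (Σ-syntax; ∃-syntax; _×_; _,_; proj₁; proj₂)
open import Data.Rational.Base using (ℚ; 0ℚ; 1ℚ; ½; mkℚ; _/_)
import Data.Rational.Base as ℚ
import Data.Rational.Properties as ℚ
open import Data.Rational.Solver using (module +-*-Solver)
open import Data.Sum.Base using (_⊎_; inj₁; inj₂)
open import Data.Vec.Base using ([]; _∷_; lookup; _[_]≔_; here; there)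
open import Data.Vec.Properties using ([]=⇒lookup; lookup⇒[]=)
open import Relation.Binary.Definitions using (tri<; tri≈; tri>)
open import Relation.Binary.PropositionalEquality
open import Relation.Nullary using (Dec; yes; no; does; contradiction)
open import Relation.Nullary.Decidable using (from-yes; _×-dec_)
open import Defs hiding (_+_; _*_; _-_; -_; ∣_∣; _≤_; _<_; _≃_; sum)
import Defs as ℝ

module TesterLowerBound where

  open RationalLemmas
  open ℝ.ℝ
  open Distribution
  open import Data.Rational.Base using (_+_; _*_; _-_; -_; _≤_; _<_; ∣_∣)
  open import Algebra.Properties.Semiring.Sum (CommutativeRing.semiring ℚ.+-*-commutativeRing)
    using (∑-distrib-+; ∑-comm; sum-cong-≗; sum-replicate-zero; *-distribˡ-sum; *-distribʳ-sum) renaming (sum to Σ)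
  open import Algebra.Properties.CommutativeSemiring.Exp
    (CommutativeRing.commutativeSemiring ℚ.+-*-commutativeRing) using (^-assocʳ)
  open +-*-Solver using (solve; _:+_; _:*_; _:-_; :-_; _:=_; con)
  open ℚ.≤-Reasoning

  -- Sums of rationals

  -- An inequality by exhibiting the difference d of its sides.
  ≤-from : ∀ {a b} d → b ≡ a + d → 0ℚ ≤ d → a ≤ b
  ≤-from {a} {b} d b≡a+d 0≤d = begin
    a        ≡⟨ ℚ.+-identityʳ a ⟨
    a + 0ℚ   ≤⟨ ℚ.+-monoʳ-≤ a 0≤d ⟩
    a + d    ≡⟨ b≡a+d ⟨
    b        ∎

  *-monoˡ : ∀ {a b} c → 0ℚ ≤ c → a ≤ b → c * a ≤ c * b
  *-monoˡ c 0≤c = ℚ.*-monoˡ-≤-nonNeg c {{ℚ.nonNegative 0≤c}}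

  *-monoʳ : ∀ {a b} c → 0ℚ ≤ c → a ≤ b → a * c ≤ b * c
  *-monoʳ c 0≤c = ℚ.*-monoʳ-≤-nonNeg c {{ℚ.nonNegative 0≤c}}

  difference-nonneg : ∀ {a b} → a ≤ b → 0ℚ ≤ b - a
  difference-nonneg {a} {b} a≤b = begin
    0ℚ     ≡⟨ ℚ.+-inverseʳ a ⟨
    a - a  ≤⟨ ℚ.+-monoˡ-≤ (- a) a≤b ⟩
    b - a  ∎

  p≤∣p∣ : ∀ p → p ≤ ∣ p ∣
  p≤∣p∣ p with ℚ.≤-total 0ℚ p
  ... | inj₁ 0≤p = ℚ.≤-reflexive (sym (ℚ.0≤p⇒∣p∣≡p 0≤p))
  ... | inj₂ p≤0 = ℚ.≤-trans p≤0 (ℚ.0≤∣p∣ p)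

  -p≤∣p∣ : ∀ p → - p ≤ ∣ p ∣
  -p≤∣p∣ p = subst (- p ≤_) (ℚ.∣-p∣≡∣p∣ p) (p≤∣p∣ (- p))

  ∣∣-least : ∀ {p b} → p ≤ b → - p ≤ b → ∣ p ∣ ≤ b
  ∣∣-least {p} p≤b -p≤b with ℚ.∣p∣≡p∨∣p∣≡-p p
  ... | inj₁ e = ℚ.≤-trans (ℚ.≤-reflexive e) p≤b
  ... | inj₂ e = ℚ.≤-trans (ℚ.≤-reflexive e) -p≤b

  ∣∣-nonneg : ∀ {p} → 0ℚ ≤ p → ∣ p ∣ ≤ p
  ∣∣-nonneg 0≤p = ℚ.≤-reflexive (ℚ.0≤p⇒∣p∣≡p 0≤p)

  ∣∣-sym : ∀ a b → ∣ a - b ∣ ≡ ∣ b - a ∣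
  ∣∣-sym a b = trans (sym (ℚ.∣-p∣≡∣p∣ (a - b)))
    (cong ∣_∣ (solve 2 (λ a b → :- (a :- b) := b :- a) refl a b))

  ∣∣-triangle : ∀ a b c → ∣ a - c ∣ ≤ ∣ a - b ∣ + ∣ b - c ∣
  ∣∣-triangle a b c = begin
    ∣ a - c ∣                ≡⟨ cong ∣_∣ (solve 3 (λ a b c → a :- c := (a :- b) :+ (b :- c)) refl a b c) ⟩
    ∣ (a - b) + (b - c) ∣    ≤⟨ ℚ.∣p+q∣≤∣p∣+∣q∣ (a - b) (b - c) ⟩
    ∣ a - b ∣ + ∣ b - c ∣    ∎

  square-nonneg : ∀ x → 0ℚ ≤ x * x
  square-nonneg x = subst (0ℚ ≤_) ∣x∣²≡x² (*-0≤ (ℚ.0≤∣p∣ x) (ℚ.0≤∣p∣ x))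
    where
    ∣x∣²≡x² : ∣ x ∣ * ∣ x ∣ ≡ x * x
    ∣x∣²≡x² with ℚ.∣p∣≡p∨∣p∣≡-p x
    ... | inj₁ e = cong₂ _*_ e e
    ... | inj₂ e = trans (cong₂ _*_ e e) (solve 1 (λ x → (:- x) :* (:- x) := x :* x) refl x)

  Σ-mono : ∀ {n} {f g : Fin n → ℚ} → (∀ i → f i ≤ g i) → Σ f ≤ Σ g
  Σ-mono {zero}  f≤g = ℚ.≤-refl
  Σ-mono {suc n} f≤g = ℚ.+-mono-≤ (f≤g zero) (Σ-mono (λ i → f≤g (suc i)))

  Σ-nonneg : ∀ {n} {f : Fin n → ℚ} → (∀ i → 0ℚ ≤ f i) → 0ℚ ≤ Σ f
  Σ-nonneg {zero}  0≤f = ℚ.≤-refl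
  Σ-nonneg {suc n} 0≤f = +-0≤ (0≤f zero) (Σ-nonneg (λ i → 0≤f (suc i)))

  ∣Σ∣≤Σ∣∣ : ∀ {n} (f : Fin n → ℚ) → ∣ Σ f ∣ ≤ Σ (λ i → ∣ f i ∣)
  ∣Σ∣≤Σ∣∣ {zero}  f = ℚ.≤-refl
  ∣Σ∣≤Σ∣∣ {suc n} f = ℚ.≤-trans (ℚ.∣p+q∣≤∣p∣+∣q∣ (f zero) (Σ (λ i → f (suc i))))
    (ℚ.+-monoʳ-≤ ∣ f zero ∣ (∣Σ∣≤Σ∣∣ (λ i → f (suc i))))

  Σ-neg : ∀ {n} (f : Fin n → ℚ) → Σ (λ i → - f i) ≡ - Σ f
  Σ-neg {zero}  f = refl
  Σ-neg {suc n} f = trans (cong ((- f zero) +_) (Σ-neg (λ i → f (suc i))))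
    (sym (ℚ.neg-distrib-+ (f zero) (Σ (λ i → f (suc i)))))

  Σ-difference : ∀ {n} (f g : Fin n → ℚ) → Σ (λ i → f i - g i) ≡ Σ f - Σ g
  Σ-difference f g = trans (∑-distrib-+ f (λ i → - g i)) (cong (Σ f +_) (Σ-neg g))

  Σ-scaleˡ : ∀ {n} x (f : Fin n → ℚ) → Σ (λ i → x * f i) ≡ x * Σ f
  Σ-scaleˡ x f = sym (*-distribˡ-sum x f)

  Σ-scaleʳ : ∀ {n} x (f : Fin n → ℚ) → Σ (λ i → f i * x) ≡ Σ f * x
  Σ-scaleʳ x f = sym (*-distribʳ-sum x f)

  Σ-cong : ∀ {n} {f g : Fin n → ℚ} → (∀ i → f i ≡ g i) → Σ f ≡ Σ g
  Σ-cong = sum-cong-≗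

  Σ-const : ∀ k c → Σ {k} (λ _ → c) ≡ natℚ k * c
  Σ-const zero    c = sym (ℚ.*-zeroˡ c)
  Σ-const (suc k) c = trans (cong (c +_) (Σ-const k c))
    (trans (solve 2 (λ k c → c :+ k :* c := (con 1ℚ :+ k) :* c) refl (natℚ k) c) (cong (_* c) (sym (natℚ-suc k))))

  ∣Σ∣≤Σ∣∣* : ∀ {n} (u x : Fin n → ℚ) {C} → (∀ i → ∣ x i ∣ ≤ C) →
    ∣ Σ (λ i → u i * x i) ∣ ≤ Σ (λ i → ∣ u i ∣) * C
  ∣Σ∣≤Σ∣∣* u x {C} ∣x∣≤C = begin
    ∣ Σ (λ i → u i * x i) ∣      ≤⟨ ∣Σ∣≤Σ∣∣ (λ i → u i * x i) ⟩
    Σ (λ i → ∣ u i * x i ∣)      ≤⟨ Σ-mono termwise ⟩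
    Σ (λ i → ∣ u i ∣ * C)        ≡⟨ Σ-scaleʳ C (λ i → ∣ u i ∣) ⟩
    Σ (λ i → ∣ u i ∣) * C        ∎
    where
    termwise : ∀ i → ∣ u i * x i ∣ ≤ ∣ u i ∣ * C
    termwise i = ℚ.≤-trans (ℚ.≤-reflexive (ℚ.∣p*q∣≡∣p∣*∣q∣ (u i) (x i)))
      (*-monoˡ ∣ u i ∣ (ℚ.0≤∣p∣ (u i)) (∣x∣≤C i))

  -- Two linear combinations of values bounded by C differ by at most C times the
  -- distance of their coefficients.
  Σ-∣difference∣ : ∀ {n} (u v x : Fin n → ℚ) {C} → (∀ i → ∣ x i ∣ ≤ C) →
    ∣ Σ (λ i → u i * x i) - Σ (λ i → v i * x i) ∣ ≤ Σ (λ i → ∣ u i - v i ∣) * C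
  Σ-∣difference∣ u v x {C} ∣x∣≤C = begin
    ∣ Σ (λ i → u i * x i) - Σ (λ i → v i * x i) ∣
      ≡⟨ cong ∣_∣ (Σ-difference (λ i → u i * x i) (λ i → v i * x i)) ⟨
    ∣ Σ (λ i → u i * x i - v i * x i) ∣
      ≡⟨ cong ∣_∣ (Σ-cong (λ i → solve 3 (λ u v x → u :* x :- v :* x := (u :- v) :* x) refl (u i) (v i) (x i))) ⟩
    ∣ Σ (λ i → (u i - v i) * x i) ∣
      ≤⟨ ∣Σ∣≤Σ∣∣* (λ i → u i - v i) x ∣x∣≤C ⟩
    Σ (λ i → ∣ u i - v i ∣) * C ∎

  Σ-average : ∀ {n} (u x : Fin n → ℚ) {M} → (∀ i → 0ℚ ≤ u i) → Σ u ≤ 1ℚ →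
    0ℚ ≤ M → (∀ i → x i ≤ M) → Σ (λ i → u i * x i) ≤ M
  Σ-average u x {M} 0≤u Σu≤1 0≤M x≤M = begin
    Σ (λ i → u i * x i)  ≤⟨ Σ-mono (λ i → *-monoˡ (u i) (0≤u i) (x≤M i)) ⟩
    Σ (λ i → u i * M)    ≡⟨ Σ-scaleʳ M u ⟩
    Σ u * M              ≤⟨ *-monoʳ M 0≤M Σu≤1 ⟩
    1ℚ * M               ≡⟨ ℚ.*-identityˡ M ⟩
    M                    ∎

  -- The reciprocal of n, with the value 0 at n = 0.
  inv : ℕ → ℚ
  inv zero    = 0ℚ
  inv (suc n) = mkℚ (ℤ.+ 1) n (Coprime.1-coprimeTo (suc n))

  inv-inverse : ∀ {n} → 0 ℕ.< n → natℚ n * inv n ≡ 1ℚ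
  inv-inverse {suc n} _ = trans (cong (_* inv (suc n)) (natℚ-mkℚ (suc n)))
    (ℚ.*-inverseʳ (mkℚ (ℤ.+ suc n) 0 (Coprime.sym (Coprime.1-coprimeTo (suc n)))))

  0≤inv : ∀ n → 0ℚ ≤ inv n
  0≤inv zero    = ℚ.≤-refl
  0≤inv (suc n) = ℚ.nonNegative⁻¹ (inv (suc n))

  -- Random subsets

  -- The expected value of f at a random subset of [n] that contains each point
  -- independently with probability p.
  E : ∀ {n} → ℚ → (Subset n → ℚ) → ℚ
  E {zero}  p f = f []
  E {suc n} p f = p * E p (λ R → f (inside ∷ R)) + (1ℚ - p) * E p (λ R → f (outside ∷ R))

  mix-const : ∀ p c → p * c + (1ℚ - p) * c ≡ c
  mix-const = solve 2 (λ p c → p :* c :+ (con 1ℚ :- p) :* c := c) refl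

  E-cong : ∀ {n} p {f g : Subset n → ℚ} → (∀ R → f R ≡ g R) → E p f ≡ E p g
  E-cong {zero}  p f≡g = f≡g []
  E-cong {suc n} p f≡g = cong₂ (λ x y → p * x + (1ℚ - p) * y)
    (E-cong p (λ R → f≡g (inside ∷ R))) (E-cong p (λ R → f≡g (outside ∷ R)))

  E-const : ∀ n p c → E {n} p (λ _ → c) ≡ c
  E-const zero    p c = refl
  E-const (suc n) p c = trans
    (cong₂ (λ x y → p * x + (1ℚ - p) * y) (E-const n p c) (E-const n p c)) (mix-const p c)

  E-+ : ∀ {n} p (f g : Subset n → ℚ) → E p (λ R → f R + g R) ≡ E p f + E p g
  E-+ {zero}  p f g = refl
  E-+ {suc n} p f g = trans
    (cong₂ (λ x y → p * x + (1ℚ - p) * y) (E-+ p f₁ g₁) (E-+ p f₀ g₀))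
    (solve 5 (λ p a b c d → p :* (a :+ b) :+ (con 1ℚ :- p) :* (c :+ d)
                         := (p :* a :+ (con 1ℚ :- p) :* c) :+ (p :* b :+ (con 1ℚ :- p) :* d))
      refl p (E p f₁) (E p g₁) (E p f₀) (E p g₀))
    where
    f₁ g₁ f₀ g₀ : Subset n → ℚ
    f₁ R = f (inside ∷ R)
    g₁ R = g (inside ∷ R)
    f₀ R = f (outside ∷ R)
    g₀ R = g (outside ∷ R)

  E-* : ∀ {n} p c (f : Subset n → ℚ) → E p (λ R → c * f R) ≡ c * E p f
  E-* {zero}  p c f = refl
  E-* {suc n} p c f = trans
    (cong₂ (λ x y → p * x + (1ℚ - p) * y)
      (E-* p c (λ R → f (inside ∷ R))) (E-* p c (λ R → f (outside ∷ R))))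
    (solve 4 (λ p c x y → p :* (c :* x) :+ (con 1ℚ :- p) :* (c :* y)
                       := c :* (p :* x :+ (con 1ℚ :- p) :* y))
      refl p c (E p (λ R → f (inside ∷ R))) (E p (λ R → f (outside ∷ R))))

  E-Σ : ∀ {n m} p (f : Fin m → Subset n → ℚ) →
        E p (λ R → Σ (λ j → f j R)) ≡ Σ (λ j → E p (f j))
  E-Σ {n} {zero}  p f = E-const n p 0ℚ
  E-Σ {n} {suc m} p f = trans (E-+ p (f zero) (λ R → Σ (λ j → f (suc j) R)))
    (cong (E p (f zero) +_) (E-Σ p (λ j → f (suc j))))

  E-difference : ∀ {n} p (f g : Subset n → ℚ) → E p (λ R → f R - g R) ≡ E p f - E p g
  E-difference p f g = begin-equality
    E p (λ R → f R - g R)            ≡⟨ E-cong p (λ R → cong (f R +_) (negate (g R))) ⟩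
    E p (λ R → f R + - 1ℚ * g R)     ≡⟨ E-+ p f (λ R → - 1ℚ * g R) ⟩
    E p f + E p (λ R → - 1ℚ * g R)   ≡⟨ cong (E p f +_) (E-* p (- 1ℚ) g) ⟩
    E p f + - 1ℚ * E p g             ≡⟨ cong (E p f +_) (negate (E p g)) ⟨
    E p f - E p g                    ∎
    where
    negate : ∀ x → - x ≡ - 1ℚ * x
    negate = solve 1 (λ x → :- x := con (- 1ℚ) :* x) refl

  IsProbability : ℚ → Set
  IsProbability p = 0ℚ ≤ p × p ≤ 1ℚ

  E-mono : ∀ {n p} → IsProbability p → {f g : Subset n → ℚ} →
           (∀ R → f R ≤ g R) → E p f ≤ E p g
  E-mono {zero}      _           f≤g = f≤g []
  E-mono {suc n} {p} π@(0≤p , p≤1) f≤g = ℚ.+-mono-≤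
    (*-monoˡ p 0≤p (E-mono π (λ R → f≤g (inside ∷ R))))
    (*-monoˡ (1ℚ - p) (difference-nonneg p≤1) (E-mono π (λ R → f≤g (outside ∷ R))))

  ∣E∣≤E∣∣ : ∀ {n p} → IsProbability p → (f : Subset n → ℚ) → ∣ E p f ∣ ≤ E p (λ R → ∣ f R ∣)
  ∣E∣≤E∣∣ {n} {p} π f = ∣∣-least
    (E-mono π (λ R → p≤∣p∣ (f R)))
    (begin
      - E p f                      ≡⟨ ℚ.+-identityˡ (- E p f) ⟨
      0ℚ - E p f                   ≡⟨ cong (_- E p f) (E-const n p 0ℚ) ⟨
      E {n} p (λ _ → 0ℚ) - E p f   ≡⟨ E-difference p (λ _ → 0ℚ) f ⟨
      E p (λ R → 0ℚ - f R)         ≡⟨ E-cong p (λ R → ℚ.+-identityˡ (- f R)) ⟩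
      E p (λ R → - f R)            ≤⟨ E-mono π (λ R → -p≤∣p∣ (f R)) ⟩
      E p (λ R → ∣ f R ∣)          ∎)

  ∣E-difference∣ : ∀ {n p} → IsProbability p → (f g h : Subset n → ℚ) →
    (∀ R → ∣ f R - g R ∣ ≤ h R) → ∣ E p f - E p g ∣ ≤ E p h
  ∣E-difference∣ {p = p} π f g h close = begin
    ∣ E p f - E p g ∣              ≡⟨ cong ∣_∣ (E-difference p f g) ⟨
    ∣ E p (λ R → f R - g R) ∣      ≤⟨ ∣E∣≤E∣∣ π (λ R → f R - g R) ⟩
    E p (λ R → ∣ f R - g R ∣)      ≤⟨ E-mono π close ⟩
    E p h                          ∎

  -- The indicator function of S.
  χ : ∀ {n} → Subset n → Fin n → ℚ
  χ S j = if lookup S j then 1ℚ else 0ℚ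

  χ-∩ : ∀ {n} (A B : Subset n) j → χ (A ∩ B) j ≡ χ A j * χ B j
  χ-∩ (true  ∷ A) (true  ∷ B) zero = refl
  χ-∩ (true  ∷ A) (false ∷ B) zero = refl
  χ-∩ (false ∷ A) (b     ∷ B) zero = sym (ℚ.*-zeroˡ (if b then 1ℚ else 0ℚ))
  χ-∩ (a ∷ A) (b ∷ B) (suc j) = χ-∩ A B j

  0≤χ : ∀ {n} (S : Subset n) j → 0ℚ ≤ χ S j
  0≤χ S j with lookup S j
  ... | true  = 0≤1
  ... | false = ℚ.≤-refl

  natℚ-∣∣ : ∀ {n} (S : Subset n) → natℚ ∣ S ∣ₛ ≡ Σ (χ S)
  natℚ-∣∣ []          = refl
  natℚ-∣∣ (true  ∷ S) = trans (natℚ-suc ∣ S ∣ₛ) (cong (1ℚ +_) (natℚ-∣∣ S))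
  natℚ-∣∣ (false ∷ S) = trans (natℚ-∣∣ S) (sym (ℚ.+-identityˡ (Σ (χ S))))

  -- Conditioning on j ∈ R amounts to adding j to R.
  E-member : ∀ {n} p j (f : Subset n → ℚ) →
             E p (λ R → χ R j * f R) ≡ p * E p (λ R → f (R [ j ]≔ true))
  E-member {suc n} p zero f = begin-equality
    p * E p (λ R → 1ℚ * f₁ R) + (1ℚ - p) * E p (λ R → 0ℚ * f (outside ∷ R))
      ≡⟨ cong₂ (λ x y → p * x + (1ℚ - p) * y) (E-cong p (λ R → ℚ.*-identityˡ (f₁ R)))
           (trans (E-cong p (λ R → ℚ.*-zeroˡ (f (outside ∷ R)))) (E-const n p 0ℚ)) ⟩
    p * E p f₁ + (1ℚ - p) * 0ℚ
      ≡⟨ solve 2 (λ p x → p :* x :+ (con 1ℚ :- p) :* con 0ℚ := p :* (p :* x :+ (con 1ℚ :- p) :* x)) refl p (E p f₁) ⟩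
    p * (p * E p f₁ + (1ℚ - p) * E p f₁) ∎
    where
    f₁ : Subset n → ℚ
    f₁ R = f (inside ∷ R)
  E-member {suc n} p (suc j) f = trans
    (cong₂ (λ x y → p * x + (1ℚ - p) * y) (E-member p j (λ R → f (inside ∷ R))) (E-member p j (λ R → f (outside ∷ R))))
    (solve 3 (λ p x y → p :* (p :* x) :+ (con 1ℚ :- p) :* (p :* y) := p :* (p :* x :+ (con 1ℚ :- p) :* y))
      refl p (E p (λ R → f (inside ∷ (R [ j ]≔ true)))) (E p (λ R → f (outside ∷ (R [ j ]≔ true)))))

  E-count : ∀ {n} p (U : Subset n) → E p (λ R → natℚ ∣ U ∩ R ∣ₛ) ≡ natℚ ∣ U ∣ₛ * p
  E-count {zero}  p [] = sym (ℚ.*-zeroˡ p)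
  E-count {suc n} p (false ∷ U) = trans (mix-const p (E p (λ R → natℚ ∣ U ∩ R ∣ₛ))) (E-count p U)
  E-count {suc n} p (true ∷ U) = begin-equality
    p * E p (λ R → natℚ (suc ∣ U ∩ R ∣ₛ)) + (1ℚ - p) * x
      ≡⟨ cong (λ y → p * y + (1ℚ - p) * x) (trans (E-cong p (λ R → natℚ-suc ∣ U ∩ R ∣ₛ))
           (trans (E-+ p (λ _ → 1ℚ) (λ R → natℚ ∣ U ∩ R ∣ₛ)) (cong (_+ x) (E-const n p 1ℚ)))) ⟩
    p * (1ℚ + x) + (1ℚ - p) * x
      ≡⟨ solve 2 (λ p x → p :* (con 1ℚ :+ x) :+ (con 1ℚ :- p) :* x := p :+ x) refl p x ⟩
    p + x
      ≡⟨ cong (p +_) (E-count p U) ⟩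
    p + natℚ ∣ U ∣ₛ * p
      ≡⟨ solve 2 (λ p a → p :+ a :* p := (con 1ℚ :+ a) :* p) refl p (natℚ ∣ U ∣ₛ) ⟩
    (1ℚ + natℚ ∣ U ∣ₛ) * p
      ≡⟨ cong (_* p) (natℚ-suc ∣ U ∣ₛ) ⟨
    natℚ (suc ∣ U ∣ₛ) * p ∎
    where
    x = E p (λ R → natℚ ∣ U ∩ R ∣ₛ)

  -- A shifted form of the bound Var ≤ mean for the size of U ∩ R; the shift c makes
  -- the induction go through.
  E-square : ∀ {n p} → IsProbability p → (U : Subset n) → ∀ c →
    E p (λ R → (natℚ ∣ U ∩ R ∣ₛ - natℚ ∣ U ∣ₛ * p + c) * (natℚ ∣ U ∩ R ∣ₛ - natℚ ∣ U ∣ₛ * p + c))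
      ≤ natℚ ∣ U ∣ₛ * p + c * c
  E-square {zero} {p} π [] c = ℚ.≤-reflexive
    (solve 2 (λ p c → (con 0ℚ :- con 0ℚ :* p :+ c) :* (con 0ℚ :- con 0ℚ :* p :+ c) := con 0ℚ :* p :+ c :* c) refl p c)
  E-square {suc n} {p} π (false ∷ U) c =
    ℚ.≤-trans (ℚ.≤-reflexive (mix-const p _)) (E-square π U c)
  E-square {suc n} {p} π@(0≤p , p≤1) (true ∷ U) c = begin
    p * E p (λ R → (natℚ (suc ∣ U ∩ R ∣ₛ) - natℚ (suc a) * p + c) * (natℚ (suc ∣ U ∩ R ∣ₛ) - natℚ (suc a) * p + c))
      + (1ℚ - p) * E p (λ R → (X R - natℚ (suc a) * p + c) * (X R - natℚ (suc a) * p + c))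
      ≡⟨ cong₂ (λ x y → p * x + (1ℚ - p) * y)
           (E-cong p (λ R → cong₂ (λ x y → (x - y * p + c) * (x - y * p + c)) (natℚ-suc ∣ U ∩ R ∣ₛ) (natℚ-suc a)))
           (E-cong p (λ R → cong (λ y → (X R - y * p + c) * (X R - y * p + c)) (natℚ-suc a))) ⟩
    p * E p (λ R → (1ℚ + X R - (1ℚ + natℚ a) * p + c) * (1ℚ + X R - (1ℚ + natℚ a) * p + c))
      + (1ℚ - p) * E p (λ R → (X R - (1ℚ + natℚ a) * p + c) * (X R - (1ℚ + natℚ a) * p + c))
      ≡⟨ cong₂ (λ x y → p * x + (1ℚ - p) * y)
           (E-cong p (λ R → cong (λ z → z * z) (shift₁ (X R))))
           (E-cong p (λ R → cong (λ z → z * z) (shift₀ (X R)))) ⟩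
    p * E p (λ R → (X R - m + c₁) * (X R - m + c₁)) + (1ℚ - p) * E p (λ R → (X R - m + c₀) * (X R - m + c₀))
      ≤⟨ ℚ.+-mono-≤ (*-monoˡ p 0≤p (E-square π U c₁)) (*-monoˡ (1ℚ - p) (difference-nonneg p≤1) (E-square π U c₀)) ⟩
    p * (m + c₁ * c₁) + (1ℚ - p) * (m + c₀ * c₀)
      ≤⟨ ≤-from (p * p)
           (solve 3 (λ p m c → (m :+ p) :+ c :* c
              := (p :* (m :+ (c :+ con 1ℚ :- p) :* (c :+ con 1ℚ :- p)) :+ (con 1ℚ :- p) :* (m :+ (c :- p) :* (c :- p)))
                 :+ p :* p) refl p m c)
           (*-0≤ 0≤p 0≤p) ⟩
    (m + p) + c * c
      ≡⟨ cong (_+ c * c) (solve 2 (λ a p → a :* p :+ p := (con 1ℚ :+ a) :* p) refl (natℚ a) p) ⟩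
    (1ℚ + natℚ a) * p + c * c
      ≡⟨ cong (λ x → x * p + c * c) (natℚ-suc a) ⟨
    natℚ (suc a) * p + c * c ∎
    where
    a = ∣ U ∣ₛ
    m = natℚ a * p
    c₁ = c + 1ℚ - p
    c₀ = c - p
    X : Subset n → ℚ
    X R = natℚ ∣ U ∩ R ∣ₛ
    shift₁ : ∀ x → 1ℚ + x - (1ℚ + natℚ a) * p + c ≡ x - m + c₁
    shift₁ x = solve 4 (λ x a p c → con 1ℚ :+ x :- (con 1ℚ :+ a) :* p :+ c := x :- a :* p :+ (c :+ con 1ℚ :- p)) refl x (natℚ a) p c
    shift₀ : ∀ x → x - (1ℚ + natℚ a) * p + c ≡ x - m + c₀
    shift₀ x = solve 4 (λ x a p c → x :- (con 1ℚ :+ a) :* p :+ c := x :- a :* p :+ (c :- p)) refl x (natℚ a) p c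

  E-variance : ∀ {n p} → IsProbability p → (U : Subset n) →
    E p (λ R → (natℚ ∣ U ∩ R ∣ₛ - natℚ ∣ U ∣ₛ * p) * (natℚ ∣ U ∩ R ∣ₛ - natℚ ∣ U ∣ₛ * p)) ≤ natℚ ∣ U ∣ₛ * p
  E-variance {n} {p} π U = begin
    E p (λ R → (X R - m) * (X R - m))                  ≡⟨ E-cong p (λ R → cong (λ z → z * z) (ℚ.+-identityʳ (X R - m))) ⟨
    E p (λ R → (X R - m + 0ℚ) * (X R - m + 0ℚ))        ≤⟨ E-square π U 0ℚ ⟩
    m + 0ℚ * 0ℚ                                        ≡⟨ ℚ.+-identityʳ m ⟩
    m                                                  ∎
    where
    m = natℚ ∣ U ∣ₛ * p
    X : Subset n → ℚ
    X R = natℚ ∣ U ∩ R ∣ₛ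

  -- By the variance bound and the arithmetic-geometric mean inequality, with t
  -- to be chosen near the square root of the mean and s = 1 / t.
  E-deviation : ∀ {n p} → IsProbability p → (U : Subset n) → ∀ s t → 0ℚ ≤ s → s * t ≡ 1ℚ →
    E p (λ R → ∣ natℚ ∣ U ∩ R ∣ₛ - natℚ ∣ U ∣ₛ * p ∣) ≤ ½ * (s * (natℚ ∣ U ∣ₛ * p) + t)
  E-deviation {n} {p} π U s t 0≤s st≡1 = begin
    E p (λ R → ∣ D R ∣)
      ≤⟨ E-mono π (λ R → am-gm (D R)) ⟩
    E p (λ R → ½ * (s * (D R * D R) + t))
      ≡⟨ E-* p ½ (λ R → s * (D R * D R) + t) ⟩
    ½ * E p (λ R → s * (D R * D R) + t)
      ≡⟨ cong (½ *_) (E-+ p (λ R → s * (D R * D R)) (λ _ → t)) ⟩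
    ½ * (E p (λ R → s * (D R * D R)) + E {n} p (λ _ → t))
      ≡⟨ cong (½ *_) (cong₂ _+_ (E-* p s (λ R → D R * D R)) (E-const n p t)) ⟩
    ½ * (s * E p (λ R → D R * D R) + t)
      ≤⟨ *-monoˡ ½ (ℚ.nonNegative⁻¹ ½) (ℚ.+-monoˡ-≤ t (*-monoˡ s 0≤s (E-variance π U))) ⟩
    ½ * (s * m + t) ∎
    where
    m = natℚ ∣ U ∣ₛ * p
    D : Subset n → ℚ
    D R = natℚ ∣ U ∩ R ∣ₛ - m
    am-gm′ : ∀ y → y ≤ ½ * (s * (y * y) + t)
    am-gm′ y = ≤-from (½ * (s * ((y - t) * (y - t))))
      (begin-equality
        ½ * (s * (y * y) + t)
          ≡⟨ solve 3 (λ s y t → con ½ :* (s :* (y :* y) :+ t)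
               := (con 2ℚ :* con ½) :* (s :* t) :* y :+ con ½ :* (s :* ((y :- t) :* (y :- t))) :+ con ½ :* t :* (con 1ℚ :- s :* t)) refl s y t ⟩
        1ℚ * (s * t) * y + ½ * (s * ((y - t) * (y - t))) + ½ * t * (1ℚ - s * t)
          ≡⟨ cong (λ z → 1ℚ * z * y + ½ * (s * ((y - t) * (y - t))) + ½ * t * (1ℚ - z)) st≡1 ⟩
        1ℚ * 1ℚ * y + ½ * (s * ((y - t) * (y - t))) + ½ * t * (1ℚ - 1ℚ)
          ≡⟨ solve 3 (λ y z t → con 1ℚ :* con 1ℚ :* y :+ z :+ con ½ :* t :* (con 1ℚ :- con 1ℚ) := y :+ z) refl y (½ * (s * ((y - t) * (y - t)))) t ⟩
        y + ½ * (s * ((y - t) * (y - t))) ∎)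
      (*-0≤ (ℚ.nonNegative⁻¹ ½) (*-0≤ 0≤s (square-nonneg (y - t))))
    am-gm : ∀ x → ∣ x ∣ ≤ ½ * (s * (x * x) + t)
    am-gm x = ∣∣-least (am-gm′ x) (subst (λ z → - x ≤ ½ * (s * z + t))
      (solve 1 (λ x → (:- x) :* (:- x) := x :* x) refl x) (am-gm′ (- x)))

  -- Answers to queries about a uniform distribution

  nonempty⇒0<∣∣ : ∀ {n} (A : Subset n) → Nonempty A → 0 ℕ.< ∣ A ∣ₛ
  nonempty⇒0<∣∣ (true  ∷ A) _                   = s≤s z≤n
  nonempty⇒0<∣∣ (false ∷ A) (suc j , there j∈A) = nonempty⇒0<∣∣ A (j , j∈A)

  ∣update∣≤ : ∀ {n} (I : Subset n) j → ∣ I [ j ]≔ true ∣ₛ ℕ.≤ suc ∣ I ∣ₛ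
  ∣update∣≤ (true  ∷ I) zero    = s≤s (ℕ.n≤1+n ∣ I ∣ₛ)
  ∣update∣≤ (false ∷ I) zero    = s≤s ℕ.≤-refl
  ∣update∣≤ (true  ∷ I) (suc j) = s≤s (∣update∣≤ I j)
  ∣update∣≤ (false ∷ I) (suc j) = ∣update∣≤ I j

  ∪-update : ∀ {n} (I R : Subset n) j → I ∪ (R [ j ]≔ true) ≡ (I [ j ]≔ true) ∪ R
  ∪-update (true  ∷ I) (r ∷ R) zero    = refl
  ∪-update (false ∷ I) (r ∷ R) zero    = refl
  ∪-update (b ∷ I) (r ∷ R) (suc j) = cong (_ ∷_) (∪-update I R j)

  -- The part of A whose membership in I ∪ R depends on R.
  unknown : ∀ {n} → Subset n → Subset n → Subset n
  unknown A I = A ∩ ∁ I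

  ∣∣-split : ∀ {n} (A I R : Subset n) →
    ∣ A ∩ (I ∪ R) ∣ₛ ≡ ∣ A ∩ I ∣ₛ ℕ.+ ∣ unknown A I ∩ R ∣ₛ
  ∣∣-split []          []          []          = refl
  ∣∣-split (false ∷ A) (b     ∷ I) (r     ∷ R) = ∣∣-split A I R
  ∣∣-split (true  ∷ A) (true  ∷ I) (r     ∷ R) = cong suc (∣∣-split A I R)
  ∣∣-split (true  ∷ A) (false ∷ I) (true  ∷ R) = trans (cong suc (∣∣-split A I R))
    (sym (ℕ.+-suc ∣ A ∩ I ∣ₛ ∣ unknown A I ∩ R ∣ₛ))
  ∣∣-split (true  ∷ A) (false ∷ I) (false ∷ R) = ∣∣-split A I R

  χ-split : ∀ {n} (A I R : Subset n) j →
    χ (A ∩ (I ∪ R)) j ≡ χ (A ∩ I) j + χ (unknown A I ∩ R) j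
  χ-split (false ∷ A) (b     ∷ I) (r     ∷ R) zero = refl
  χ-split (true  ∷ A) (true  ∷ I) (r     ∷ R) zero = refl
  χ-split (true  ∷ A) (false ∷ I) (true  ∷ R) zero = refl
  χ-split (true  ∷ A) (false ∷ I) (false ∷ R) zero = refl
  χ-split (a ∷ A) (b ∷ I) (r ∷ R) (suc j) = χ-split A I R j

  ∩-unaffected : ∀ {n} (A I R : Subset n) → ∣ unknown A I ∩ R ∣ₛ ≡ 0 → A ∩ (I ∪ R) ≡ A ∩ I
  ∩-unaffected []          []          []          _ = refl
  ∩-unaffected (false ∷ A) (b     ∷ I) (r     ∷ R) e = cong (false ∷_) (∩-unaffected A I R e)
  ∩-unaffected (true  ∷ A) (true  ∷ I) (r     ∷ R) e = cong (true ∷_) (∩-unaffected A I R e)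
  ∩-unaffected (true  ∷ A) (false ∷ I) (false ∷ R) e = cong (false ∷_) (∩-unaffected A I R e)

  -- The uniform distribution on B; the zero function if B is empty.
  uniformOn : ∀ {n} → Subset n → Fin n → ℚ
  uniformOn B j = χ B j * inv ∣ B ∣ₛ

  0≤uniformOn : ∀ {n} (B : Subset n) j → 0ℚ ≤ uniformOn B j
  0≤uniformOn B j = *-0≤ (0≤χ B j) (0≤inv ∣ B ∣ₛ)

  Σ-uniformOn : ∀ {n} (B : Subset n) → 0 ℕ.< ∣ B ∣ₛ → Σ (uniformOn B) ≡ 1ℚ
  Σ-uniformOn B 0<∣B∣ = trans (Σ-scaleʳ (inv ∣ B ∣ₛ) (χ B))
    (trans (cong (_* inv ∣ B ∣ₛ) (sym (natℚ-∣∣ B))) (inv-inverse 0<∣B∣))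

  Σ-uniformOn≤1 : ∀ {n} (B : Subset n) → Σ (uniformOn B) ≤ 1ℚ
  Σ-uniformOn≤1 {n} B with ∣ B ∣ₛ ℕ.≟ 0
  ... | no  ∣B∣≢0 = ℚ.≤-reflexive (Σ-uniformOn B (ℕ.n≢0⇒n>0 ∣B∣≢0))
  ... | yes ∣B∣≡0 = ℚ.≤-trans (ℚ.≤-reflexive (trans
    (Σ-cong (λ j → trans (cong (λ b → χ B j * inv b) ∣B∣≡0) (ℚ.*-zeroʳ (χ B j))))
    (sum-replicate-zero n))) 0≤1

  -- A or B according to whether the given size of B is zero.
  ifEmpty : ∀ {n} → ℕ → Subset n → Subset n → Subset n
  ifEmpty zero    A B = A
  ifEmpty (suc _) A B = B

  -- The set of possible answers to the query A about the uniform distribution on S.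
  target : ∀ {n} → Subset n → Subset n → Subset n
  target S A = ifEmpty ∣ A ∩ S ∣ₛ A (A ∩ S)

  -- The answer to the query A about the uniform distribution on S.
  response : ∀ {n} → Subset n → Subset n → Fin n → ℚ
  response S A = uniformOn (target S A)

  0<∣target∣ : ∀ {n} (S A : Subset n) → Nonempty A → 0 ℕ.< ∣ target S A ∣ₛ
  0<∣target∣ S A ne with ∣ A ∩ S ∣ₛ in e
  ... | zero  = nonempty⇒0<∣∣ A ne
  ... | suc _ = subst (0 ℕ.<_) (sym e) (s≤s z≤n)

  Σ-response : ∀ {n} (S A : Subset n) → Nonempty A → Σ (response S A) ≡ 1ℚ
  Σ-response S A ne = Σ-uniformOn (target S A) (0<∣target∣ S A ne)

  Σ-∣response∣ : ∀ {n} (S A : Subset n) → Nonempty A → Σ (λ j → ∣ response S A j ∣) ≡ 1ℚ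
  Σ-∣response∣ S A ne = trans (Σ-cong (λ j → ℚ.0≤p⇒∣p∣≡p (0≤uniformOn (target S A) j))) (Σ-response S A ne)

  ∣a-b∣≤a+b : ∀ {a b} → 0ℚ ≤ a → 0ℚ ≤ b → ∣ a - b ∣ ≤ a + b
  ∣a-b∣≤a+b {a} {b} 0≤a 0≤b = ℚ.≤-trans (ℚ.∣p-q∣≤∣p∣+∣q∣ a b)
    (ℚ.+-mono-≤ (∣∣-nonneg 0≤a) (∣∣-nonneg 0≤b))

  -- The answer depends on the known members in A only, unless R meets the unknown part
  -- of A.  In that case the sum is at most 2 and the bound at least 2.
  response-sparse : ∀ {n} (A I R : Subset n) → Nonempty A →
    Σ (λ j → ∣ response (I ∪ R) A j - response I A j ∣) ≤ 2ℚ * natℚ ∣ unknown A I ∩ R ∣ₛ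
  response-sparse {n} A I R ne with ∣ unknown A I ∩ R ∣ₛ in e
  ... | zero = ℚ.≤-reflexive (trans (Σ-cong vanish) (sum-replicate-zero n))
    where
    vanish : ∀ j → ∣ response (I ∪ R) A j - response I A j ∣ ≡ 0ℚ
    vanish j = trans
      (cong (λ B → ∣ uniformOn (ifEmpty ∣ B ∣ₛ A B) j - response I A j ∣) (∩-unaffected A I R e))
      (cong ∣_∣ (ℚ.+-inverseʳ (response I A j)))
  ... | suc x = begin
    Σ (λ j → ∣ response (I ∪ R) A j - response I A j ∣)
      ≤⟨ Σ-mono (λ j → ∣a-b∣≤a+b (0≤uniformOn (target (I ∪ R) A) j) (0≤uniformOn (target I A) j)) ⟩
    Σ (λ j → response (I ∪ R) A j + response I A j)
      ≡⟨ ∑-distrib-+ (response (I ∪ R) A) (response I A) ⟩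
    Σ (response (I ∪ R) A) + Σ (response I A)
      ≡⟨ cong₂ _+_ (Σ-response (I ∪ R) A ne) (Σ-response I A ne) ⟩
    2ℚ * 1ℚ
      ≤⟨ *-monoˡ 2ℚ 0≤2 (natℚ-mono {1} {suc x} (s≤s z≤n)) ⟩
    2ℚ * natℚ (suc x) ∎

  -- Here m is an estimate for the number of points of R in the unknown part U of A.  If it
  -- is good and few members in A are known, then each point of U ∩ R is the answer with
  -- a probability of about 1 / m.  The inequality is multiplied by m.
  response-dense : ∀ {n} (A I R : Subset n) m → Nonempty A → 0ℚ ≤ m →
    Σ (λ j → ∣ m * response (I ∪ R) A j - χ (unknown A I) j * χ R j ∣)
      ≤ 2ℚ * natℚ ∣ A ∩ I ∣ₛ + 2ℚ * ∣ natℚ ∣ unknown A I ∩ R ∣ₛ - m ∣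
  response-dense {n} A I R m ne 0≤m = ℚ.≤-trans
    (ℚ.≤-reflexive (Σ-cong (λ j → cong (λ z → ∣ m * response (I ∪ R) A j - z ∣) (sym (χ-∩ U R j)))))
    (by-count ∣ A ∩ (I ∪ R) ∣ₛ refl)
    where
    U = unknown A I
    i = natℚ ∣ A ∩ I ∣ₛ
    X = natℚ ∣ U ∩ R ∣ₛ
    y u : Fin n → ℚ
    y = χ (U ∩ R)
    u = χ (A ∩ I)

    by-count : ∀ c → ∣ A ∩ (I ∪ R) ∣ₛ ≡ c →
      Σ (λ j → ∣ m * response (I ∪ R) A j - y j ∣) ≤ 2ℚ * i + 2ℚ * ∣ X - m ∣
    by-count zero none = begin
      Σ (λ j → ∣ m * response (I ∪ R) A j - y j ∣)
        ≤⟨ Σ-mono (λ j → ∣a-b∣≤a+b (*-0≤ 0≤m (0≤uniformOn (target (I ∪ R) A) j)) (0≤χ (U ∩ R) j)) ⟩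
      Σ (λ j → m * response (I ∪ R) A j + y j)
        ≡⟨ ∑-distrib-+ (λ j → m * response (I ∪ R) A j) y ⟩
      Σ (λ j → m * response (I ∪ R) A j) + Σ y
        ≡⟨ cong₂ _+_ (trans (Σ-scaleˡ m (response (I ∪ R) A)) (cong (m *_) (Σ-response (I ∪ R) A ne)))
                     (sym (natℚ-∣∣ (U ∩ R))) ⟩
      m * 1ℚ + X
        ≡⟨ solve 2 (λ m X → m :* con 1ℚ :+ X := :- (X :- m) :+ con 2ℚ :* X) refl m X ⟩
      - (X - m) + 2ℚ * X
        ≤⟨ ℚ.+-mono-≤ (-p≤∣p∣ (X - m)) (ℚ.≤-reflexive (cong (λ k → 2ℚ * natℚ k) X≡0)) ⟩
      ∣ X - m ∣ + 0ℚ
        ≤⟨ ≤-from (2ℚ * i + ∣ X - m ∣)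
             (solve 2 (λ i d → con 2ℚ :* i :+ con 2ℚ :* d := (d :+ con 0ℚ) :+ (con 2ℚ :* i :+ d)) refl i ∣ X - m ∣)
             (+-0≤ (*-0≤ 0≤2 (0≤natℚ ∣ A ∩ I ∣ₛ)) (ℚ.0≤∣p∣ (X - m))) ⟩
      2ℚ * i + 2ℚ * ∣ X - m ∣ ∎
      where
      X≡0 : ∣ U ∩ R ∣ₛ ≡ 0
      X≡0 = ℕ.m+n≡0⇒n≡0 ∣ A ∩ I ∣ₛ (trans (sym (∣∣-split A I R)) none)
    by-count (suc c) some = begin
      Σ (λ j → ∣ m * response (I ∪ R) A j - y j ∣)
        ≤⟨ Σ-mono termwise ⟩
      Σ (λ j → u j * (m * κ) + y j * ∣ m * κ - 1ℚ ∣)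
        ≡⟨ ∑-distrib-+ (λ j → u j * (m * κ)) (λ j → y j * ∣ m * κ - 1ℚ ∣) ⟩
      Σ (λ j → u j * (m * κ)) + Σ (λ j → y j * ∣ m * κ - 1ℚ ∣)
        ≡⟨ cong₂ _+_
             (trans (Σ-scaleʳ (m * κ) u) (cong (_* (m * κ)) (sym (natℚ-∣∣ (A ∩ I)))))
             (trans (Σ-scaleʳ ∣ m * κ - 1ℚ ∣ y) (cong (_* ∣ m * κ - 1ℚ ∣) (sym (natℚ-∣∣ (U ∩ R))))) ⟩
      i * (m * κ) + X * ∣ m * κ - 1ℚ ∣
        ≤⟨ ℚ.+-mono-≤ known-part unknown-part ⟩
      (i + d) + (i + d)
        ≡⟨ solve 2 (λ i d → (i :+ d) :+ (i :+ d) := con 2ℚ :* i :+ con 2ℚ :* d) refl i d ⟩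
      2ℚ * i + 2ℚ * d ∎
      where
      κ = inv (suc c)
      d = ∣ X - m ∣
      0≤κ = 0≤inv (suc c)
      0≤i = 0≤natℚ ∣ A ∩ I ∣ₛ
      0≤X = 0≤natℚ ∣ U ∩ R ∣ₛ
      0≤d = ℚ.0≤∣p∣ (X - m)

      [i+X]κ≡1 : (i + X) * κ ≡ 1ℚ
      [i+X]κ≡1 = trans (cong (_* κ) (trans (sym (natℚ-+ ∣ A ∩ I ∣ₛ ∣ U ∩ R ∣ₛ))
        (cong natℚ (trans (sym (∣∣-split A I R)) some)))) (inv-inverse {suc c} (s≤s z≤n))

      iκ≤1 : i * κ ≤ 1ℚ
      iκ≤1 = ≤-from (X * κ) (trans (sym [i+X]κ≡1) (ℚ.*-distribʳ-+ κ i X)) (*-0≤ 0≤X 0≤κ)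

      Xκ≤1 : X * κ ≤ 1ℚ
      Xκ≤1 = ≤-from (i * κ)
        (trans (sym [i+X]κ≡1) (solve 3 (λ i X κ → (i :+ X) :* κ := X :* κ :+ i :* κ) refl i X κ)) (*-0≤ 0≤i 0≤κ)

      response-value : ∀ j → response (I ∪ R) A j ≡ (u j + y j) * κ
      response-value j = trans
        (cong (λ k → uniformOn (ifEmpty k A (A ∩ (I ∪ R))) j) some)
        (cong₂ _*_ (χ-split A I R j) (cong inv some))

      termwise : ∀ j → ∣ m * response (I ∪ R) A j - y j ∣ ≤ u j * (m * κ) + y j * ∣ m * κ - 1ℚ ∣
      termwise j = begin
        ∣ m * response (I ∪ R) A j - y j ∣
          ≡⟨ cong (λ z → ∣ m * z - y j ∣) (response-value j) ⟩
        ∣ m * ((u j + y j) * κ) - y j ∣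
          ≡⟨ cong ∣_∣ (solve 4 (λ m u y κ → m :* ((u :+ y) :* κ) :- y := u :* (m :* κ) :+ y :* (m :* κ :- con 1ℚ)) refl m (u j) (y j) κ) ⟩
        ∣ u j * (m * κ) + y j * (m * κ - 1ℚ) ∣
          ≤⟨ ℚ.∣p+q∣≤∣p∣+∣q∣ (u j * (m * κ)) (y j * (m * κ - 1ℚ)) ⟩
        ∣ u j * (m * κ) ∣ + ∣ y j * (m * κ - 1ℚ) ∣
          ≤⟨ ℚ.+-mono-≤ (∣∣-nonneg (*-0≤ (0≤χ (A ∩ I) j) (*-0≤ 0≤m 0≤κ)))
               (ℚ.≤-reflexive (trans (ℚ.∣p*q∣≡∣p∣*∣q∣ (y j) (m * κ - 1ℚ))
                 (cong (_* ∣ m * κ - 1ℚ ∣) (ℚ.0≤p⇒∣p∣≡p (0≤χ (U ∩ R) j))))) ⟩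
        u j * (m * κ) + y j * ∣ m * κ - 1ℚ ∣ ∎

      -- From m ≤ X + d, where i κ and X κ are at most 1.
      known-part : i * (m * κ) ≤ i + d
      known-part = begin
        i * (m * κ)                    ≡⟨ solve 3 (λ i m κ → i :* (m :* κ) := (i :* κ) :* m) refl i m κ ⟩
        (i * κ) * m                    ≤⟨ *-monoˡ (i * κ) (*-0≤ 0≤i 0≤κ) m≤X+d ⟩
        (i * κ) * (X + d)              ≡⟨ solve 4 (λ i κ X d → (i :* κ) :* (X :+ d) := i :* (X :* κ) :+ (i :* κ) :* d) refl i κ X d ⟩
        i * (X * κ) + (i * κ) * d      ≤⟨ ℚ.+-mono-≤ (*-monoˡ i 0≤i Xκ≤1) (*-monoʳ d 0≤d iκ≤1) ⟩
        i * 1ℚ + 1ℚ * d                ≡⟨ cong₂ _+_ (ℚ.*-identityʳ i) (ℚ.*-identityˡ d) ⟩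
        i + d                          ∎
        where
        m≤X+d : m ≤ X + d
        m≤X+d = begin
          m                ≡⟨ solve 2 (λ m X → m := X :+ :- (X :- m)) refl m X ⟩
          X + - (X - m)    ≤⟨ ℚ.+-monoʳ-≤ X (-p≤∣p∣ (X - m)) ⟩
          X + d            ∎

      unknown-part : X * ∣ m * κ - 1ℚ ∣ ≤ i + d
      unknown-part = begin
        X * ∣ m * κ - 1ℚ ∣             ≡⟨ cong (λ z → X * ∣ m * κ - z ∣) [i+X]κ≡1 ⟨
        X * ∣ m * κ - (i + X) * κ ∣    ≡⟨ cong (λ z → X * ∣ z ∣) (solve 4 (λ m κ i X → m :* κ :- (i :+ X) :* κ := κ :* (:- i :- (X :- m))) refl m κ i X) ⟩
        X * ∣ κ * (- i - (X - m)) ∣    ≡⟨ cong (X *_) (trans (ℚ.∣p*q∣≡∣p∣*∣q∣ κ (- i - (X - m))) (cong (_* ∣ - i - (X - m) ∣) (ℚ.0≤p⇒∣p∣≡p 0≤κ))) ⟩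
        X * (κ * ∣ - i - (X - m) ∣)    ≡⟨ ℚ.*-assoc X κ ∣ - i - (X - m) ∣ ⟨
        X * κ * ∣ - i - (X - m) ∣      ≤⟨ *-mono (*-0≤ 0≤X 0≤κ) Xκ≤1 (ℚ.0≤∣p∣ (- i - (X - m))) (ℚ.∣p-q∣≤∣p∣+∣q∣ (- i) (X - m)) ⟩
        1ℚ * (∣ - i ∣ + d)             ≡⟨ ℚ.*-identityˡ (∣ - i ∣ + d) ⟩
        ∣ - i ∣ + d                    ≡⟨ cong (_+ d) (trans (ℚ.∣-p∣≡∣p∣ i) (ℚ.0≤p⇒∣p∣≡p 0≤i)) ⟩
        i + d                          ∎

  -- One query: the sparse and the dense approximation

  -- The N-th rational approximation to the probability of the outcome i of a coin.
  weight : ∀ {k} → ℕ → Distribution k → Fin k → ℚ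
  weight N coin i = seq (prob coin i) N

  -- The expected payoff φ of a tester when the queried distribution is uniform on S
  -- and the coins have their N-th approximate weights, which may be negative and need
  -- not add up to 1.
  eval : ∀ {n q} → ℕ → (Verdict → ℚ) → Subset n → Tester n q → ℚ
  eval N φ S (decide v)     = φ v
  eval N φ S (toss coin T)  = Σ (λ i → weight N coin i * eval N φ S (T i))
  eval N φ S (query A ne T) = Σ (λ j → response S A j * eval N φ S (T j))

  -- On every path, the total absolute weights of the coins have a product of at most C.
  data WeightBound {n} (N : ℕ) : ℚ → ∀ {q} → Tester n q → Set where
    decide : ∀ {C q v} → 1ℚ ≤ C → WeightBound N C {q} (decide v)
    toss   : ∀ {C D q k} {coin : Distribution k} {T : Fin k → Tester n q} → 0ℚ ≤ D →
             (∀ i → WeightBound N D (T i)) → Σ (λ i → ∣ weight N coin i ∣) * D ≤ C →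
             WeightBound N C (toss coin T)
    query  : ∀ {C q A ne} {T : Fin n → Tester n q} →
             (∀ j → WeightBound N C (T j)) → WeightBound N C (query A ne T)

  bound-nonneg : ∀ {n N C q} {T : Tester n q} → WeightBound N C T → 0ℚ ≤ C
  bound-nonneg (decide 1≤C)      = ℚ.≤-trans 0≤1 1≤C
  bound-nonneg {N = N} {T = toss coin _} (toss 0≤D _ wD≤C) =
    ℚ.≤-trans (*-0≤ (Σ-nonneg (λ i → ℚ.0≤∣p∣ (weight N coin i))) 0≤D) wD≤C
  bound-nonneg {T = query A (j , _) _} (query bounds) = bound-nonneg (bounds j)

  module Evaluation (N : ℕ) (φ : Verdict → ℚ) (∣φ∣≤1 : ∀ v → ∣ φ v ∣ ≤ 1ℚ) where

    ∣eval∣≤ : ∀ {n q C} {T : Tester n q} → WeightBound N C T → ∀ S → ∣ eval N φ S T ∣ ≤ C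
    ∣eval∣≤ {T = decide v} (decide 1≤C) S = ℚ.≤-trans (∣φ∣≤1 v) 1≤C
    ∣eval∣≤ {T = toss coin T} (toss 0≤D bounds wD≤C) S = ℚ.≤-trans
      (∣Σ∣≤Σ∣∣* (weight N coin) (λ i → eval N φ S (T i)) (λ i → ∣eval∣≤ (bounds i) S)) wD≤C
    ∣eval∣≤ {C = C} {T = query A ne T} (query bounds) S = begin
      ∣ Σ (λ j → response S A j * eval N φ S (T j)) ∣
        ≤⟨ ∣Σ∣≤Σ∣∣* (response S A) (λ j → eval N φ S (T j)) (λ j → ∣eval∣≤ (bounds j) S) ⟩
      Σ (λ j → ∣ response S A j ∣) * C
        ≡⟨ cong (_* C) (Σ-∣response∣ S A ne) ⟩
      1ℚ * C
        ≡⟨ ℚ.*-identityˡ C ⟩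
      C ∎

    -- The expected payoff of T when the members of I are known to belong to the
    -- support and the other points belong to it independently with probability p.
    W : ∀ {n q} → ℚ → Subset n → Tester n q → ℚ
    W p I T = E p (λ R → eval N φ (I ∪ R) T)

    W-combination : ∀ {n m q} p (I : Subset n) (u : Fin m → ℚ) (T : Fin m → Tester n q) →
      E p (λ R → Σ (λ j → u j * eval N φ (I ∪ R) (T j))) ≡ Σ (λ j → u j * W p I (T j))
    W-combination p I u T = trans (E-Σ p (λ j R → u j * eval N φ (I ∪ R) (T j)))
      (Σ-cong (λ j → E-* p (u j) (λ R → eval N φ (I ∪ R) (T j))))

    module _ {n q : ℕ} {p C : ℚ} (π : IsProbability p) (I A : Subset n) (ne : Nonempty A)
             (T : Fin n → Tester n q) (bounds : ∀ j → WeightBound N C (T j)) where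
      private
        U : Subset n
        U = unknown A I
        m i : ℚ
        m = natℚ ∣ U ∣ₛ * p
        i = natℚ ∣ A ∩ I ∣ₛ
        x : Subset n → Fin n → ℚ
        x R j = eval N φ (I ∪ R) (T j)

      -- If R meets U in few points on average, the answer is nearly as if there were none.
      -- Then it carries no information, and the known members stay the same.
      W-sparse : ∣ W p I (query A ne T) - Σ (λ j → response I A j * W p I (T j)) ∣ ≤ 2ℚ * m * C
      W-sparse = begin
        ∣ W p I (query A ne T) - Σ (λ j → response I A j * W p I (T j)) ∣
          ≡⟨ cong (λ z → ∣ W p I (query A ne T) - z ∣) (W-combination p I (response I A) T) ⟨
        ∣ W p I (query A ne T) - E p (λ R → Σ (λ j → response I A j * x R j)) ∣
          ≤⟨ ∣E-difference∣ π (λ R → Σ (λ j → response (I ∪ R) A j * x R j)) _ (λ R → 2ℚ * C * natℚ ∣ U ∩ R ∣ₛ) pointwise ⟩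
        E p (λ R → 2ℚ * C * natℚ ∣ U ∩ R ∣ₛ)
          ≡⟨ E-* p (2ℚ * C) (λ R → natℚ ∣ U ∩ R ∣ₛ) ⟩
        2ℚ * C * E p (λ R → natℚ ∣ U ∩ R ∣ₛ)
          ≡⟨ cong (2ℚ * C *_) (E-count p U) ⟩
        2ℚ * C * m
          ≡⟨ solve 2 (λ c m → con 2ℚ :* c :* m := con 2ℚ :* m :* c) refl C m ⟩
        2ℚ * m * C ∎
        where
        pointwise : ∀ R → ∣ Σ (λ j → response (I ∪ R) A j * x R j) - Σ (λ j → response I A j * x R j) ∣ ≤ 2ℚ * C * natℚ ∣ U ∩ R ∣ₛ
        pointwise R = begin
          ∣ Σ (λ j → response (I ∪ R) A j * x R j) - Σ (λ j → response I A j * x R j) ∣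
            ≤⟨ Σ-∣difference∣ (response (I ∪ R) A) (response I A) (x R) (λ j → ∣eval∣≤ (bounds j) (I ∪ R)) ⟩
          Σ (λ j → ∣ response (I ∪ R) A j - response I A j ∣) * C
            ≤⟨ *-monoʳ C (bound-nonneg (bounds (proj₁ ne))) (response-sparse A I R ne) ⟩
          2ℚ * natℚ ∣ U ∩ R ∣ₛ * C
            ≡⟨ solve 2 (λ c m → con 2ℚ :* m :* c := con 2ℚ :* c :* m) refl C (natℚ ∣ U ∩ R ∣ₛ) ⟩
          2ℚ * C * natℚ ∣ U ∩ R ∣ₛ ∎

      -- If R meets U in many points on average, the answer is nearly a uniformly
      -- random point of U, which becomes a known member.  The number e bounds the relative
      -- error; s and t are as in the deviation bound.
      W-dense : ∀ s t e → 0ℚ < m → 0ℚ ≤ s → s * t ≡ 1ℚ → 2ℚ * i + (s * m + t) ≤ m * e →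
        ∣ W p I (query A ne T) - Σ (λ j → uniformOn U j * W p (I [ j ]≔ true) (T j)) ∣ ≤ e * C
      W-dense s t e 0<m 0≤s st≡1 small = ℚ.*-cancelˡ-≤-pos m {{ℚ.positive 0<m}} (begin
        m * ∣ W p I (query A ne T) - L ∣
          ≡⟨ cong (_* ∣ W p I (query A ne T) - L ∣) (ℚ.0≤p⇒∣p∣≡p 0≤m) ⟨
        ∣ m ∣ * ∣ W p I (query A ne T) - L ∣
          ≡⟨ ℚ.∣p*q∣≡∣p∣*∣q∣ m (W p I (query A ne T) - L) ⟨
        ∣ m * (W p I (query A ne T) - L) ∣
          ≡⟨ cong ∣_∣ (trans (solve 3 (λ m w l → m :* (w :- l) := m :* w :- m :* l) refl m (W p I (query A ne T)) L) (cong₂ _-_ mW mL)) ⟩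
        ∣ E p (λ R → Σ (λ j → m * response (I ∪ R) A j * x R j)) - E p (λ R → Σ (λ j → χ U j * χ R j * x R j)) ∣
          ≤⟨ ∣E-difference∣ π _ _ (λ R → 2ℚ * C * (i + ∣ natℚ ∣ U ∩ R ∣ₛ - m ∣)) pointwise ⟩
        E p (λ R → 2ℚ * C * (i + ∣ natℚ ∣ U ∩ R ∣ₛ - m ∣))
          ≡⟨ trans (E-* p (2ℚ * C) (λ R → i + ∣ natℚ ∣ U ∩ R ∣ₛ - m ∣))
               (cong (2ℚ * C *_) (trans (E-+ p (λ _ → i) (λ R → ∣ natℚ ∣ U ∩ R ∣ₛ - m ∣))
                 (cong (_+ E p (λ R → ∣ natℚ ∣ U ∩ R ∣ₛ - m ∣)) (E-const n p i)))) ⟩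
        2ℚ * C * (i + E p (λ R → ∣ natℚ ∣ U ∩ R ∣ₛ - m ∣))
          ≤⟨ *-monoˡ (2ℚ * C) (*-0≤ 0≤2 0≤C) (ℚ.+-monoʳ-≤ i (E-deviation π U s t 0≤s st≡1)) ⟩
        2ℚ * C * (i + ½ * (s * m + t))
          ≡⟨ solve 3 (λ c i z → con 2ℚ :* c :* (i :+ con ½ :* z) := (con 2ℚ :* i :+ z) :* c) refl C i (s * m + t) ⟩
        (2ℚ * i + (s * m + t)) * C
          ≤⟨ *-monoʳ C 0≤C small ⟩
        m * e * C
          ≡⟨ ℚ.*-assoc m e C ⟩
        m * (e * C) ∎)
        where
        0≤C = bound-nonneg (bounds (proj₁ ne))
        0≤m = ℚ.<⇒≤ 0<m
        W⁺ : Fin n → ℚ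
        W⁺ j = W p (I [ j ]≔ true) (T j)
        L = Σ (λ j → uniformOn U j * W⁺ j)

        mW : m * W p I (query A ne T) ≡ E p (λ R → Σ (λ j → m * response (I ∪ R) A j * x R j))
        mW = trans (sym (E-* p m (λ R → Σ (λ j → response (I ∪ R) A j * x R j))))
          (E-cong p (λ R → trans (sym (Σ-scaleˡ m (λ j → response (I ∪ R) A j * x R j)))
            (Σ-cong (λ j → sym (ℚ.*-assoc m (response (I ∪ R) A j) (x R j))))))

        0<∣U∣ : 0 ℕ.< ∣ U ∣ₛ
        0<∣U∣ = ℕ.n≢0⇒n>0 λ ∣U∣≡0 → ℚ.<-irrefl
          (sym (trans (cong (λ a → natℚ a * p) ∣U∣≡0) (ℚ.*-zeroˡ p))) 0<m

        -- Since m = ∣U∣ p, the factor ∣U∣ cancels the uniform weight and p remains for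
        -- conditioning on j ∈ R.
        weight-value : ∀ j → m * (uniformOn U j * W⁺ j) ≡ χ U j * (p * W⁺ j)
        weight-value j = begin-equality
          natℚ ∣ U ∣ₛ * p * (χ U j * inv ∣ U ∣ₛ * W⁺ j)
            ≡⟨ solve 5 (λ a p u v w → a :* p :* (u :* v :* w) := (a :* v) :* (u :* (p :* w))) refl (natℚ ∣ U ∣ₛ) p (χ U j) (inv ∣ U ∣ₛ) (W⁺ j) ⟩
          natℚ ∣ U ∣ₛ * inv ∣ U ∣ₛ * (χ U j * (p * W⁺ j))
            ≡⟨ cong (_* (χ U j * (p * W⁺ j))) (inv-inverse 0<∣U∣) ⟩
          1ℚ * (χ U j * (p * W⁺ j))
            ≡⟨ ℚ.*-identityˡ (χ U j * (p * W⁺ j)) ⟩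
          χ U j * (p * W⁺ j) ∎

        mL : m * L ≡ E p (λ R → Σ (λ j → χ U j * χ R j * x R j))
        mL = begin-equality
          m * L
            ≡⟨ Σ-scaleˡ m (λ j → uniformOn U j * W⁺ j) ⟨
          Σ (λ j → m * (uniformOn U j * W⁺ j))
            ≡⟨ Σ-cong (λ j → trans (weight-value j) (cong (λ z → χ U j * (p * z))
                 (E-cong p (λ R → cong (λ S → eval N φ S (T j)) (sym (∪-update I R j)))))) ⟩
          Σ (λ j → χ U j * (p * E p (λ R → x (R [ j ]≔ true) j)))
            ≡⟨ Σ-cong (λ j → cong (χ U j *_) (E-member p j (λ R → x R j))) ⟨
          Σ (λ j → χ U j * E p (λ R → χ R j * x R j))
            ≡⟨ Σ-cong (λ j → E-* p (χ U j) (λ R → χ R j * x R j)) ⟨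
          Σ (λ j → E p (λ R → χ U j * (χ R j * x R j)))
            ≡⟨ E-Σ p (λ j R → χ U j * (χ R j * x R j)) ⟨
          E p (λ R → Σ (λ j → χ U j * (χ R j * x R j)))
            ≡⟨ E-cong p (λ R → Σ-cong (λ j → sym (ℚ.*-assoc (χ U j) (χ R j) (x R j)))) ⟩
          E p (λ R → Σ (λ j → χ U j * χ R j * x R j)) ∎

        pointwise : ∀ R → ∣ Σ (λ j → m * response (I ∪ R) A j * x R j) - Σ (λ j → χ U j * χ R j * x R j) ∣
          ≤ 2ℚ * C * (i + ∣ natℚ ∣ U ∩ R ∣ₛ - m ∣)
        pointwise R = begin
          ∣ Σ (λ j → m * response (I ∪ R) A j * x R j) - Σ (λ j → χ U j * χ R j * x R j) ∣
            ≤⟨ Σ-∣difference∣ (λ j → m * response (I ∪ R) A j) (λ j → χ U j * χ R j) (x R) (λ j → ∣eval∣≤ (bounds j) (I ∪ R)) ⟩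
          Σ (λ j → ∣ m * response (I ∪ R) A j - χ U j * χ R j ∣) * C
            ≤⟨ *-monoʳ C 0≤C (response-dense A I R m ne 0≤m) ⟩
          (2ℚ * i + 2ℚ * ∣ natℚ ∣ U ∩ R ∣ₛ - m ∣) * C
            ≡⟨ solve 3 (λ i d c → (con 2ℚ :* i :+ con 2ℚ :* d) :* c := con 2ℚ :* c :* (i :+ d)) refl i ∣ natℚ ∣ U ∩ R ∣ₛ - m ∣ C ⟩
          2ℚ * C * (i + ∣ natℚ ∣ U ∩ R ∣ₛ - m ∣) ∎

  -- Total variation along the densities

  ^-+ : ∀ a m n → a ^ (m ℕ.+ n) ≡ a ^ m * a ^ n
  ^-+ a zero    n = sym (ℚ.*-identityˡ (a ^ n))
  ^-+ a (suc m) n = trans (cong (a *_) (^-+ a m n)) (sym (ℚ.*-assoc a (a ^ m) (a ^ n)))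

  ½^≤1 : ∀ k → ½ ^ k ≤ 1ℚ
  ½^≤1 k = ½^-anti {0} {k} z≤n

  -- The k-th density, 1 / 4ᵏ.
  density : ℕ → ℚ
  density k = ½ ^ k * ½ ^ k

  density-probability : ∀ k → IsProbability (density k)
  density-probability k = *-0≤ (0≤½^ k) (0≤½^ k) , *-mono (0≤½^ k) (½^≤1 k) (0≤½^ k) (½^≤1 k)

  natℚ-4^ : ∀ k → natℚ (4 ℕ.^ k) ≡ 2ℚ ^ k * 2ℚ ^ k
  natℚ-4^ zero    = refl
  natℚ-4^ (suc k) = trans (natℚ-* 4 (4 ℕ.^ k)) (trans (cong (natℚ 4 *_) (natℚ-4^ k))
    (solve 1 (λ x → con (natℚ 4) :* (x :* x) := (con 2ℚ :* x) :* (con 2ℚ :* x)) refl (2ℚ ^ k)))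

  -- The exponent k with 4ᵏ ≤ a < 4ᵏ⁺¹, or 0 if a is 0.
  scale : ∀ a → ∃[ k ] (a ℕ.< 4 ℕ.^ suc k × (k ≡ 0 ⊎ 4 ℕ.^ k ℕ.≤ a))
  scale zero = 0 , s≤s z≤n , inj₁ refl
  scale (suc a) with scale a
  ... | k , a< , lower with suc a ℕ.<? 4 ℕ.^ suc k
  ...   | no  a≮ = suc k , ℕ.≤-<-trans a< (ℕ.^-monoʳ-< 4 (s≤s (s≤s z≤n)) (ℕ.n<1+n (suc k))) , inj₂ (ℕ.≮⇒≥ a≮)
  ...   | yes a<′ = k , a<′ , weaken lower
    where
    weaken : k ≡ 0 ⊎ 4 ℕ.^ k ℕ.≤ a → k ≡ 0 ⊎ 4 ℕ.^ k ℕ.≤ suc a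
    weaken (inj₁ k≡0)  = inj₁ k≡0
    weaken (inj₂ 4ᵏ≤a) = inj₂ (ℕ.m≤n⇒m≤1+n 4ᵏ≤a)

  dense-mean : ∀ a k d → 4 ℕ.^ (k ℕ.+ d) ℕ.≤ a → 2ℚ ^ d * 2ℚ ^ d ≤ natℚ a * density k
  dense-mean a k d h = begin
    2ℚ ^ d * 2ℚ ^ d
      ≡⟨ 4^-cancel k (2ℚ ^ d * 2ℚ ^ d) ⟨
    2ℚ ^ d * 2ℚ ^ d * (2ℚ ^ k * 2ℚ ^ k) * (½ ^ k * ½ ^ k)
      ≡⟨ cong (_* density k) (solve 2 (λ x y → x :* x :* (y :* y) := (y :* x) :* (y :* x)) refl (2ℚ ^ d) (2ℚ ^ k)) ⟩
    2ℚ ^ k * 2ℚ ^ d * (2ℚ ^ k * 2ℚ ^ d) * density k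
      ≡⟨ cong (λ z → z * z * density k) (^-+ 2ℚ k d) ⟨
    2ℚ ^ (k ℕ.+ d) * 2ℚ ^ (k ℕ.+ d) * density k
      ≡⟨ cong (_* density k) (natℚ-4^ (k ℕ.+ d)) ⟨
    natℚ (4 ℕ.^ (k ℕ.+ d)) * density k
      ≤⟨ *-monoʳ (density k) (proj₁ (density-probability k)) (natℚ-mono h) ⟩
    natℚ a * density k ∎

  -- The error of the dense approximation, with t = 2ᵈ in the deviation bound.
  dense-error : ∀ i m d → 0ℚ ≤ i → 2ℚ ^ d * 2ℚ ^ d ≤ m →
    2ℚ * i + (½ ^ d * m + 2ℚ ^ d) ≤ m * ((2ℚ * i + 2ℚ) * ½ ^ d)
  dense-error i m d 0≤i uu≤m = begin
    2ℚ * i + (v + u)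
      ≤⟨ ℚ.+-mono-≤ (ℚ.≤-reflexive (sym (ℚ.*-identityʳ (2ℚ * i)))) (ℚ.+-monoʳ-≤ v u≤v) ⟩
    2ℚ * i * 1ℚ + (v + v)
      ≤⟨ ℚ.+-monoˡ-≤ (v + v) (*-monoˡ (2ℚ * i) (*-0≤ 0≤2 0≤i) (ℚ.≤-trans (1≤^ d (ℚ.<⇒≤ 1<2)) u≤v)) ⟩
    2ℚ * i * v + (v + v)
      ≡⟨ solve 3 (λ i h m → con 2ℚ :* i :* (h :* m) :+ (h :* m :+ h :* m) := m :* ((con 2ℚ :* i :+ con 2ℚ) :* h)) refl i (½ ^ d) m ⟩
    m * ((2ℚ * i + 2ℚ) * ½ ^ d) ∎
    where
    u = 2ℚ ^ d
    v = ½ ^ d * m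
    u≤v : u ≤ v
    u≤v = begin
      u                    ≡⟨ ℚ.*-identityˡ u ⟨
      1ℚ * u               ≡⟨ cong (_* u) (2^*½^ d) ⟨
      u * ½ ^ d * u        ≡⟨ solve 2 (λ u h → u :* h :* u := h :* (u :* u)) refl u (½ ^ d) ⟩
      ½ ^ d * (u * u)      ≤⟨ *-monoˡ (½ ^ d) (0≤½^ d) uu≤m ⟩
      v                    ∎

  sparse-mean : ∀ a k d → a ℕ.< 4 ℕ.^ suc k → natℚ a * density (k ℕ.+ d) ≤ natℚ 4 * ½ ^ d
  sparse-mean a k d h = begin
    natℚ a * density (k ℕ.+ d)
      ≤⟨ *-monoʳ (density (k ℕ.+ d)) (proj₁ (density-probability (k ℕ.+ d))) (natℚ-mono (ℕ.<⇒≤ h)) ⟩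
    natℚ (4 ℕ.^ suc k) * density (k ℕ.+ d)
      ≡⟨ cong₂ _*_ (natℚ-4^ (suc k)) (cong (λ z → z * z) (^-+ ½ k d)) ⟩
    2ℚ * 2ℚ ^ k * (2ℚ * 2ℚ ^ k) * (½ ^ k * ½ ^ d * (½ ^ k * ½ ^ d))
      ≡⟨ solve 3 (λ u h e → con 2ℚ :* u :* (con 2ℚ :* u) :* (h :* e :* (h :* e))
           := con (natℚ 4) :* (e :* e) :* (u :* u) :* (h :* h)) refl (2ℚ ^ k) (½ ^ k) (½ ^ d) ⟩
    natℚ 4 * (½ ^ d * ½ ^ d) * (2ℚ ^ k * 2ℚ ^ k) * (½ ^ k * ½ ^ k)
      ≡⟨ 4^-cancel k (natℚ 4 * (½ ^ d * ½ ^ d)) ⟩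
    natℚ 4 * (½ ^ d * ½ ^ d)
      ≤⟨ *-monoˡ (natℚ 4) (0≤natℚ 4) (*-mono (0≤½^ d) (½^≤1 d) (0≤½^ d) ℚ.≤-refl) ⟩
    natℚ 4 * (1ℚ * ½ ^ d)
      ≡⟨ cong (natℚ 4 *_) (ℚ.*-identityˡ (½ ^ d)) ⟩
    natℚ 4 * ½ ^ d ∎

  Σ-geometric₀ : ∀ K → Σ {K} (λ k → ½ ^ ℕ.∣ toℕ k - 0 ∣) ≤ natℚ 2
  Σ-geometric₀ zero    = 0≤2
  Σ-geometric₀ (suc K) = begin
    1ℚ + Σ {K} (λ k → ½ * ½ ^ toℕ k)
      ≡⟨ cong (1ℚ +_) (trans (Σ-scaleˡ {K} ½ (λ k → ½ ^ toℕ k))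
           (cong (½ *_) (Σ-cong {K} (λ k → cong (½ ^_) (sym (ℕ.∣-∣-identityʳ (toℕ k))))))) ⟩
    1ℚ + ½ * Σ {K} (λ k → ½ ^ ℕ.∣ toℕ k - 0 ∣)
      ≤⟨ ℚ.+-monoʳ-≤ 1ℚ (*-monoˡ ½ (ℚ.nonNegative⁻¹ ½) (Σ-geometric₀ K)) ⟩
    natℚ 2 ∎

  Σ-geometric : ∀ K c → Σ {K} (λ k → ½ ^ ℕ.∣ toℕ k - c ∣) ≤ natℚ 3 - ½ ^ c
  Σ-geometric K       zero    = Σ-geometric₀ K
  Σ-geometric zero    (suc c) = difference-nonneg (ℚ.≤-trans (½^≤1 (suc c)) (natℚ-mono {1} {3} (s≤s z≤n)))
  Σ-geometric (suc K) (suc c) = begin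
    ½ * ½ ^ c + Σ {K} (λ k → ½ ^ ℕ.∣ toℕ k - c ∣)
      ≤⟨ ℚ.+-monoʳ-≤ (½ * ½ ^ c) (Σ-geometric K c) ⟩
    ½ * ½ ^ c + (natℚ 3 - ½ ^ c)
      ≡⟨ solve 1 (λ h → con ½ :* h :+ (con (natℚ 3) :- h) := con (natℚ 3) :- con ½ :* h) refl (½ ^ c) ⟩
    natℚ 3 - ½ * ½ ^ c ∎

  -- Two numbers that are close to weighted averages of y and y′ differ by little more
  -- than the average difference of y and y′.
  averages-close : ∀ {n e e′} x x′ (u y y′ : Fin n → ℚ) → (∀ j → 0ℚ ≤ u j) →
    ∣ x′ - Σ (λ j → u j * y′ j) ∣ ≤ e′ → ∣ x - Σ (λ j → u j * y j) ∣ ≤ e →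
    ∣ x′ - x ∣ ≤ e′ + (Σ (λ j → u j * ∣ y′ j - y j ∣) + e)
  averages-close {e = e} {e′} x x′ u y y′ 0≤u h′ h = begin
    ∣ x′ - x ∣
      ≤⟨ ∣∣-triangle x′ s′ x ⟩
    ∣ x′ - s′ ∣ + ∣ s′ - x ∣
      ≤⟨ ℚ.+-mono-≤ h′ (∣∣-triangle s′ s x) ⟩
    e′ + (∣ s′ - s ∣ + ∣ s - x ∣)
      ≤⟨ ℚ.+-monoʳ-≤ e′ (ℚ.+-mono-≤ middle (ℚ.≤-trans (ℚ.≤-reflexive (∣∣-sym s x)) h)) ⟩
    e′ + (Σ (λ j → u j * ∣ y′ j - y j ∣) + e) ∎
    where
    s = Σ (λ j → u j * y j)
    s′ = Σ (λ j → u j * y′ j)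
    termwise : ∀ j → ∣ u j * y′ j - u j * y j ∣ ≡ u j * ∣ y′ j - y j ∣
    termwise j = begin-equality
      ∣ u j * y′ j - u j * y j ∣   ≡⟨ cong ∣_∣ (solve 3 (λ u a b → u :* a :- u :* b := u :* (a :- b)) refl (u j) (y′ j) (y j)) ⟩
      ∣ u j * (y′ j - y j) ∣       ≡⟨ ℚ.∣p*q∣≡∣p∣*∣q∣ (u j) (y′ j - y j) ⟩
      ∣ u j ∣ * ∣ y′ j - y j ∣     ≡⟨ cong (_* ∣ y′ j - y j ∣) (ℚ.0≤p⇒∣p∣≡p (0≤u j)) ⟩
      u j * ∣ y′ j - y j ∣         ∎
    middle : ∣ s′ - s ∣ ≤ Σ (λ j → u j * ∣ y′ j - y j ∣)
    middle = begin
      ∣ s′ - s ∣                                 ≡⟨ cong ∣_∣ (Σ-difference (λ j → u j * y′ j) (λ j → u j * y j)) ⟨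
      ∣ Σ (λ j → u j * y′ j - u j * y j) ∣       ≤⟨ ∣Σ∣≤Σ∣∣ (λ j → u j * y′ j - u j * y j) ⟩
      Σ (λ j → ∣ u j * y′ j - u j * y j ∣)       ≡⟨ Σ-cong termwise ⟩
      Σ (λ j → u j * ∣ y′ j - y j ∣)             ∎

  -- The errors of a query decay geometrically away from the density at which R meets the
  -- unknown part of A in about one point on average.  The constant is the error there, if
  -- Q bounds the number of known members.
  errorConst : ℕ → ℚ
  errorConst Q = natℚ 16 + natℚ 6 * natℚ Q

  0≤errorConst : ∀ Q → 0ℚ ≤ errorConst Q
  0≤errorConst Q = +-0≤ (0≤natℚ 16) (*-0≤ (0≤natℚ 6) (0≤natℚ Q))

  -- The bound on the total variation for a tester with q of Q queries left.  The constant 3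
  -- bounds the two-sided geometric series, and the factor 2 accounts for the two averages.
  variationBound : ℕ → ℕ → ℚ
  variationBound Q zero    = 0ℚ
  variationBound Q (suc q) = natℚ 3 * errorConst Q + 2ℚ * variationBound Q q

  0≤variationBound : ∀ Q q → 0ℚ ≤ variationBound Q q
  0≤variationBound Q zero    = ℚ.≤-refl
  0≤variationBound Q (suc q) = +-0≤ (*-0≤ (0≤natℚ 3) (0≤errorConst Q)) (*-0≤ 0≤2 (0≤variationBound Q q))

  module Variation (N : ℕ) (φ : Verdict → ℚ) (∣φ∣≤1 : ∀ v → ∣ φ v ∣ ≤ 1ℚ) where
    open Evaluation N φ ∣φ∣≤1

    -- The change of the expected payoff between the densities k and k + 1.
    D : ∀ {n q} → ℕ → Subset n → Tester n q → ℚ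
    D k I T = ∣ W (density (suc k)) I T - W (density k) I T ∣

    0≤D : ∀ {n q} k (I : Subset n) (T : Tester n q) → 0ℚ ≤ D k I T
    0≤D k I T = ℚ.0≤∣p∣ (W (density (suc k)) I T - W (density k) I T)

    module _ {n q Q : ℕ} {C : ℚ} (I A : Subset n) (ne : Nonempty A) (∣I∣≤Q : ∣ I ∣ₛ ℕ.≤ Q)
             (T : Fin n → Tester n q) (bounds : ∀ j → WeightBound N C (T j)) where
      private
        U : Subset n
        U = unknown A I
        a : ℕ
        a = ∣ U ∣ₛ
        c : ℕ
        c = proj₁ (scale a)
        i : ℚ
        i = natℚ ∣ A ∩ I ∣ₛ
        0≤C = bound-nonneg (bounds (proj₁ ne))
        0≤i : 0ℚ ≤ i
        0≤i = 0≤natℚ ∣ A ∩ I ∣ₛ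
        i≤Q : i ≤ natℚ Q
        i≤Q = natℚ-mono (ℕ.≤-trans (∣p∩q∣≤∣q∣ A I) ∣I∣≤Q)

      -- The averages of the change of the expected payoff over the answers in the two
      -- approximations, and the error of the one that applies at the density k.
      sparseAverage denseAverage error : ℕ → ℚ
      sparseAverage k = Σ (λ j → response I A j * D k I (T j))
      denseAverage  k = Σ (λ j → uniformOn U j * D k (I [ j ]≔ true) (T j))
      error         k = errorConst Q * ½ ^ ℕ.∣ k - c ∣

      -- Both k and k + 1 are at most c, so R meets U in at least 4ᶜ⁻ᵏ⁻¹ points on average.
      dense-step : ∀ k d → k ℕ.+ suc d ≡ c → D k I (query A ne T) ≤ denseAverage k + error k * C
      dense-step k d k+d≡c = begin
        D k I (query A ne T)
          ≤⟨ averages-close (W (density k) I (query A ne T)) (W (density (suc k)) I (query A ne T)) (uniformOn U)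
               (λ j → W (density k) (I [ j ]≔ true) (T j)) (λ j → W (density (suc k)) (I [ j ]≔ true) (T j)) (0≤uniformOn U)
               (approximation (suc k) d (trans (sym (ℕ.+-suc k d)) k+d≡c))
               (approximation k (suc d) k+d≡c) ⟩
        (2ℚ * i + 2ℚ) * ½ ^ d * C + (denseAverage k + (2ℚ * i + 2ℚ) * (½ * ½ ^ d) * C)
          ≡⟨ solve 4 (λ i h C D → (con 2ℚ :* i :+ con 2ℚ) :* h :* C :+ (D :+ (con 2ℚ :* i :+ con 2ℚ) :* (con ½ :* h) :* C)
               := D :+ (con (natℚ 6) :+ con (natℚ 6) :* i) :* (con ½ :* h) :* C) refl i (½ ^ d) C (denseAverage k) ⟩
        denseAverage k + (natℚ 6 + natℚ 6 * i) * ½ ^ suc d * C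
          ≤⟨ ℚ.+-monoʳ-≤ (denseAverage k) (*-monoʳ C 0≤C (*-monoʳ (½ ^ suc d) (0≤½^ (suc d))
               (ℚ.+-mono-≤ (natℚ-mono {6} {16} (ℕ.m≤m+n 6 10)) (*-monoˡ (natℚ 6) (0≤natℚ 6) i≤Q)))) ⟩
        denseAverage k + errorConst Q * ½ ^ suc d * C
          ≡⟨ cong (λ z → denseAverage k + errorConst Q * ½ ^ z * C)
               (trans (cong ℕ.∣ k -_∣ (sym k+d≡c)) (ℕ.∣m-m+n∣≡n k (suc d))) ⟨
        denseAverage k + error k * C ∎
        where
        4^c≤a : 4 ℕ.^ c ℕ.≤ a
        4^c≤a with proj₂ (proj₂ (scale a))
        ... | inj₂ h   = h
        ... | inj₁ c≡0 = contradiction (trans (sym (ℕ.+-suc k d)) (trans k+d≡c c≡0)) λ ()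

        approximation : ∀ k d → k ℕ.+ d ≡ c →
          ∣ W (density k) I (query A ne T) - Σ (λ j → uniformOn U j * W (density k) (I [ j ]≔ true) (T j)) ∣
            ≤ (2ℚ * i + 2ℚ) * ½ ^ d * C
        approximation k d k+d≡c = W-dense (density-probability k) I A ne T bounds (½ ^ d) (2ℚ ^ d) ((2ℚ * i + 2ℚ) * ½ ^ d)
          (ℚ.<-≤-trans (*-0< (^-0< d (ℚ.positive⁻¹ 2ℚ)) (^-0< d (ℚ.positive⁻¹ 2ℚ))) mean)
          (0≤½^ d) (trans (ℚ.*-comm (½ ^ d) (2ℚ ^ d)) (2^*½^ d)) (dense-error i (natℚ a * density k) d 0≤i mean)
          where
          mean : 2ℚ ^ d * 2ℚ ^ d ≤ natℚ a * density k
          mean = dense-mean a k d (subst (λ z → 4 ℕ.^ z ℕ.≤ a) (sym k+d≡c) 4^c≤a)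

      sparse-step : ∀ k d → c ℕ.+ d ≡ k → D k I (query A ne T) ≤ sparseAverage k + error k * C
      sparse-step k d c+d≡k = begin
        D k I (query A ne T)
          ≤⟨ averages-close (W (density k) I (query A ne T)) (W (density (suc k)) I (query A ne T)) (response I A)
               (λ j → W (density k) I (T j)) (λ j → W (density (suc k)) I (T j)) (0≤uniformOn (target I A))
               (W-sparse (density-probability (suc k)) I A ne T bounds)
               (W-sparse (density-probability k) I A ne T bounds) ⟩
        2ℚ * (natℚ a * density (suc k)) * C + (sparseAverage k + 2ℚ * (natℚ a * density k) * C)
          ≤⟨ ℚ.+-mono-≤ (*-monoʳ C 0≤C (*-monoˡ 2ℚ 0≤2 (mean (suc k) (suc d) (trans (ℕ.+-suc c d) (cong suc c+d≡k)))))
               (ℚ.+-monoʳ-≤ (sparseAverage k) (*-monoʳ C 0≤C (*-monoˡ 2ℚ 0≤2 (mean k d c+d≡k)))) ⟩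
        2ℚ * (natℚ 4 * (½ * ½ ^ d)) * C + (sparseAverage k + 2ℚ * (natℚ 4 * ½ ^ d) * C)
          ≤⟨ ≤-from ((natℚ 4 + natℚ 6 * natℚ Q) * ½ ^ d * C)
               (solve 4 (λ h C D Q → D :+ (con (natℚ 16) :+ con (natℚ 6) :* Q) :* h :* C
                 := (con 2ℚ :* (con (natℚ 4) :* (con ½ :* h)) :* C :+ (D :+ con 2ℚ :* (con (natℚ 4) :* h) :* C))
                    :+ (con (natℚ 4) :+ con (natℚ 6) :* Q) :* h :* C) refl (½ ^ d) C (sparseAverage k) (natℚ Q))
               (*-0≤ (*-0≤ (+-0≤ (0≤natℚ 4) (*-0≤ (0≤natℚ 6) (0≤natℚ Q))) (0≤½^ d)) 0≤C) ⟩
        sparseAverage k + errorConst Q * ½ ^ d * C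
          ≡⟨ cong (λ z → sparseAverage k + errorConst Q * ½ ^ z * C)
               (trans (cong ℕ.∣_- c ∣ (sym c+d≡k)) (trans (ℕ.∣-∣-comm (c ℕ.+ d) c) (ℕ.∣m-m+n∣≡n c d))) ⟨
        sparseAverage k + error k * C ∎
        where
        mean : ∀ k d → c ℕ.+ d ≡ k → natℚ a * density k ≤ natℚ 4 * ½ ^ d
        mean k d c+d≡k = subst (λ z → natℚ a * density z ≤ natℚ 4 * ½ ^ d) c+d≡k
          (sparse-mean a c d (proj₁ (proj₂ (scale a))))

      -- Adding both averages avoids distinguishing the densities when summing over them.
      query-step : ∀ k → D k I (query A ne T) ≤ sparseAverage k + denseAverage k + error k * C
      query-step k with k ℕ.<? c
      ... | no k≮c = ℚ.≤-trans (sparse-step k (k ℕ.∸ c) (ℕ.m+[n∸m]≡n (ℕ.≮⇒≥ k≮c)))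
        (ℚ.+-monoˡ-≤ (error k * C) (≤-from {sparseAverage k} (denseAverage k) refl
          (Σ-nonneg (λ j → *-0≤ (0≤uniformOn U j) (0≤D k (I [ j ]≔ true) (T j))))))
      ... | yes k<c = ℚ.≤-trans (dense-step k (c ℕ.∸ suc k) (trans (ℕ.+-suc k (c ℕ.∸ suc k)) (ℕ.m+[n∸m]≡n k<c)))
        (ℚ.+-monoˡ-≤ (error k * C) (≤-from {denseAverage k} (sparseAverage k) (ℚ.+-comm (sparseAverage k) (denseAverage k))
          (Σ-nonneg (λ j → *-0≤ (0≤uniformOn (target I A) j) (0≤D k I (T j))))))

    D-decide : ∀ {n q} k (I : Subset n) v → D k I (decide {q = q} v) ≡ 0ℚ
    D-decide {n} k I v = trans
      (cong₂ (λ x y → ∣ x - y ∣) (E-const n (density (suc k)) (φ v)) (E-const n (density k) (φ v)))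
      (cong ∣_∣ (ℚ.+-inverseʳ (φ v)))

    D-toss : ∀ {n q m} k (I : Subset n) (coin : Distribution m) (T : Fin m → Tester n q) →
      D k I (toss coin T) ≤ Σ (λ i → ∣ weight N coin i ∣ * D k I (T i))
    D-toss k I coin T = begin
      ∣ W (density (suc k)) I (toss coin T) - W (density k) I (toss coin T) ∣
        ≡⟨ cong₂ (λ x y → ∣ x - y ∣) (W-combination (density (suc k)) I w T) (W-combination (density k) I w T) ⟩
      ∣ Σ (λ i → w i * W (density (suc k)) I (T i)) - Σ (λ i → w i * W (density k) I (T i)) ∣
        ≡⟨ cong ∣_∣ (Σ-difference (λ i → w i * W (density (suc k)) I (T i)) (λ i → w i * W (density k) I (T i))) ⟨
      ∣ Σ (λ i → w i * W (density (suc k)) I (T i) - w i * W (density k) I (T i)) ∣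
        ≤⟨ ∣Σ∣≤Σ∣∣ (λ i → w i * W (density (suc k)) I (T i) - w i * W (density k) I (T i)) ⟩
      Σ (λ i → ∣ w i * W (density (suc k)) I (T i) - w i * W (density k) I (T i) ∣)
        ≡⟨ Σ-cong (λ i → trans
             (cong ∣_∣ (solve 3 (λ u a b → u :* a :- u :* b := u :* (a :- b)) refl (w i) (W (density (suc k)) I (T i)) (W (density k) I (T i))))
             (ℚ.∣p*q∣≡∣p∣*∣q∣ (w i) (W (density (suc k)) I (T i) - W (density k) I (T i)))) ⟩
      Σ (λ i → ∣ w i ∣ * D k I (T i)) ∎
      where
      w = weight N coin

    -- The total variation of the expected payoff along the first K + 1 densities.
    totalVariation : ∀ {n q} → ℕ → Subset n → Tester n q → ℚ
    totalVariation K I T = Σ {K} (λ k → D (toℕ k) I T)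

    totalVariation-combination : ∀ {n m q} K (I : Fin m → Subset n) (u : Fin m → ℚ) (T : Fin m → Tester n q) →
      Σ {K} (λ k → Σ (λ i → u i * D (toℕ k) (I i) (T i))) ≡ Σ (λ i → u i * totalVariation K (I i) (T i))
    totalVariation-combination {m = m} K I u T = trans (∑-comm {K} {m} (λ k i → u i * D (toℕ k) (I i) (T i)))
      (Σ-cong (λ i → Σ-scaleˡ {K} (u i) (λ k → D (toℕ k) (I i) (T i))))

    -- By induction on the tester: coins average, and each query costs the bound of
    -- query-step, summed over the densities.
    totalVariation≤ : ∀ {n q Q C} K {T : Tester n q} → WeightBound N C T → (I : Subset n) →
      ∣ I ∣ₛ ℕ.+ q ℕ.≤ Q → totalVariation K I T ≤ variationBound Q q * C
    totalVariation≤ {q = q} {Q} {C} K {decide v} bound@(decide 1≤C) I _ = begin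
      Σ {K} (λ k → D (toℕ k) I (decide {q = q} v))    ≡⟨ Σ-cong {K} (λ k → D-decide {q = q} (toℕ k) I v) ⟩
      Σ {K} (λ k → 0ℚ)                                ≡⟨ sum-replicate-zero K ⟩
      0ℚ                                              ≤⟨ *-0≤ (0≤variationBound Q q) (ℚ.≤-trans 0≤1 1≤C) ⟩
      variationBound Q q * C                          ∎
    totalVariation≤ {q = q} {Q} {C} K {toss coin T} (toss {D = B} 0≤B bounds wB≤C) I I+q≤Q = begin
      totalVariation K I (toss coin T)
        ≤⟨ Σ-mono {K} (λ k → D-toss (toℕ k) I coin T) ⟩
      Σ {K} (λ k → Σ (λ i → w i * D (toℕ k) I (T i)))
        ≡⟨ totalVariation-combination K (λ _ → I) w T ⟩
      Σ (λ i → w i * totalVariation K I (T i))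
        ≤⟨ Σ-mono (λ i → *-monoˡ (w i) (ℚ.0≤∣p∣ (weight N coin i)) (totalVariation≤ K (bounds i) I I+q≤Q)) ⟩
      Σ (λ i → w i * (variationBound Q q * B))
        ≡⟨ Σ-scaleʳ (variationBound Q q * B) w ⟩
      Σ w * (variationBound Q q * B)
        ≡⟨ solve 3 (λ w v b → w :* (v :* b) := v :* (w :* b)) refl (Σ w) (variationBound Q q) B ⟩
      variationBound Q q * (Σ w * B)
        ≤⟨ *-monoˡ (variationBound Q q) (0≤variationBound Q q) wB≤C ⟩
      variationBound Q q * C ∎
      where
      w : Fin _ → ℚ
      w i = ∣ weight N coin i ∣
    totalVariation≤ {n} {suc q} {Q} {C} K {query A ne T} (query bounds) I I+q≤Q = begin
      totalVariation K I (query A ne T)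
        ≤⟨ Σ-mono {K} (λ k → query-step {Q = Q} I A ne ∣I∣≤Q T bounds (toℕ k)) ⟩
      Σ {K} (λ k → s (toℕ k) + d (toℕ k) + e (toℕ k) * C)
        ≡⟨ trans (∑-distrib-+ {K} (λ k → s (toℕ k) + d (toℕ k)) (λ k → e (toℕ k) * C))
             (cong₂ _+_ (∑-distrib-+ {K} (λ k → s (toℕ k)) (λ k → d (toℕ k)))
               (trans (Σ-scaleʳ {K} C (λ k → e (toℕ k))) (cong (_* C) (Σ-scaleˡ {K} (errorConst Q) (λ k → ½ ^ ℕ.∣ toℕ k - c ∣))))) ⟩
      Σ {K} (λ k → s (toℕ k)) + Σ {K} (λ k → d (toℕ k)) + errorConst Q * Σ {K} (λ k → ½ ^ ℕ.∣ toℕ k - c ∣) * C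
        ≤⟨ ℚ.+-mono-≤ (ℚ.+-mono-≤ sparse dense) (*-monoʳ C 0≤C (*-monoˡ (errorConst Q) (0≤errorConst Q)
             (ℚ.≤-trans (Σ-geometric K c) (≤-from (½ ^ c) (solve 1 (λ h → con (natℚ 3) := con (natℚ 3) :- h :+ h) refl (½ ^ c)) (0≤½^ c))))) ⟩
      V + V + errorConst Q * natℚ 3 * C
        ≡⟨ solve 3 (λ v e C → v :* C :+ v :* C :+ e :* con (natℚ 3) :* C := (con (natℚ 3) :* e :+ con 2ℚ :* v) :* C)
             refl (variationBound Q q) (errorConst Q) C ⟩
      variationBound Q (suc q) * C ∎
      where
      U = unknown A I
      c = proj₁ (scale ∣ U ∣ₛ)
      V = variationBound Q q * C
      0≤C = bound-nonneg (bounds (proj₁ ne))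
      0≤V = *-0≤ (0≤variationBound Q q) 0≤C
      I+1+q≤Q : suc ∣ I ∣ₛ ℕ.+ q ℕ.≤ Q
      I+1+q≤Q = subst (ℕ._≤ Q) (ℕ.+-suc ∣ I ∣ₛ q) I+q≤Q
      ∣I∣≤Q : ∣ I ∣ₛ ℕ.≤ Q
      ∣I∣≤Q = ℕ.m+n≤o⇒m≤o ∣ I ∣ₛ I+q≤Q
      s d e : ℕ → ℚ
      s = sparseAverage {Q = Q} I A ne ∣I∣≤Q T bounds
      d = denseAverage {Q = Q} I A ne ∣I∣≤Q T bounds
      e = error {Q = Q} I A ne ∣I∣≤Q T bounds
      sparse : Σ {K} (λ k → s (toℕ k)) ≤ V
      sparse = subst (_≤ V) (sym (totalVariation-combination K (λ _ → I) (response I A) T))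
        (Σ-average (response I A) (λ j → totalVariation K I (T j)) (0≤uniformOn (target I A))
          (ℚ.≤-reflexive (Σ-response I A ne)) 0≤V
          (λ j → totalVariation≤ K (bounds j) I (ℕ.≤-trans (ℕ.n≤1+n (∣ I ∣ₛ ℕ.+ q)) I+1+q≤Q)))
      dense : Σ {K} (λ k → d (toℕ k)) ≤ V
      dense = subst (_≤ V) (sym (totalVariation-combination K (λ j → I [ j ]≔ true) (uniformOn U) T))
        (Σ-average (uniformOn U) (λ j → totalVariation K (I [ j ]≔ true) (T j)) (0≤uniformOn U) (Σ-uniformOn≤1 U) 0≤V
          (λ j → totalVariation≤ K (bounds j) (I [ j ]≔ true) (ℕ.≤-trans (ℕ.+-monoˡ-≤ q (∣update∣≤ I j)) I+1+q≤Q)))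

  variationBound≤ : ∀ Q → variationBound Q Q ≤ natℚ (48 ℕ.* 4 ℕ.^ Q)
  variationBound≤ Q = begin
    variationBound Q Q
      ≤⟨ ≤-from (natℚ 3 * e) refl (*-0≤ (0≤natℚ 3) (0≤errorConst Q)) ⟩
    variationBound Q Q + natℚ 3 * e
      ≡⟨ closed Q ⟩
    natℚ 3 * e * 2ℚ ^ Q
      ≤⟨ *-monoʳ (2ℚ ^ Q) (^-0≤ Q 0≤2) (*-monoˡ (natℚ 3) (0≤natℚ 3) e≤) ⟩
    natℚ 3 * (natℚ 16 * 2ℚ ^ Q) * 2ℚ ^ Q
      ≡⟨ solve 1 (λ u → con (natℚ 3) :* (con (natℚ 16) :* u) :* u := con (natℚ 48) :* (u :* u)) refl (2ℚ ^ Q) ⟩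
    natℚ 48 * (2ℚ ^ Q * 2ℚ ^ Q)
      ≡⟨ cong (natℚ 48 *_) (natℚ-4^ Q) ⟨
    natℚ 48 * natℚ (4 ℕ.^ Q)
      ≡⟨ natℚ-* 48 (4 ℕ.^ Q) ⟨
    natℚ (48 ℕ.* 4 ℕ.^ Q) ∎
    where
    e = errorConst Q

    -- The recursion has the closed form 3 e (2 ^ q - 1).
    closed : ∀ q → variationBound Q q + natℚ 3 * e ≡ natℚ 3 * e * 2ℚ ^ q
    closed zero = solve 1 (λ e → con 0ℚ :+ con (natℚ 3) :* e := con (natℚ 3) :* e :* con 1ℚ) refl e
    closed (suc q) = begin-equality
      natℚ 3 * e + 2ℚ * variationBound Q q + natℚ 3 * e
        ≡⟨ solve 2 (λ e v → con (natℚ 3) :* e :+ con 2ℚ :* v :+ con (natℚ 3) :* e := con 2ℚ :* (v :+ con (natℚ 3) :* e)) refl e (variationBound Q q) ⟩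
      2ℚ * (variationBound Q q + natℚ 3 * e)
        ≡⟨ cong (2ℚ *_) (closed q) ⟩
      2ℚ * (natℚ 3 * e * 2ℚ ^ q)
        ≡⟨ solve 2 (λ e u → con 2ℚ :* (con (natℚ 3) :* e :* u) := con (natℚ 3) :* e :* (con 2ℚ :* u)) refl e (2ℚ ^ q) ⟩
      natℚ 3 * e * (2ℚ * 2ℚ ^ q) ∎

    1+n≤2^n : ∀ n → suc n ℕ.≤ 2 ℕ.^ n
    1+n≤2^n zero    = ℕ.≤-refl
    1+n≤2^n (suc n) = ℕ.+-mono-≤ (ℕ.m^n>0 2 n) (ℕ.≤-trans (1+n≤2^n n) (ℕ.m≤m+n (2 ℕ.^ n) 0))

    e≤ : e ≤ natℚ 16 * 2ℚ ^ Q
    e≤ = begin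
      natℚ 16 + natℚ 6 * natℚ Q
        ≤⟨ ≤-from (natℚ 10 * natℚ Q) (solve 1 (λ Q → con (natℚ 16) :* (con 1ℚ :+ Q)
             := con (natℚ 16) :+ con (natℚ 6) :* Q :+ con (natℚ 10) :* Q) refl (natℚ Q)) (*-0≤ (0≤natℚ 10) (0≤natℚ Q)) ⟩
      natℚ 16 * (1ℚ + natℚ Q)
        ≡⟨ cong (natℚ 16 *_) (natℚ-suc Q) ⟨
      natℚ 16 * natℚ (suc Q)
        ≤⟨ *-monoˡ (natℚ 16) (0≤natℚ 16) (natℚ-mono (1+n≤2^n Q)) ⟩
      natℚ 16 * natℚ (2 ℕ.^ Q)
        ≡⟨ cong (natℚ 16 *_) (natℚ-^ Q) ⟩
      natℚ 16 * 2ℚ ^ Q ∎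

  -- Real numbers and the tester at a fixed stage of approximation

  -- The predicate P holds from some index on.
  Eventually : (ℕ → Set) → Set
  Eventually P = ∃[ N₀ ] (∀ N → N₀ ℕ.≤ N → P N)

  eventually-map : ∀ {P Q : ℕ → Set} → (∀ N → P N → Q N) → Eventually P → Eventually Q
  eventually-map f (N₀ , h) = N₀ , λ N N₀≤N → f N (h N N₀≤N)

  eventually-× : ∀ {P Q : ℕ → Set} → Eventually P → Eventually Q → Eventually (λ N → P N × Q N)
  eventually-× (N , h) (M , g) = N ℕ.⊔ M , λ L ≤L →
    h L (ℕ.m⊔n≤o⇒m≤o N M ≤L) , g L (ℕ.m⊔n≤o⇒n≤o N M ≤L)

  eventually-Fin : ∀ {k} {P : Fin k → ℕ → Set} → (∀ i → Eventually (P i)) → Eventually (λ N → ∀ i → P i N)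
  eventually-Fin {zero}  h = 0 , λ _ _ ()
  eventually-Fin {suc k} h = eventually-map (λ N (p , ps) → λ { zero → p ; (suc i) → ps i })
    (eventually-× (h zero) (eventually-Fin (λ i → h (suc i))))

  eventually-Subset : ∀ {n} {P : Subset n → ℕ → Set} → (∀ S → Eventually (P S)) → Eventually (λ N → ∀ S → P S N)
  eventually-Subset {zero}  h = eventually-map (λ N p → λ { [] → p }) (h [])
  eventually-Subset {suc n} h = eventually-map (λ N (p , q) → λ { (true ∷ S) → p S ; (false ∷ S) → q S })
    (eventually-× (eventually-Subset (λ S → h (true ∷ S))) (eventually-Subset (λ S → h (false ∷ S))))

  ≤-everywhere : ∀ {x y} → (∀ N → seq x N ≤ seq y N) → x ℝ.≤ y
  ≤-everywhere {x} {y} h = ℝ.≤-intro λ ε 0<ε → 0 , λ N _ → ℚ.≤-trans (h N) (≤-from ε refl (ℚ.<⇒≤ 0<ε))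

  ≃-everywhere : ∀ {x y} → (∀ N → seq x N ≡ seq y N) → x ℝ.≃ y
  ≃-everywhere h = ≤-everywhere (λ N → ℚ.≤-reflexive (h N)) , ≤-everywhere (λ N → ℚ.≤-reflexive (sym (h N)))

  ½+½ : ∀ x → ½ * x + ½ * x ≡ x
  ½+½ = solve 1 (λ x → con ½ :* x :+ con ½ :* x := x) refl

  0<½* : ∀ {ε} → 0ℚ < ε → 0ℚ < ½ * ε
  0<½* = *-0< (ℚ.positive⁻¹ ½)

  ≤ℝ-trans : ∀ {x y z} → x ℝ.≤ y → y ℝ.≤ z → x ℝ.≤ z
  ≤ℝ-trans {x} {y} {z} (ℝ.≤-intro f) (ℝ.≤-intro g) = ℝ.≤-intro λ ε 0<ε →
    eventually-map (λ N (h₁ , h₂) → begin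
      seq x N                        ≤⟨ h₁ ⟩
      seq y N + ½ * ε                ≤⟨ ℚ.+-monoˡ-≤ (½ * ε) h₂ ⟩
      seq z N + ½ * ε + ½ * ε        ≡⟨ trans (ℚ.+-assoc (seq z N) (½ * ε) (½ * ε)) (cong (seq z N +_) (½+½ ε)) ⟩
      seq z N + ε                    ∎)
      (eventually-× (f (½ * ε) (0<½* 0<ε)) (g (½ * ε) (0<½* 0<ε)))

  ≃-trans : ∀ {x y z} → x ℝ.≃ y → y ℝ.≃ z → x ℝ.≃ z
  ≃-trans (x≤y , y≤x) (y≤z , z≤y) = ≤ℝ-trans x≤y y≤z , ≤ℝ-trans z≤y y≤x

  +ℝ-mono : ∀ {x y u v} → x ℝ.≤ y → u ℝ.≤ v → (x ℝ.+ u) ℝ.≤ (y ℝ.+ v)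
  +ℝ-mono {x} {y} {u} {v} (ℝ.≤-intro f) (ℝ.≤-intro g) = ℝ.≤-intro λ ε 0<ε →
    eventually-map (λ N (h₁ , h₂) → begin
      seq x N + seq u N                        ≤⟨ ℚ.+-mono-≤ h₁ h₂ ⟩
      seq y N + ½ * ε + (seq v N + ½ * ε)      ≡⟨ solve 3 (λ y v e → y :+ con ½ :* e :+ (v :+ con ½ :* e) := y :+ v :+ e) refl (seq y N) (seq v N) ε ⟩
      seq y N + seq v N + ε                    ∎)
      (eventually-× (f (½ * ε) (0<½* 0<ε)) (g (½ * ε) (0<½* 0<ε)))

  sumℝ-mono : ∀ {n} {f g : Fin n → ℝ} → (∀ i → f i ℝ.≤ g i) → ℝ.sum f ℝ.≤ ℝ.sum g
  sumℝ-mono {zero}  h = ≤-everywhere λ _ → ℚ.≤-refl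
  sumℝ-mono {suc n} h = +ℝ-mono (h zero) (sumℝ-mono (λ i → h (suc i)))

  seq-sum : ∀ {n} (f : Fin n → ℝ) N → seq (ℝ.sum f) N ≡ Σ (λ i → seq (f i) N)
  seq-sum {zero}  f N = refl
  seq-sum {suc n} f N = cong (seq (f zero) N +_) (seq-sum (λ i → f (suc i)) N)

  -- The limits of the approximate weights are nonnegative with sum 1, so the late weights
  -- have absolute values close to them.
  coin-weights : ∀ {k} (coin : Distribution k) η → 0ℚ < η →
    Eventually (λ N → Σ (λ i → ∣ weight N coin i ∣) ≤ 1ℚ + η)
  coin-weights {k} coin η 0<η = eventually-map bound
    (eventually-× (eventually-Fin (λ i → ℝ._≤_.eventually (nonNegative coin i) δ 0<δ))
                  (ℝ._≤_.eventually (proj₁ (total coin)) (½ * η) (0<½* 0<η)))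
    where
    small = scale-down (0≤natℚ (2 ℕ.* k)) (0<½* 0<η)
    δ = proj₁ small
    0<δ = proj₁ (proj₂ small)

    bound : ∀ N → (∀ i → 0ℚ ≤ weight N coin i + δ) × seq (ℝ.sum (prob coin)) N ≤ 1ℚ + ½ * η →
      Σ (λ i → ∣ weight N coin i ∣) ≤ 1ℚ + η
    bound N (0≤w+δ , Σw≤) = begin
      Σ (λ i → ∣ w i ∣)
        ≤⟨ Σ-mono (λ i → ∣∣-least
             (≤-from (2ℚ * δ) refl (*-0≤ 0≤2 (ℚ.<⇒≤ 0<δ)))
             (≤-from (2ℚ * (w i + δ)) (solve 2 (λ w d → w :+ con 2ℚ :* d := :- w :+ con 2ℚ :* (w :+ d)) refl (w i) δ)
               (*-0≤ 0≤2 (0≤w+δ i)))) ⟩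
      Σ (λ i → w i + 2ℚ * δ)
        ≡⟨ trans (∑-distrib-+ w (λ _ → 2ℚ * δ)) (cong₂ _+_ (sym (seq-sum (prob coin) N)) (Σ-const k (2ℚ * δ))) ⟩
      seq (ℝ.sum (prob coin)) N + natℚ k * (2ℚ * δ)
        ≡⟨ cong (seq (ℝ.sum (prob coin)) N +_) (trans
             (solve 2 (λ k d → k :* (con 2ℚ :* d) := con 2ℚ :* k :* d) refl (natℚ k) δ) (cong (_* δ) (sym (natℚ-* 2 k)))) ⟩
      seq (ℝ.sum (prob coin)) N + natℚ (2 ℕ.* k) * δ
        ≤⟨ ℚ.+-mono-≤ Σw≤ (proj₂ (proj₂ small)) ⟩
      1ℚ + ½ * η + ½ * η
        ≡⟨ trans (ℚ.+-assoc 1ℚ (½ * η) (½ * η)) (cong (1ℚ +_) (½+½ η)) ⟩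
      1ℚ + η ∎
      where
      w = weight N coin

  weights-bounded : ∀ {n q} (T : Tester n q) η → 0ℚ < η → η ≤ 1ℚ → Eventually (λ N → WeightBound N (1ℚ + η) T)
  weights-bounded (decide v)     η 0<η η≤1 = 0 , λ _ _ → decide (≤-from η refl (ℚ.<⇒≤ 0<η))
  weights-bounded (query A ne T) η 0<η η≤1 =
    eventually-map (λ _ → query) (eventually-Fin (λ j → weights-bounded (T j) η 0<η η≤1))
  weights-bounded (toss coin T)  η 0<η η≤1 =
    eventually-map (λ N (w≤ , bounds) → toss 0≤1+η′ bounds (begin
      Σ (λ i → ∣ weight N coin i ∣) * (1ℚ + η′)
        ≤⟨ *-monoʳ (1ℚ + η′) 0≤1+η′ w≤ ⟩
      (1ℚ + η′) * (1ℚ + η′)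
        ≤⟨ ≤-from (η′ * (1ℚ - η′)) (solve 1 (λ e → con 1ℚ :+ e :* con (natℚ 3)
             := (con 1ℚ :+ e) :* (con 1ℚ :+ e) :+ e :* (con 1ℚ :- e)) refl η′)
             (*-0≤ (ℚ.<⇒≤ 0<η′) (difference-nonneg η′≤1)) ⟩
      1ℚ + η′ * natℚ 3
        ≡⟨ cong (1ℚ +_) (solve 1 (λ e → con ⅓ :* e :* con (natℚ 3) := e) refl η) ⟩
      1ℚ + η ∎))
      (eventually-× (coin-weights coin η′ 0<η′) (eventually-Fin (λ i → weights-bounded (T i) η′ 0<η′ η′≤1)))
    where
    η′ = ⅓ * η
    0<η′ : 0ℚ < η′
    0<η′ = *-0< (ℚ.positive⁻¹ ⅓) 0<η
    η′≤1 : η′ ≤ 1ℚ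
    η′≤1 = ℚ.≤-trans (≤-from ((1ℚ - ⅓) * η) (solve 1 (λ e → e := con ⅓ :* e :+ (con 1ℚ :- con ⅓) :* e) refl η)
      (*-0≤ (ℚ.nonNegative⁻¹ (1ℚ - ⅓)) (ℚ.<⇒≤ 0<η))) η≤1
    0≤1+η′ : 0ℚ ≤ 1ℚ + η′
    0≤1+η′ = +-0≤ 0≤1 (ℚ.<⇒≤ 0<η′)

  -- The uniform distribution on B as a distribution over [n].
  uniform : ∀ {n} (B : Subset n) → 0 ℕ.< ∣ B ∣ₛ → Distribution n
  uniform B 0<∣B∣ = record
    { prob        = λ i → fromℚ (uniformOn B i)
    ; nonNegative = λ i → ≤-everywhere (λ _ → 0≤uniformOn B i)
    ; total       = ≃-everywhere λ N → trans (seq-sum (λ i → fromℚ (uniformOn B i)) N) (Σ-uniformOn B 0<∣B∣)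
    }

  does-∈? : ∀ {n} j (A : Subset n) → does (j ∈? A) ≡ lookup A j
  does-∈? zero    (true  ∷ A) = refl
  does-∈? zero    (false ∷ A) = refl
  does-∈? (suc j) (a     ∷ A) = does-∈? j A

  χ-∈ : ∀ {n} {A : Subset n} {j} → j ∈ A → χ A j ≡ 1ℚ
  χ-∈ j∈A = cong (λ b → if b then 1ℚ else 0ℚ) ([]=⇒lookup j∈A)

  χ-∉ : ∀ {n} {A : Subset n} {j} → j ∉ A → χ A j ≡ 0ℚ
  χ-∉ {A = A} {j} j∉A with lookup A j in eq
  ... | true  = contradiction (lookup⇒[]= j A eq) j∉A
  ... | false = refl

  -- The payoff 1 for the verdict v and 0 for the other one; the output probability of v
  -- is its expected value.
  payoff : Verdict → Verdict → ℚ
  payoff accept accept = 1ℚ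
  payoff reject reject = 1ℚ
  payoff _      _      = 0ℚ

  indicator-payoff : ∀ v w N → seq (indicator w v) N ≡ payoff v w
  indicator-payoff accept accept N = refl
  indicator-payoff accept reject N = refl
  indicator-payoff reject accept N = refl
  indicator-payoff reject reject N = refl

  -- The uniform distribution on S with its conditional sampling oracle.
  module UniformOracle {n : ℕ} (S : Subset n) (0<∣S∣ : 0 ℕ.< ∣ S ∣ₛ) where

    mass-value : ∀ A N → seq (mass (uniform S 0<∣S∣) A) N ≡ natℚ ∣ A ∩ S ∣ₛ * inv ∣ S ∣ₛ
    mass-value A N = begin-equality
      seq (mass (uniform S 0<∣S∣) A) N
        ≡⟨ seq-sum (λ i → if does (i ∈? A) then fromℚ (uniformOn S i) else 0ℝ) N ⟩
      Σ (λ i → seq (if does (i ∈? A) then fromℚ (uniformOn S i) else 0ℝ) N)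
        ≡⟨ Σ-cong (λ i → trans (cong (λ b → seq (if b then fromℚ (uniformOn S i) else 0ℝ) N) (does-∈? i A)) (term i)) ⟩
      Σ (λ i → χ (A ∩ S) i * inv ∣ S ∣ₛ)
        ≡⟨ Σ-scaleʳ (inv ∣ S ∣ₛ) (χ (A ∩ S)) ⟩
      Σ (χ (A ∩ S)) * inv ∣ S ∣ₛ
        ≡⟨ cong (_* inv ∣ S ∣ₛ) (natℚ-∣∣ (A ∩ S)) ⟨
      natℚ ∣ A ∩ S ∣ₛ * inv ∣ S ∣ₛ ∎
      where
      select : ∀ b x → seq (if b then fromℚ x else 0ℝ) N ≡ (if b then 1ℚ else 0ℚ) * x
      select true  x = sym (ℚ.*-identityˡ x)
      select false x = sym (ℚ.*-zeroˡ x)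
      term : ∀ i → seq (if lookup A i then fromℚ (uniformOn S i) else 0ℝ) N ≡ χ (A ∩ S) i * inv ∣ S ∣ₛ
      term i = trans (select (lookup A i) (uniformOn S i))
        (trans (sym (ℚ.*-assoc (χ A i) (χ S i) (inv ∣ S ∣ₛ))) (cong (_* inv ∣ S ∣ₛ) (sym (χ-∩ A S i))))

    -- Whether A meets S can be decided here, so this oracle is explicit.
    oracle : ConditionalOracle (uniform S 0<∣S∣)
    oracle = record
      { respond     = λ A ne → uniform (target S A) (0<∣target∣ S A ne)
      ; outside     = λ A ne j j∉A → ≃-everywhere λ _ → outside-value A j j∉A ∣ A ∩ S ∣ₛ
      ; conditional = λ A ne j j∈A 0<mass → ≃-everywhere λ N → conditional-value A j N j∈A (hit A 0<mass)
      ; uniform     = λ A ne j j∈A mass≃0 → ≃-everywhere λ _ → uniform-value A ne j j∈A (miss A mass≃0)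
      }
      where
      outside-value : ∀ A j → j ∉ A → ∀ c → uniformOn (ifEmpty c A (A ∩ S)) j ≡ 0ℚ
      outside-value A j j∉A zero    = trans (cong (_* inv ∣ A ∣ₛ) (χ-∉ j∉A)) (ℚ.*-zeroˡ (inv ∣ A ∣ₛ))
      outside-value A j j∉A (suc _) = trans (cong (_* inv ∣ A ∩ S ∣ₛ)
        (trans (χ-∩ A S j) (trans (cong (_* χ S j) (χ-∉ j∉A)) (ℚ.*-zeroˡ (χ S j))))) (ℚ.*-zeroˡ (inv ∣ A ∩ S ∣ₛ))

      hit : ∀ A → 0ℝ ℝ.< mass (uniform S 0<∣S∣) A → 0 ℕ.< ∣ A ∩ S ∣ₛ
      hit A (ℝ.<-intro gap 0<gap (N , below)) = ℕ.n≢0⇒n>0 λ none → ℚ.<-irrefl refl (begin-strict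
        0ℚ                                     <⟨ 0<gap ⟩
        gap                                    ≡⟨ ℚ.+-identityˡ gap ⟨
        0ℚ + gap                               ≤⟨ below N ℕ.≤-refl ⟩
        seq (mass (uniform S 0<∣S∣) A) N       ≡⟨ mass-value A N ⟩
        natℚ ∣ A ∩ S ∣ₛ * inv ∣ S ∣ₛ           ≡⟨ trans (cong (λ c → natℚ c * inv ∣ S ∣ₛ) none) (ℚ.*-zeroˡ (inv ∣ S ∣ₛ)) ⟩
        0ℚ                                     ∎)

      -- A positive number of members would give A at least the mass 1 / ∣S∣.
      miss : ∀ A → mass (uniform S 0<∣S∣) A ℝ.≃ 0ℝ → ∣ A ∩ S ∣ₛ ≡ 0
      miss A (mass≤0 , _) with ∣ A ∩ S ∣ₛ ℕ.≟ 0
      ... | yes none = none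
      ... | no  some = contradiction 1≤½ λ { (ℚ.*≤* (ℤ.+≤+ (s≤s ()))) }
        where
        s = natℚ ∣ S ∣ₛ
        v = inv ∣ S ∣ₛ
        0≤s = 0≤natℚ ∣ S ∣ₛ
        0<v : 0ℚ < ½ * v
        0<v = 0<½* (0<inv 0<∣S∣)
          where
          0<inv : ∀ {k} → 0 ℕ.< k → 0ℚ < inv k
          0<inv {suc k} _ = ℚ.positive⁻¹ (inv (suc k))
        1≤½ : 1ℚ ≤ ½
        1≤½ = let (N , below) = ℝ._≤_.eventually mass≤0 (½ * v) 0<v in begin
          1ℚ                                         ≡⟨ inv-inverse 0<∣S∣ ⟨
          s * v                                      ≡⟨ cong (s *_) (ℚ.*-identityˡ v) ⟨
          s * (1ℚ * v)                               ≤⟨ *-monoˡ s 0≤s (*-monoʳ v (0≤inv ∣ S ∣ₛ) (natℚ-mono {1} (ℕ.n≢0⇒n>0 some))) ⟩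
          s * (natℚ ∣ A ∩ S ∣ₛ * v)                  ≡⟨ cong (s *_) (mass-value A N) ⟨
          s * seq (mass (uniform S 0<∣S∣) A) N       ≤⟨ *-monoˡ s 0≤s (below N ℕ.≤-refl) ⟩
          s * (0ℚ + ½ * v)                           ≡⟨ solve 2 (λ s v → s :* (con 0ℚ :+ con ½ :* v) := con ½ :* (s :* v)) refl s v ⟩
          ½ * (s * v)                                ≡⟨ cong (½ *_) (inv-inverse 0<∣S∣) ⟩
          ½                                          ∎

      conditional-value : ∀ A j N → j ∈ A → 0 ℕ.< ∣ A ∩ S ∣ₛ →
        response S A j * seq (mass (uniform S 0<∣S∣) A) N ≡ uniformOn S j
      conditional-value A j N j∈A 0<c = begin-equality
        response S A j * seq (mass (uniform S 0<∣S∣) A) N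
          ≡⟨ cong₂ _*_ (nonempty ∣ A ∩ S ∣ₛ 0<c) (mass-value A N) ⟩
        χ (A ∩ S) j * inv c * (natℚ c * v)
          ≡⟨ solve 4 (λ x i c v → x :* i :* (c :* v) := x :* (c :* i) :* v) refl (χ (A ∩ S) j) (inv c) (natℚ c) v ⟩
        χ (A ∩ S) j * (natℚ c * inv c) * v
          ≡⟨ cong₂ (λ x y → x * y * v) (trans (χ-∩ A S j) (trans (cong (_* χ S j) (χ-∈ j∈A)) (ℚ.*-identityˡ (χ S j)))) (inv-inverse 0<c) ⟩
        χ S j * 1ℚ * v
          ≡⟨ cong (_* v) (ℚ.*-identityʳ (χ S j)) ⟩
        χ S j * v ∎
        where
        c = ∣ A ∩ S ∣ₛ
        v = inv ∣ S ∣ₛ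
        nonempty : ∀ k → 0 ℕ.< k → uniformOn (ifEmpty k A (A ∩ S)) j ≡ χ (A ∩ S) j * inv c
        nonempty (suc _) _ = refl

      uniform-value : ∀ A → Nonempty A → ∀ j → j ∈ A → ∣ A ∩ S ∣ₛ ≡ 0 → response S A j * natℚ ∣ A ∣ₛ ≡ 1ℚ
      uniform-value A ne j j∈A none = begin-equality
        response S A j * natℚ ∣ A ∣ₛ             ≡⟨ cong (λ c → uniformOn (ifEmpty c A (A ∩ S)) j * natℚ ∣ A ∣ₛ) none ⟩
        χ A j * inv ∣ A ∣ₛ * natℚ ∣ A ∣ₛ         ≡⟨ cong (λ x → x * inv ∣ A ∣ₛ * natℚ ∣ A ∣ₛ) (χ-∈ j∈A) ⟩
        1ℚ * inv ∣ A ∣ₛ * natℚ ∣ A ∣ₛ            ≡⟨ solve 2 (λ i a → con 1ℚ :* i :* a := a :* i) refl (inv ∣ A ∣ₛ) (natℚ ∣ A ∣ₛ) ⟩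
        natℚ ∣ A ∣ₛ * inv ∣ A ∣ₛ                 ≡⟨ inv-inverse (nonempty⇒0<∣∣ A ne) ⟩
        1ℚ                                       ∎

    outputProb-eval : ∀ {q} (T : Tester n q) v N → seq (outputProb oracle T v) N ≡ eval N (payoff v) S T
    outputProb-eval (decide w)     v N = indicator-payoff v w N
    outputProb-eval (toss coin T)  v N = trans (seq-sum (λ i → prob coin i ℝ.* outputProb oracle (T i) v) N)
      (Σ-cong (λ i → cong (weight N coin i *_) (outputProb-eval (T i) v N)))
    outputProb-eval (query A ne T) v N = trans (seq-sum (λ j → fromℚ (response S A j) ℝ.* outputProb oracle (T j) v) N)
      (Σ-cong (λ j → cong (response S A j *_) (outputProb-eval (T j) v N)))

  -- The property of even levels

  ¼ ⅛ : ℚ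
  ¼ = ½ * ½
  ⅛ = ½ * ¼

  opposite : Verdict → Verdict
  opposite accept = reject
  opposite reject = accept

  -- The correct verdict on a distribution of level k: accept exactly when k is even.
  verdictAt : ℕ → Verdict
  verdictAt zero    = accept
  verdictAt (suc k) = opposite (verdictAt k)

  -- The density 1 / (n r) of a uniform distribution with probabilities r on its support
  -- lies between half of and 3/2 times 1 / 4ᵏ.
  InRange : ℕ → ℕ → ℚ → Set
  InRange n k r = 2ℚ * natℚ (4 ℕ.^ k) ≤ natℚ 3 * (natℚ n * r) × natℚ n * r ≤ 2ℚ * natℚ (4 ℕ.^ k)

  -- The distributions that are uniform on a set of density about 1 / 4ᵏ, for some even k.
  -- As the total probability is 1, the set may be left implicit.
  EvenLevel : (n : ℕ) → Property n
  EvenLevel n μ = ∃[ k ] (verdictAt k ≡ accept × ∃[ r ] (InRange n k r ×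
    (∀ i → prob μ i ℝ.≃ 0ℝ ⊎ prob μ i ℝ.≃ fromℚ r)))

  evenLevel-invariant : ∀ n → LabelInvariant (EvenLevel n)
  evenLevel-invariant n π μ ν ν≃μπ (k , even , r , range , values) =
    k , even , r , range , λ i → transport i (values _)
    where
    transport : ∀ i → _ → prob ν i ℝ.≃ 0ℝ ⊎ prob ν i ℝ.≃ fromℚ r
    transport i (inj₁ zero-value) = inj₁ (≃-trans (ν≃μπ i) zero-value)
    transport i (inj₂ r-value)    = inj₂ (≃-trans (ν≃μπ i) r-value)

  levels-separate : ∀ {n k k′ r r′} → 0 ℕ.< n → k ℕ.< k′ → InRange n k r → InRange n k′ r′ →
    natℚ 4 * r ≤ natℚ 3 * r′
  levels-separate {n} {k} {k′} {r} {r′} 0<n k<k′ (_ , nr≤) (≤nr′ , _) =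
    ℚ.*-cancelˡ-≤-pos (natℚ n) {{ℚ.positive 0<natℚn}} (begin
      natℚ n * (natℚ 4 * r)              ≡⟨ solve 2 (λ n r → n :* (con (natℚ 4) :* r) := con (natℚ 4) :* (n :* r)) refl (natℚ n) r ⟩
      natℚ 4 * (natℚ n * r)              ≤⟨ *-monoˡ (natℚ 4) (0≤natℚ 4) nr≤ ⟩
      natℚ 4 * (2ℚ * natℚ (4 ℕ.^ k))     ≡⟨ solve 1 (λ x → con (natℚ 4) :* (con 2ℚ :* x) := con 2ℚ :* (con (natℚ 4) :* x)) refl (natℚ (4 ℕ.^ k)) ⟩
      2ℚ * (natℚ 4 * natℚ (4 ℕ.^ k))     ≡⟨ cong (2ℚ *_) (natℚ-* 4 (4 ℕ.^ k)) ⟨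
      2ℚ * natℚ (4 ℕ.^ suc k)            ≤⟨ *-monoˡ 2ℚ 0≤2 (natℚ-mono (ℕ.^-monoʳ-≤ 4 k<k′)) ⟩
      2ℚ * natℚ (4 ℕ.^ k′)               ≤⟨ ≤nr′ ⟩
      natℚ 3 * (natℚ n * r′)             ≡⟨ solve 2 (λ n r → con (natℚ 3) :* (n :* r) := n :* (con (natℚ 3) :* r)) refl (natℚ n) r′ ⟩
      natℚ n * (natℚ 3 * r′)             ∎)
    where
    0<natℚn : 0ℚ < natℚ n
    0<natℚn = ℚ.<-≤-trans (ℚ.positive⁻¹ 1ℚ) (natℚ-mono 0<n)

  -- The distribution ρ is meant to be one of μ and ν.
  distance≥⅛ : ∀ {n} (μ ν ρ : Distribution n) →
    (∀ i → (fromℚ ¼ ℝ.* prob ρ i) ℝ.≤ ℝ.∣ prob μ i ℝ.- prob ν i ∣) → fromℚ ⅛ ℝ.≤ distance μ ν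
  distance≥⅛ μ ν ρ gaps = ℝ.≤-intro λ ε 0<ε → eventually-map (bound ε 0<ε)
    (eventually-× (ℝ._≤_.eventually (proj₂ (total ρ)) ε 0<ε)
                  (ℝ._≤_.eventually (sumℝ-mono gaps) ε 0<ε))
    where
    bound : ∀ ε → 0ℚ < ε → ∀ N →
      1ℚ ≤ seq (ℝ.sum (prob ρ)) N + ε ×
      seq (ℝ.sum (λ i → fromℚ ¼ ℝ.* prob ρ i)) N ≤ seq (ℝ.sum (λ i → ℝ.∣ prob μ i ℝ.- prob ν i ∣)) N + ε →
      ⅛ ≤ seq (distance μ ν) N + ε
    bound ε 0<ε N (1≤ , ¼s≤) = begin
      ½ * ¼
        ≡⟨ cong (½ *_) (ℚ.*-identityʳ ¼) ⟨
      ½ * (¼ * 1ℚ)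
        ≤⟨ *-monoˡ ½ (ℚ.nonNegative⁻¹ ½) (*-monoˡ ¼ (ℚ.nonNegative⁻¹ ¼) 1≤) ⟩
      ½ * (¼ * (s + ε))
        ≡⟨ solve 2 (λ s e → con ½ :* (con ¼ :* (s :+ e)) := con ½ :* (con ¼ :* s) :+ con ⅛ :* e) refl s ε ⟩
      ½ * (¼ * s) + ⅛ * ε
        ≤⟨ ℚ.+-monoˡ-≤ (⅛ * ε) (*-monoˡ ½ (ℚ.nonNegative⁻¹ ½) (subst (_≤ d + ε) ¼Σ ¼s≤)) ⟩
      ½ * (d + ε) + ⅛ * ε
        ≤⟨ ≤-from ((½ - ⅛) * ε) (solve 2 (λ d e → con ½ :* d :+ e := con ½ :* (d :+ e) :+ con ⅛ :* e :+ (con ½ :- con ⅛) :* e) refl d ε)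
             (*-0≤ (ℚ.nonNegative⁻¹ (½ - ⅛)) (ℚ.<⇒≤ 0<ε)) ⟩
      ½ * d + ε ∎
      where
      s = seq (ℝ.sum (prob ρ)) N
      d = seq (ℝ.sum (λ i → ℝ.∣ prob μ i ℝ.- prob ν i ∣)) N
      ¼Σ : seq (ℝ.sum (λ i → fromℚ ¼ ℝ.* prob ρ i)) N ≡ ¼ * s
      ¼Σ = trans (seq-sum (λ i → fromℚ ¼ ℝ.* prob ρ i) N)
        (trans (Σ-scaleˡ ¼ (λ i → seq (prob ρ i) N)) (cong (¼ *_) (sym (seq-sum (prob ρ) N))))

  uniformOn-values : ∀ {n} (S : Subset n) i → uniformOn S i ≡ 0ℚ ⊎ uniformOn S i ≡ inv ∣ S ∣ₛ
  uniformOn-values S i with lookup S i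
  ... | true  = inj₂ (ℚ.*-identityˡ (inv ∣ S ∣ₛ))
  ... | false = inj₁ (ℚ.*-zeroˡ (inv ∣ S ∣ₛ))

  uniformOn≤ : ∀ {n} (S : Subset n) i → uniformOn S i ≤ inv ∣ S ∣ₛ
  uniformOn≤ S i with uniformOn-values S i
  ... | inj₁ e = ℚ.≤-trans (ℚ.≤-reflexive e) (0≤inv ∣ S ∣ₛ)
  ... | inj₂ e = ℚ.≤-reflexive e

  -- Of two uniform distributions with supports of different levels, the one with the
  -- smaller support exceeds the other by at least a quarter of itself on its support.
  odd-far : ∀ {n k} → 0 ℕ.< n → (S : Subset n) (0<∣S∣ : 0 ℕ.< ∣ S ∣ₛ) → verdictAt k ≡ reject →
    InRange n k (inv ∣ S ∣ₛ) → Far (fromℚ ⅛) (EvenLevel n) (uniform S 0<∣S∣)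
  odd-far {n} {k} 0<n S 0<∣S∣ odd range ν (k′ , even , r′ , range′ , values) with ℕ.<-cmp k k′
  ... | tri≈ _ refl _ = contradiction (trans (sym even) odd) λ ()
  ... | tri< k<k′ _ _ = distance≥⅛ (uniform S 0<∣S∣) ν ν (λ i → ℝ.≤-intro (gap i (values i)))
    where
    gap : ∀ i → prob ν i ℝ.≃ 0ℝ ⊎ prob ν i ℝ.≃ fromℚ r′ → ∀ ε → 0ℚ < ε →
      Eventually (λ N → ¼ * seq (prob ν i) N ≤ ∣ uniformOn S i - seq (prob ν i) N ∣ + ε)
    gap i (inj₁ (ν≤0 , _)) ε 0<ε = eventually-map (λ N z≤ε → let z = seq (prob ν i) N in begin
      ¼ * z                ≤⟨ *-monoˡ ¼ (ℚ.nonNegative⁻¹ ¼) z≤ε ⟩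
      ¼ * (0ℚ + ε)         ≤⟨ ≤-from (∣ uniformOn S i - z ∣ + (1ℚ - ¼) * ε)
                                (solve 2 (λ d e → d :+ e := con ¼ :* (con 0ℚ :+ e) :+ (d :+ (con 1ℚ :- con ¼) :* e)) refl ∣ uniformOn S i - z ∣ ε)
                                (+-0≤ (ℚ.0≤∣p∣ (uniformOn S i - z)) (*-0≤ (ℚ.nonNegative⁻¹ (1ℚ - ¼)) (ℚ.<⇒≤ 0<ε))) ⟩
      ∣ uniformOn S i - z ∣ + ε ∎)
      (ℝ._≤_.eventually ν≤0 ε 0<ε)
    gap i (inj₂ (_ , r′≤ν)) ε 0<ε = eventually-map (λ N r′≤z+ε → let z = seq (prob ν i) N in begin
      ¼ * z
        ≤⟨ ≤-from (¼ * (natℚ 3 * r′ - natℚ 4 * r) + (1ℚ - ¼) * (z + ε - r′) + ¼ * ε)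
             (solve 4 (λ z e r r′ → :- (r :- z) :+ e
               := con ¼ :* z :+ (con ¼ :* (con (natℚ 3) :* r′ :- con (natℚ 4) :* r) :+ (con 1ℚ :- con ¼) :* (z :+ e :- r′) :+ con ¼ :* e)) refl z ε r r′)
             (+-0≤ (+-0≤ (*-0≤ (ℚ.nonNegative⁻¹ ¼) (difference-nonneg (levels-separate {k = k} {k′} 0<n k<k′ range range′)))
               (*-0≤ (ℚ.nonNegative⁻¹ (1ℚ - ¼)) (difference-nonneg r′≤z+ε))) (*-0≤ (ℚ.nonNegative⁻¹ ¼) (ℚ.<⇒≤ 0<ε))) ⟩
      - (r - z) + ε
        ≤⟨ ℚ.+-monoˡ-≤ ε (ℚ.neg-antimono-≤ (ℚ.+-monoˡ-≤ (- z) (uniformOn≤ S i))) ⟩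
      - (uniformOn S i - z) + ε
        ≤⟨ ℚ.+-monoˡ-≤ ε (-p≤∣p∣ (uniformOn S i - z)) ⟩
      ∣ uniformOn S i - z ∣ + ε ∎)
      (ℝ._≤_.eventually r′≤ν ε 0<ε)
      where
      r = inv ∣ S ∣ₛ
  ... | tri> _ _ k′<k = distance≥⅛ (uniform S 0<∣S∣) ν (uniform S 0<∣S∣) (λ i → ℝ.≤-intro (gap i (values i)))
    where
    r = inv ∣ S ∣ₛ
    -- The values of ν are at most 3/4 of r.
    small : ∀ i → prob ν i ℝ.≃ 0ℝ ⊎ prob ν i ℝ.≃ fromℚ r′ → ∀ ε → 0ℚ < ε →
      Eventually (λ N → seq (prob ν i) N ≤ (1ℚ - ¼) * r + ε)
    small i (inj₁ (ν≤0 , _)) ε 0<ε = eventually-map (λ N z≤ε → ℚ.≤-trans z≤ε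
      (ℚ.+-monoˡ-≤ ε (*-0≤ (ℚ.nonNegative⁻¹ (1ℚ - ¼)) (0≤inv ∣ S ∣ₛ)))) (ℝ._≤_.eventually ν≤0 ε 0<ε)
    small i (inj₂ (ν≤r′ , _)) ε 0<ε = eventually-map (λ N z≤r′+ε → ℚ.≤-trans z≤r′+ε
      (ℚ.+-monoˡ-≤ ε (≤-from {r′} (¼ * (natℚ 3 * r - natℚ 4 * r′))
        (solve 2 (λ r r′ → (con 1ℚ :- con ¼) :* r := r′ :+ con ¼ :* (con (natℚ 3) :* r :- con (natℚ 4) :* r′)) refl r r′)
        (*-0≤ (ℚ.nonNegative⁻¹ ¼) (difference-nonneg (levels-separate {k = k′} {k} 0<n k′<k range′ range))))))
      (ℝ._≤_.eventually ν≤r′ ε 0<ε)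
    gap : ∀ i → prob ν i ℝ.≃ 0ℝ ⊎ prob ν i ℝ.≃ fromℚ r′ → ∀ ε → 0ℚ < ε →
      Eventually (λ N → ¼ * uniformOn S i ≤ ∣ uniformOn S i - seq (prob ν i) N ∣ + ε)
    gap i value ε 0<ε with uniformOn-values S i
    ... | inj₁ u≡0 = 0 , λ N _ → let z = seq (prob ν i) N in begin
      ¼ * uniformOn S i             ≡⟨ cong (¼ *_) u≡0 ⟩
      0ℚ                            ≤⟨ +-0≤ (ℚ.0≤∣p∣ (uniformOn S i - z)) (ℚ.<⇒≤ 0<ε) ⟩
      ∣ uniformOn S i - z ∣ + ε     ∎
    ... | inj₂ u≡r = eventually-map (λ N z≤ → let z = seq (prob ν i) N in begin
      ¼ * uniformOn S i             ≡⟨ cong (¼ *_) u≡r ⟩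
      ¼ * r                         ≤⟨ ≤-from ((1ℚ - ¼) * r + ε - z)
                                         (solve 3 (λ r z e → r :- z :+ e := con ¼ :* r :+ ((con 1ℚ :- con ¼) :* r :+ e :- z)) refl r z ε)
                                         (difference-nonneg z≤) ⟩
      r - z + ε                     ≤⟨ ℚ.+-monoˡ-≤ ε (p≤∣p∣ (r - z)) ⟩
      ∣ r - z ∣ + ε                 ≡⟨ cong (λ u → ∣ u - z ∣ + ε) u≡r ⟨
      ∣ uniformOn S i - z ∣ + ε     ∎)
      (small i value ε 0<ε)

  -- Concentration of the size of a random subset

  eventually-< : ∀ K {P : ℕ → ℕ → Set} → (∀ k → Eventually (P k)) → Eventually (λ N → ∀ k → k ℕ.< K → P k N)
  eventually-< zero    h = 0 , λ _ _ _ ()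
  eventually-< (suc K) {P} h = eventually-map extend (eventually-× (h K) (eventually-< K h))
    where
    extend : ∀ N → P K N × (∀ k → k ℕ.< K → P k N) → ∀ k → k ℕ.< suc K → P k N
    extend N (last , rest) k k<1+K with ℕ.m<1+n⇒m<n∨m≡n k<1+K
    ... | inj₁ k<K  = rest k k<K
    ... | inj₂ refl = last

  eventually-→ : ∀ {A : Set} {P : ℕ → Set} → Dec A → (A → Eventually P) → Eventually (λ N → A → P N)
  eventually-→ (yes a) h = eventually-map (λ _ p _ → p) (h a)
  eventually-→ (no ¬a) h = 0 , λ _ _ a → contradiction a ¬a

  percent : ℚ
  percent = ℤ.+ 1 ℚ./ 100

  -- A random set R of density 1 / 4ᵏ has expected size m = n / 4ᵏ, here at least 1200, and is
  -- therefore likely to be in the range of level k.  The reciprocal of m is κ.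
  module Concentration {n k : ℕ} (large : natℚ 1200 * natℚ (4 ℕ.^ k) ≤ natℚ n) where
    private
      F m κ : ℚ
      F = natℚ (4 ℕ.^ k)
      m = natℚ n * density k
      κ = F * inv n

      1≤F : 1ℚ ≤ F
      1≤F = natℚ-mono {1} (ℕ.m^n>0 4 k)

      0≤F : 0ℚ ≤ F
      0≤F = 0≤natℚ (4 ℕ.^ k)

      F*density : F * density k ≡ 1ℚ
      F*density = begin-equality
        F * density k
          ≡⟨ cong (_* density k) (trans (natℚ-4^ k) (sym (ℚ.*-identityˡ (2ℚ ^ k * 2ℚ ^ k)))) ⟩
        1ℚ * (2ℚ ^ k * 2ℚ ^ k) * (½ ^ k * ½ ^ k)
          ≡⟨ 4^-cancel k 1ℚ ⟩
        1ℚ ∎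

      Fm≡n : F * m ≡ natℚ n
      Fm≡n = begin-equality
        F * (natℚ n * density k)     ≡⟨ solve 3 (λ f n d → f :* (n :* d) := n :* (f :* d)) refl F (natℚ n) (density k) ⟩
        natℚ n * (F * density k)     ≡⟨ cong (natℚ n *_) F*density ⟩
        natℚ n * 1ℚ                  ≡⟨ ℚ.*-identityʳ (natℚ n) ⟩
        natℚ n                       ∎

      0<natℚn : 0ℚ < natℚ n
      0<natℚn = ℚ.<-≤-trans (*-0< (ℚ.positive⁻¹ (natℚ 1200)) (ℚ.<-≤-trans (ℚ.positive⁻¹ 1ℚ) 1≤F)) large

    0<n : 0 ℕ.< n
    0<n = ℕ.n≢0⇒n>0 λ n≡0 → ℚ.<-irrefl (cong natℚ (sym n≡0)) 0<natℚn

    private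
      0≤m : 0ℚ ≤ m
      0≤m = *-0≤ (0≤natℚ n) (proj₁ (density-probability k))

      0≤κ : 0ℚ ≤ κ
      0≤κ = *-0≤ 0≤F (0≤inv n)

      κm≡1 : κ * m ≡ 1ℚ
      κm≡1 = begin-equality
        F * inv n * m        ≡⟨ solve 3 (λ f i m → f :* i :* m := (f :* m) :* i) refl F (inv n) m ⟩
        F * m * inv n        ≡⟨ cong (_* inv n) Fm≡n ⟩
        natℚ n * inv n       ≡⟨ inv-inverse 0<n ⟩
        1ℚ                   ∎

      1200κ≤1 : natℚ 1200 * κ ≤ 1ℚ
      1200κ≤1 = begin
        natℚ 1200 * (F * inv n)    ≡⟨ ℚ.*-assoc (natℚ 1200) F (inv n) ⟨
        natℚ 1200 * F * inv n      ≤⟨ *-monoʳ (inv n) (0≤inv n) large ⟩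
        natℚ n * inv n             ≡⟨ inv-inverse 0<n ⟩
        1ℚ                         ∎

      dev : Subset n → ℚ
      dev R = natℚ ∣ R ∣ₛ - m

      E-dev² : E (density k) (λ R → dev R * dev R) ≤ m
      E-dev² = subst₂ _≤_
        (E-cong {n} (density k) (λ R → cong₂ {A = Subset n} {B = ℕ} (λ A a → (natℚ ∣ A ∣ₛ - natℚ a * density k) * (natℚ ∣ A ∣ₛ - natℚ a * density k)) (∩-identityˡ R) (∣⊤∣≡n n)))
        (cong (λ a → natℚ a * density k) (∣⊤∣≡n n))
        (E-variance (density-probability k) (⊤ {n}))

      -- Sets of nearly the expected size are in the range of level k.
      typical : ∀ R → natℚ 4 * (dev R * dev R) ≤ m * m → 0 ℕ.< ∣ R ∣ₛ × InRange n k (inv ∣ R ∣ₛ)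
      typical R close = 0<∣R∣ , lower , upper
        where
        X r : ℚ
        X = natℚ ∣ R ∣ₛ
        r = inv ∣ R ∣ₛ
        0≤½m = *-0≤ (ℚ.nonNegative⁻¹ ½) 0≤m
        dev²≤ : dev R * dev R ≤ ½ * m * (½ * m)
        dev²≤ = begin
          dev R * dev R                       ≡⟨ solve 1 (λ x → x := con ¼ :* (con (natℚ 4) :* x)) refl (dev R * dev R) ⟩
          ¼ * (natℚ 4 * (dev R * dev R))      ≤⟨ *-monoˡ ¼ (ℚ.nonNegative⁻¹ ¼) close ⟩
          ¼ * (m * m)                         ≡⟨ solve 1 (λ m → con ¼ :* (m :* m) := con ½ :* m :* (con ½ :* m)) refl m ⟩
          ½ * m * (½ * m)                     ∎
        X-m≤ : X - m ≤ ½ * m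
        X-m≤ = square-cancel 0≤½m dev²≤
        m-X≤ : m - X ≤ ½ * m
        m-X≤ = square-cancel 0≤½m (subst (_≤ ½ * m * (½ * m))
          (solve 2 (λ x m → (x :- m) :* (x :- m) := (m :- x) :* (m :- x)) refl X m) dev²≤)
        n≤2FX : natℚ n ≤ 2ℚ * F * X
        n≤2FX = begin
          natℚ n       ≡⟨ Fm≡n ⟨
          F * m        ≤⟨ ≤-from (2ℚ * F * (½ * m - (m - X)))
                            (solve 3 (λ f m x → con 2ℚ :* f :* x := f :* m :+ con 2ℚ :* f :* (con ½ :* m :- (m :- x))) refl F m X)
                            (*-0≤ (*-0≤ 0≤2 0≤F) (difference-nonneg m-X≤)) ⟩
          2ℚ * F * X   ∎
        0<∣R∣ : 0 ℕ.< ∣ R ∣ₛ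
        0<∣R∣ = ℕ.n≢0⇒n>0 λ none → ℚ.<-irrefl refl (begin-strict
          0ℚ                         <⟨ 0<natℚn ⟩
          natℚ n                     ≤⟨ n≤2FX ⟩
          2ℚ * F * X                 ≡⟨ trans (cong (λ c → 2ℚ * F * natℚ c) none) (ℚ.*-zeroʳ (2ℚ * F)) ⟩
          0ℚ                         ∎)
        Xr≡1 = inv-inverse 0<∣R∣
        lower : 2ℚ * F ≤ natℚ 3 * (natℚ n * r)
        lower = begin
          2ℚ * F                     ≡⟨ ℚ.*-identityʳ (2ℚ * F) ⟨
          2ℚ * F * 1ℚ                ≡⟨ cong (2ℚ * F *_) Xr≡1 ⟨
          2ℚ * F * (X * r)           ≤⟨ ≤-from (2ℚ * F * r * (½ * m - (X - m)))
                                          (solve 4 (λ f m x r → con (natℚ 3) :* (f :* m :* r)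
                                            := con 2ℚ :* f :* (x :* r) :+ con 2ℚ :* f :* r :* (con ½ :* m :- (x :- m))) refl F m X r)
                                          (*-0≤ (*-0≤ (*-0≤ 0≤2 0≤F) (0≤inv ∣ R ∣ₛ)) (difference-nonneg X-m≤)) ⟩
          natℚ 3 * (F * m * r)       ≡⟨ cong (λ x → natℚ 3 * (x * r)) Fm≡n ⟩
          natℚ 3 * (natℚ n * r)      ∎
        upper : natℚ n * r ≤ 2ℚ * F
        upper = begin
          natℚ n * r                 ≤⟨ *-monoʳ r (0≤inv ∣ R ∣ₛ) n≤2FX ⟩
          2ℚ * F * X * r             ≡⟨ ℚ.*-assoc (2ℚ * F) X r ⟩
          2ℚ * F * (X * r)           ≡⟨ cong (2ℚ * F *_) Xr≡1 ⟩
          2ℚ * F * 1ℚ                ≡⟨ ℚ.*-identityʳ (2ℚ * F) ⟩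
          2ℚ * F                     ∎

    -- By Chebyshev's inequality: subtracting 12 (∣R∣ - m)² / m² from 2/3 - 1/100 leaves a lower
    -- bound for f at every set, because for atypical sets the subtracted term is at least 3
    -- and f is at least -2.  Its expected value is at most 12 / m.
    expectation≥ : (f : Subset n → ℚ) → (∀ R → ∣ f R ∣ ≤ 2ℚ) →
      (∀ R → 0 ℕ.< ∣ R ∣ₛ × InRange n k (inv ∣ R ∣ₛ) → 1ℚ - ⅓ ≤ f R + percent) →
      1ℚ - ⅓ - 2ℚ * percent ≤ E (density k) f
    expectation≥ f ∣f∣≤2 good = begin
      1ℚ - ⅓ - 2ℚ * percent
        ≤⟨ ≤-from (percent * (1ℚ - natℚ 1200 * κ))
             (solve 1 (λ κ → con (1ℚ - ⅓ - percent) :- con (natℚ 12) :* κ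
               := con (1ℚ - ⅓ - 2ℚ * percent) :+ con percent :* (con 1ℚ :- con (natℚ 1200) :* κ)) refl κ)
             (*-0≤ (ℚ.nonNegative⁻¹ percent) (difference-nonneg 1200κ≤1)) ⟩
      1ℚ - ⅓ - percent - natℚ 12 * κ
        ≡⟨ cong (λ z → 1ℚ - ⅓ - percent - natℚ 12 * z) (trans (sym (ℚ.*-identityʳ κ))
             (trans (cong (κ *_) (sym κm≡1)) (solve 2 (λ κ m → κ :* (κ :* m) := κ :* κ :* m) refl κ m))) ⟩
      1ℚ - ⅓ - percent - natℚ 12 * (κ * κ * m)
        ≤⟨ ≤-from (natℚ 12 * (κ * κ) * (m - E (density k) (λ R → dev R * dev R)))
             (solve 3 (λ κ m v → con (1ℚ - ⅓ - percent) :- con (natℚ 12) :* (κ :* κ) :* v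
               := con (1ℚ - ⅓ - percent) :- con (natℚ 12) :* (κ :* κ :* m) :+ con (natℚ 12) :* (κ :* κ) :* (m :- v)) refl κ m (E (density k) (λ R → dev R * dev R)))
             (*-0≤ (*-0≤ (0≤natℚ 12) (*-0≤ 0≤κ 0≤κ)) (difference-nonneg E-dev²)) ⟩
      1ℚ - ⅓ - percent - natℚ 12 * (κ * κ) * E (density k) (λ R → dev R * dev R)
        ≡⟨ cong₂ _-_ (E-const n (density k) (1ℚ - ⅓ - percent)) (E-* (density k) (natℚ 12 * (κ * κ)) (λ R → dev R * dev R)) ⟨
      E {n} (density k) (λ _ → 1ℚ - ⅓ - percent) - E (density k) (λ R → natℚ 12 * (κ * κ) * (dev R * dev R))
        ≡⟨ E-difference (density k) (λ _ → 1ℚ - ⅓ - percent) (λ R → natℚ 12 * (κ * κ) * (dev R * dev R)) ⟨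
      E (density k) (λ R → 1ℚ - ⅓ - percent - natℚ 12 * (κ * κ) * (dev R * dev R))
        ≤⟨ E-mono (density-probability k) pointwise ⟩
      E (density k) f ∎
      where
      pointwise : ∀ R → 1ℚ - ⅓ - percent - natℚ 12 * (κ * κ) * (dev R * dev R) ≤ f R
      pointwise R = by-size (natℚ 4 * (dev R * dev R) ℚ.≤? m * m)
        where
        by-size : Dec (natℚ 4 * (dev R * dev R) ≤ m * m) → 1ℚ - ⅓ - percent - natℚ 12 * (κ * κ) * (dev R * dev R) ≤ f R
        by-size (yes close) = begin
          1ℚ - ⅓ - percent - natℚ 12 * (κ * κ) * (dev R * dev R)
            ≤⟨ ≤-from (natℚ 12 * (κ * κ) * (dev R * dev R) + (f R + percent - (1ℚ - ⅓)))
                 (solve 2 (λ z f → f := con (1ℚ - ⅓ - percent) :- z :+ (z :+ (f :+ con percent :- con (1ℚ - ⅓)))) refl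
                   (natℚ 12 * (κ * κ) * (dev R * dev R)) (f R))
                 (+-0≤ (*-0≤ (*-0≤ (0≤natℚ 12) (*-0≤ 0≤κ 0≤κ)) (square-nonneg (dev R))) (difference-nonneg (good R (typical R close)))) ⟩
          f R ∎
        by-size (no far) = begin
          1ℚ - ⅓ - percent - natℚ 12 * (κ * κ) * (dev R * dev R)
            ≤⟨ ≤-from (natℚ 3 * (κ * κ * (natℚ 4 * (dev R * dev R)) - κ * κ * (m * m)) + (⅓ + percent) + natℚ 3 * (κ * m * (κ * m) - 1ℚ))
                 (solve 3 (λ κ m d → :- con 2ℚ := con (1ℚ - ⅓ - percent) :- con (natℚ 12) :* (κ :* κ) :* d
                   :+ (con (natℚ 3) :* (κ :* κ :* (con (natℚ 4) :* d) :- κ :* κ :* (m :* m)) :+ con (⅓ + percent)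
                     :+ con (natℚ 3) :* (κ :* m :* (κ :* m) :- con 1ℚ))) refl κ m (dev R * dev R))
                 (+-0≤ (+-0≤ (*-0≤ (0≤natℚ 3) (difference-nonneg (*-monoˡ (κ * κ) (*-0≤ 0≤κ 0≤κ) (ℚ.<⇒≤ (ℚ.≰⇒> far)))))
                   (ℚ.nonNegative⁻¹ (⅓ + percent)))
                   (ℚ.≤-reflexive (cong (λ z → natℚ 3 * (z * z - 1ℚ)) (sym κm≡1)))) ⟩
          - 2ℚ
            ≤⟨ ℚ.neg-antimono-≤ (ℚ.≤-trans (-p≤∣p∣ (f R)) (∣f∣≤2 R)) ⟩
          - - f R
            ≡⟨ solve 1 (λ x → :- :- x := x) refl (f R) ⟩
          f R ∎

  -- The threshold for the domain size

  eval-total : ∀ {n q} N S (T : Tester n q) →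
    eval N (payoff accept) S T + eval N (payoff reject) S T ≡ eval N (λ _ → 1ℚ) S T
  eval-total N S (decide accept) = refl
  eval-total N S (decide reject) = refl
  eval-total N S (toss coin T) = trans
    (sym (∑-distrib-+ (λ i → weight N coin i * eval N (payoff accept) S (T i)) (λ i → weight N coin i * eval N (payoff reject) S (T i))))
    (Σ-cong (λ i → trans (sym (ℚ.*-distribˡ-+ (weight N coin i) (eval N (payoff accept) S (T i)) (eval N (payoff reject) S (T i))))
      (cong (weight N coin i *_) (eval-total N S (T i)))))
  eval-total N S (query A ne T) = trans
    (sym (∑-distrib-+ (λ j → response S A j * eval N (payoff accept) S (T j)) (λ j → response S A j * eval N (payoff reject) S (T j))))
    (Σ-cong (λ j → trans (sym (ℚ.*-distribˡ-+ (response S A j) (eval N (payoff accept) S (T j)) (eval N (payoff reject) S (T j))))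
      (cong (response S A j *_) (eval-total N S (T j)))))

  ∣payoff∣≤1 : ∀ v w → ∣ payoff v w ∣ ≤ 1ℚ
  ∣payoff∣≤1 accept accept = ℚ.≤-refl
  ∣payoff∣≤1 accept reject = 0≤1
  ∣payoff∣≤1 reject accept = 0≤1
  ∣payoff∣≤1 reject reject = ℚ.≤-refl

  -- From this domain size on, Q queries do not suffice: there is room for
  -- 4 ^ (Q + 5) + 1 levels whose sets are expected to have at least 4 ^ 6 elements.
  threshold : ℕ → ℕ
  threshold Q = 4 ℕ.^ (4 ℕ.^ (Q ℕ.+ 5) ℕ.+ 6)

  -- A correct tester with Q queries is impossible: by totalVariation≤ its probabilities of
  -- acceptance vary too little over the K + 1 levels, but between any two consecutive levels
  -- they must change by at least 1/4.
  module LowerBound {n Q : ℕ} (T : Tester n Q) (isTester : IsTester (EvenLevel n) (fromℚ ⅛) (fromℚ ⅓) T)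
                    (threshold≤n : threshold Q ℕ.≤ n) where
    private
      K : ℕ
      K = 4 ℕ.^ (Q ℕ.+ 5)

      large : ∀ k → k ℕ.< suc K → natℚ 1200 * natℚ (4 ℕ.^ k) ≤ natℚ n
      large k (s≤s k≤K) = begin
        natℚ 1200 * natℚ (4 ℕ.^ k)      ≤⟨ *-monoʳ (natℚ (4 ℕ.^ k)) (0≤natℚ (4 ℕ.^ k)) (natℚ-mono {1200} {4 ℕ.^ 6} (ℕ.m≤m+n 1200 2896)) ⟩
        natℚ (4 ℕ.^ 6) * natℚ (4 ℕ.^ k) ≡⟨ natℚ-* (4 ℕ.^ 6) (4 ℕ.^ k) ⟨
        natℚ (4 ℕ.^ 6 ℕ.* 4 ℕ.^ k)      ≡⟨ cong natℚ (trans (ℕ.*-comm (4 ℕ.^ 6) (4 ℕ.^ k)) (sym (ℕ.^-distribˡ-+-* 4 k 6))) ⟩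
        natℚ (4 ℕ.^ (k ℕ.+ 6))          ≤⟨ natℚ-mono (ℕ.≤-trans (ℕ.^-monoʳ-≤ 4 (ℕ.+-monoˡ-≤ 6 k≤K)) threshold≤n) ⟩
        natℚ n                          ∎

      0<n : 0 ℕ.< n
      0<n = ℕ.<-≤-trans (ℕ.m^n>0 4 (K ℕ.+ 6)) threshold≤n

      -- At the index N, the tester is correct on the uniform distribution on S, up to 1/100,
      -- provided that S is in the range of level k.
      Correct : ℕ → Subset n → ℕ → Set
      Correct k S N = 0 ℕ.< ∣ S ∣ₛ × InRange n k (inv ∣ S ∣ₛ) → 1ℚ - ⅓ ≤ eval N (payoff (verdictAt k)) S T + percent

      0<percent : 0ℚ < percent
      0<percent = ℚ.positive⁻¹ percent

      correct : ∀ k S → Eventually (Correct k S)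
      correct k S = eventually-→
        ((0 ℕ.<? ∣ S ∣ₛ) ×-dec ((2ℚ * natℚ (4 ℕ.^ k) ℚ.≤? natℚ 3 * (natℚ n * inv ∣ S ∣ₛ)) ×-dec (natℚ n * inv ∣ S ∣ₛ ℚ.≤? 2ℚ * natℚ (4 ℕ.^ k))))
        λ (0<∣S∣ , range) → by-verdict 0<∣S∣ range (verdictAt k) refl
        where
        by-verdict : (0<∣S∣ : 0 ℕ.< ∣ S ∣ₛ) → InRange n k (inv ∣ S ∣ₛ) → ∀ v → verdictAt k ≡ v →
          Eventually (λ N → 1ℚ - ⅓ ≤ eval N (payoff (verdictAt k)) S T + percent)
        by-verdict 0<∣S∣ range accept even = eventually-map
          (λ N h → subst (λ v → 1ℚ - ⅓ ≤ eval N (payoff v) S T + percent) (sym even)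
            (subst (λ x → 1ℚ - ⅓ ≤ x + percent) (UniformOracle.outputProb-eval S 0<∣S∣ T accept N) h))
          (ℝ._≤_.eventually (IsTester.accepts isTester (uniform S 0<∣S∣) (UniformOracle.oracle S 0<∣S∣)
            (k , even , inv ∣ S ∣ₛ , range , values)) percent 0<percent)
          where
          values : ∀ i → fromℚ (uniformOn S i) ℝ.≃ 0ℝ ⊎ fromℚ (uniformOn S i) ℝ.≃ fromℚ (inv ∣ S ∣ₛ)
          values i with uniformOn-values S i
          ... | inj₁ e = inj₁ (≃-everywhere (λ _ → e))
          ... | inj₂ e = inj₂ (≃-everywhere (λ _ → e))
        by-verdict 0<∣S∣ range reject odd = eventually-map
          (λ N h → subst (λ v → 1ℚ - ⅓ ≤ eval N (payoff v) S T + percent) (sym odd)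
            (subst (λ x → 1ℚ - ⅓ ≤ x + percent) (UniformOracle.outputProb-eval S 0<∣S∣ T reject N) h))
          (ℝ._≤_.eventually (IsTester.rejects isTester (uniform S 0<∣S∣) (UniformOracle.oracle S 0<∣S∣)
            (odd-far {n} {k} 0<n S 0<∣S∣ odd range)) percent 0<percent)

      -- A bound for the total weight of the coins at late indices.
      C : ℚ
      C = 1ℚ + percent

      C≤2 : C ≤ 2ℚ
      C≤2 = from-yes (C ℚ.≤? 2ℚ)

      at-good-index : ∃[ N ] (WeightBound N C T × (∀ k → k ℕ.< suc K → ∀ S → Correct k S N))
      at-good-index = let (N , h) = good in N , h N ℕ.≤-refl
        where
        good : Eventually (λ N → WeightBound N C T × (∀ k → k ℕ.< suc K → ∀ S → Correct k S N))
        good = eventually-×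
          (weights-bounded T percent 0<percent (from-yes (percent ℚ.≤? 1ℚ)))
          (eventually-< (suc K) (λ k → eventually-Subset (correct k)))

    module _ (N : ℕ) (bound : WeightBound N C T) (correctAt : ∀ k → k ℕ.< suc K → ∀ S → Correct k S N) where
      private
        open Variation N (payoff accept) (∣payoff∣≤1 accept)

        -- The probability of the verdict v at level k.
        V : Verdict → ℕ → ℚ
        V v k = E (density k) (λ R → eval N (payoff v) (⊥ ∪ R) T)

        correct-verdict : ∀ k → k ℕ.< suc K → 1ℚ - ⅓ - 2ℚ * percent ≤ V (verdictAt k) k
        correct-verdict k k≤K = Concentration.expectation≥ {n} {k} (large k k≤K)
          (λ R → eval N (payoff (verdictAt k)) (⊥ ∪ R) T)
          (λ R → ℚ.≤-trans (Evaluation.∣eval∣≤ N (payoff (verdictAt k)) (∣payoff∣≤1 (verdictAt k)) bound (⊥ ∪ R)) C≤2)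
          (λ R typical → subst (λ S → 1ℚ - ⅓ ≤ eval N (payoff (verdictAt k)) S T + percent) (sym (∪-identityˡ R))
            (correctAt k k≤K R typical))

        total-verdict : ∀ k → V accept k + V reject k ≤ C
        total-verdict k = begin
          V accept k + V reject k
            ≡⟨ E-+ (density k) (λ R → eval N (payoff accept) (⊥ ∪ R) T) (λ R → eval N (payoff reject) (⊥ ∪ R) T) ⟨
          E (density k) (λ R → eval N (payoff accept) (⊥ ∪ R) T + eval N (payoff reject) (⊥ ∪ R) T)
            ≤⟨ E-mono (density-probability k) (λ R → ℚ.≤-trans (ℚ.≤-reflexive (eval-total N (⊥ ∪ R) T))
                 (ℚ.≤-trans (p≤∣p∣ (eval N (λ _ → 1ℚ) (⊥ ∪ R) T)) (Evaluation.∣eval∣≤ N (λ _ → 1ℚ) (λ _ → ℚ.≤-refl) bound (⊥ ∪ R)))) ⟩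
          E {n} (density k) (λ _ → C)
            ≡⟨ E-const n (density k) C ⟩
          C ∎

        -- Here a is a probability of acceptance where T should accept, and a′ and r′ are the
        -- probabilities of acceptance and rejection where T should reject.
        spread : ∀ {a a′ r′} → 1ℚ - ⅓ - 2ℚ * percent ≤ a → 1ℚ - ⅓ - 2ℚ * percent ≤ r′ → a′ + r′ ≤ C → ¼ ≤ a - a′
        spread {a} {a′} {r′} ≤a ≤r′ a′+r′≤C = ≤-from
          ((a - b) + (r′ - b) + (C - (a′ + r′)) + (b + b - C - ¼))
          (solve 5 (λ a a′ r′ b C → a :- a′ := con ¼ :+ ((a :- b) :+ (r′ :- b) :+ (C :- (a′ :+ r′)) :+ (b :+ b :- C :- con ¼))) refl a a′ r′ b C)
          (+-0≤ (+-0≤ (+-0≤ (difference-nonneg ≤a) (difference-nonneg ≤r′)) (difference-nonneg a′+r′≤C))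
            (from-yes (0ℚ ℚ.≤? (b + b - C - ¼))))
          where
          b = 1ℚ - ⅓ - 2ℚ * percent

        D≥¼ : ∀ k → k ℕ.< K → ¼ ≤ D k ⊥ T
        D≥¼ k k<K = by-verdict (verdictAt k) (correct-verdict k (ℕ.m≤n⇒m≤1+n k<K)) (correct-verdict (suc k) (s≤s k<K))
          where
          by-verdict : ∀ v → 1ℚ - ⅓ - 2ℚ * percent ≤ V v k → 1ℚ - ⅓ - 2ℚ * percent ≤ V (opposite v) (suc k) → ¼ ≤ D k ⊥ T
          by-verdict accept accepted rejected = begin
            ¼                                       ≤⟨ spread {V accept k} {V accept (suc k)} accepted rejected (total-verdict (suc k)) ⟩
            V accept k - V accept (suc k)           ≤⟨ p≤∣p∣ (V accept k - V accept (suc k)) ⟩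
            ∣ V accept k - V accept (suc k) ∣       ≡⟨ ∣∣-sym (V accept k) (V accept (suc k)) ⟩
            ∣ V accept (suc k) - V accept k ∣       ∎
          by-verdict reject rejected accepted = begin
            ¼                                       ≤⟨ spread {V accept (suc k)} {V accept k} accepted rejected (total-verdict k) ⟩
            V accept (suc k) - V accept k           ≤⟨ p≤∣p∣ (V accept (suc k) - V accept k) ⟩
            ∣ V accept (suc k) - V accept k ∣       ∎

        -- Here K = 1024 F, so that K / 4 = 256 F.
        F : ℚ
        F = natℚ (4 ℕ.^ Q)

        256F≤96F : natℚ 256 * F ≤ natℚ 96 * F
        256F≤96F = begin
          natℚ 256 * F
            ≡⟨ solve 1 (λ f → con (natℚ 256) :* f := f :* con (natℚ 1024) :* con ¼) refl F ⟩
          F * natℚ 1024 * ¼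
            ≡⟨ cong (_* ¼) (trans (cong natℚ (ℕ.^-distribˡ-+-* 4 Q 5)) (natℚ-* (4 ℕ.^ Q) 1024)) ⟨
          natℚ K * ¼
            ≡⟨ Σ-const K ¼ ⟨
          Σ {K} (λ _ → ¼)
            ≤⟨ Σ-mono {K} (λ k → D≥¼ (toℕ k) (toℕ<n k)) ⟩
          totalVariation K ⊥ T
            ≤⟨ totalVariation≤ K bound ⊥ (ℕ.≤-reflexive (cong (ℕ._+ Q) (∣⊥∣≡0 n))) ⟩
          variationBound Q Q * C
            ≤⟨ *-mono (0≤variationBound Q Q) (variationBound≤ Q) (bound-nonneg bound) C≤2 ⟩
          natℚ (48 ℕ.* 4 ℕ.^ Q) * 2ℚ
            ≡⟨ cong (_* 2ℚ) (natℚ-* 48 (4 ℕ.^ Q)) ⟩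
          natℚ 48 * F * 2ℚ
            ≡⟨ solve 1 (λ f → con (natℚ 48) :* f :* con 2ℚ := con (natℚ 96) :* f) refl F ⟩
          natℚ 96 * F ∎

      contradiction-at : 0ℚ < 0ℚ
      contradiction-at = begin-strict
        0ℚ                               <⟨ *-0< (ℚ.positive⁻¹ (natℚ 160)) (ℚ.<-≤-trans (ℚ.positive⁻¹ 1ℚ) (natℚ-mono {1} (ℕ.m^n>0 4 Q))) ⟩
        natℚ 160 * F                     ≡⟨ solve 1 (λ f → con (natℚ 160) :* f := con (natℚ 256) :* f :- con (natℚ 96) :* f) refl F ⟩
        natℚ 256 * F - natℚ 96 * F       ≤⟨ ℚ.+-monoˡ-≤ (- (natℚ 96 * F)) 256F≤96F ⟩
        natℚ 96 * F - natℚ 96 * F        ≡⟨ ℚ.+-inverseʳ (natℚ 96 * F) ⟩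
        0ℚ                               ∎

    impossible : 0ℚ < 0ℚ
    impossible = let (N , bound , correctAt) = at-good-index in contradiction-at N bound correctAt

  -- Iterated logarithms

  log₂-approx≤ : ∀ k {p} L → p ≤ 2ℚ ^ L → log₂-approx k p ≤ natℚ L
  log₂-approx≤ k {p} L p≤2^L = begin
    natℚ a * ½ ^ k                        ≤⟨ *-monoʳ (½ ^ k) (0≤½^ k) (natℚ-mono a≤) ⟩
    natℚ (L ℕ.* 2 ℕ.^ k) * ½ ^ k          ≡⟨ cong (_* ½ ^ k) (trans (natℚ-* L (2 ℕ.^ k)) (cong (natℚ L *_) (natℚ-^ k))) ⟩
    natℚ L * 2ℚ ^ k * ½ ^ k               ≡⟨ ℚ.*-assoc (natℚ L) (2ℚ ^ k) (½ ^ k) ⟩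
    natℚ L * (2ℚ ^ k * ½ ^ k)             ≡⟨ cong (natℚ L *_) (2^*½^ k) ⟩
    natℚ L * 1ℚ                           ≡⟨ ℚ.*-identityʳ (natℚ L) ⟩
    natℚ L                                ∎
    where
    a = log₂-index k p
    a≤ : a ℕ.≤ L ℕ.* 2 ℕ.^ k
    a≤ = 2^-cancel (begin
      2ℚ ^ a                              ≤⟨ log₂-lower k p ⟩
      (1ℚ ℚ.⊔ p) ^ (2 ℕ.^ k)              ≤⟨ ^-monoˡ (2 ℕ.^ k) (ℚ.≤-trans 0≤1 (ℚ.p≤p⊔q 1ℚ p)) (ℚ.⊔-lub (1≤^ L (ℚ.<⇒≤ 1<2)) p≤2^L) ⟩
      (2ℚ ^ L) ^ (2 ℕ.^ k)                ≡⟨ ^-assocʳ 2ℚ L (2 ℕ.^ k) ⟩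
      2ℚ ^ (L ℕ.* 2 ℕ.^ k)                ∎)

  √-approx≤ : ∀ k {p s} → 0ℚ ≤ s → p ≤ s * s → √-approx k p ≤ s
  √-approx≤ k {p} {s} 0≤s p≤s² = square-cancel 0≤s
    (ℚ.≤-trans (√-lower k p) (ℚ.⊔-lub (*-0≤ 0≤s 0≤s) p≤s²))

  log₂-seq≤ : ∀ {x} L → (∀ k → seq x k ≤ 2ℚ ^ L) → ∀ k → seq (log₂ x) k ≤ natℚ L
  log₂-seq≤ L x≤ k = log₂-approx≤ k L (x≤ k)

  √-seq≤ : ∀ {x s} → 0ℚ ≤ s → (∀ k → seq x k ≤ s * s) → ∀ k → seq (√ x) k ≤ s
  √-seq≤ 0≤s x≤ k = √-approx≤ k 0≤s (x≤ k)

  ¼*-≤ : ∀ {x} s → (∀ k → seq x k ≤ natℚ 4 * natℚ s) → fromℚ ¼ ℝ.* x ℝ.≤ fromℕ s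
  ¼*-≤ s x≤ = ≤-everywhere λ k → ℚ.≤-trans (*-monoˡ ¼ (ℚ.nonNegative⁻¹ ¼) (x≤ k))
    (ℚ.≤-reflexive (solve 1 (λ x → con ¼ :* (con (natℚ 4) :* x) := x) refl (natℚ s)))

  threshold≤ : ∀ q → threshold q ℕ.≤ 2 ℕ.^ (2 ℕ.^ (2 ℕ.* (q ℕ.+ 6)))
  threshold≤ q = ℕ.≤-trans (ℕ.≤-reflexive (ℕ.^-*-assoc 2 2 (M ℕ.+ 6)))
    (ℕ.^-monoʳ-≤ 2 (ℕ.≤-trans exponent (ℕ.≤-reflexive (ℕ.^-*-assoc 2 2 (q ℕ.+ 6)))))
    where
    M = 4 ℕ.^ (q ℕ.+ 5)
    6≤M : 6 ℕ.≤ M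
    6≤M = ℕ.≤-trans (ℕ.m≤m+n 6 1018) (ℕ.^-monoʳ-≤ 4 (ℕ.m≤n+m 5 q))
    exponent : 2 ℕ.* (M ℕ.+ 6) ℕ.≤ 4 ℕ.^ (q ℕ.+ 6)
    exponent = ℕ.≤-trans (ℕ.*-monoʳ-≤ 2 (ℕ.+-monoʳ-≤ M (ℕ.≤-trans 6≤M (ℕ.m≤m+n M 0))))
      (ℕ.≤-reflexive (trans (sym (ℕ.*-assoc 2 2 M)) (cong (4 ℕ.^_) (sym (ℕ.+-suc q 5)))))

  √log₂log₂≤ : ∀ {n} L s → n ℕ.≤ 2 ℕ.^ (2 ℕ.^ L) → L ℕ.≤ 16 ℕ.* (s ℕ.* s) →
    fromℚ ¼ ℝ.* √ (log₂ (log₂ (fromℕ n))) ℝ.≤ fromℕ s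
  √log₂log₂≤ {n} L s n≤ L≤ = ¼*-≤ {√ (log₂ (log₂ (fromℕ n)))} s
    (√-seq≤ {log₂ (log₂ (fromℕ n))} (*-0≤ (0≤natℚ 4) (0≤natℚ s)) λ k → ℚ.≤-trans
      (log₂-seq≤ {log₂ (fromℕ n)} L (λ k → subst (seq (log₂ (fromℕ n)) k ≤_) (natℚ-^ L)
        (log₂-seq≤ {fromℕ n} (2 ℕ.^ L) (λ _ → n≤′) k)) k)
      L≤′)
    where
    n≤′ : natℚ n ≤ 2ℚ ^ (2 ℕ.^ L)
    n≤′ = subst (natℚ n ≤_) (natℚ-^ (2 ℕ.^ L)) (natℚ-mono n≤)
    L≤′ : natℚ L ≤ natℚ 4 * natℚ s * (natℚ 4 * natℚ s)
    L≤′ = begin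
      natℚ L
        ≤⟨ natℚ-mono L≤ ⟩
      natℚ (16 ℕ.* (s ℕ.* s))
        ≡⟨ trans (natℚ-* 16 (s ℕ.* s)) (cong (natℚ 16 *_) (natℚ-* s s)) ⟩
      natℚ 16 * (natℚ s * natℚ s)
        ≡⟨ solve 1 (λ x → con (natℚ 16) :* (x :* x) := con (natℚ 4) :* x :* (con (natℚ 4) :* x)) refl (natℚ s) ⟩
      natℚ 4 * natℚ s * (natℚ 4 * natℚ s) ∎

  2[q+6]≤16q² : ∀ {q} → 0 ℕ.< q → 2 ℕ.* (q ℕ.+ 6) ℕ.≤ 16 ℕ.* (q ℕ.* q)
  2[q+6]≤16q² {q@(suc _)} _ = ℕ.≤-trans
    (ℕ.*-monoʳ-≤ 2 (ℕ.+-monoʳ-≤ q (ℕ.≤-trans (ℕ.m≤m+n 6 1) (ℕ.m≤m*n 7 q))))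
    (ℕ.≤-trans (ℕ.≤-reflexive (sym (ℕ.*-assoc 2 8 q))) (ℕ.*-monoʳ-≤ 16 (ℕ.m≤m*n q q)))

  -- If n is below the threshold, then q is positive because n is at least threshold 0,
  -- and the iterated logarithm of n is at most 2 (q + 6), which is at most (4 q)².
  queries≥ : ∀ n → threshold 0 ℕ.≤ n → ∀ q (T : Tester n q) → IsTester (EvenLevel n) (fromℚ ⅛) (fromℚ ⅓) T →
    fromℚ ¼ ℝ.* √ (log₂ (log₂ (fromℕ n))) ℝ.≤ fromℕ q
  queries≥ n n₀≤n q T isTester = by-size (threshold q ℕ.≤? n)
    where
    by-size : Dec (threshold q ℕ.≤ n) → fromℚ ¼ ℝ.* √ (log₂ (log₂ (fromℕ n))) ℝ.≤ fromℕ q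
    by-size (yes threshold≤n) = ⊥-elim (ℚ.<-irrefl {0ℚ} refl (LowerBound.impossible T isTester threshold≤n))
    by-size (no  threshold≰n) = √log₂log₂≤ {n} (2 ℕ.* (q ℕ.+ 6)) q
      (ℕ.≤-trans (ℕ.<⇒≤ (ℕ.≰⇒> threshold≰n)) (threshold≤ q))
      (2[q+6]≤16q² {q} (ℕ.n≢0⇒n>0 λ q≡0 → threshold≰n (subst (λ q → threshold q ℕ.≤ n) (sym q≡0) n₀≤n)))

  positiveℝ : ∀ {q} → 0ℚ < q → 0ℝ ℝ.< fromℚ q
  positiveℝ {q} 0<q = ℝ.<-intro q 0<q (0 , λ _ _ → ℚ.≤-reflexive (ℚ.+-identityˡ q))

open import Data.Integer.Base using (+_)
open Defs using (_<_; _≤_; _*_)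
open TesterLowerBound

theorem7p3p1 : ∃[ ε ] ∃[ c ] Σ[ P ∈ ((n : ℕ) → Property n) ]
    (0ℝ < ε × 0ℝ < c × (∀ n → LabelInvariant (P n)) ×
    ∃[ n₀ ] (∀ n → n₀ ℕ.≤ n → ∀ q (T : Tester n q) →
    IsTester (P n) ε (fromℚ (+ 1 / 3)) T →
    c * √ (log₂ (log₂ (fromℕ n))) ≤ fromℕ q))
theorem7p3p1 =
  fromℚ ⅛ , fromℚ ¼ , EvenLevel ,
  positiveℝ (ℚ.positive⁻¹ ⅛) , positiveℝ (ℚ.positive⁻¹ ¼) , evenLevel-invariant ,
  threshold 0 , queries≥
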